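{- The problem Mersenne-Number-SAT is $\mathbf{MNS}$-complete: it belongs to $\mathbf{MNS}$, and every language in $\mathbf{MNS}$ is polynomial-time many-one reducible to it.
   Context: A Mersenne number is an integer of the form $2^t-1$ with $t\in\{1,2,3,\dots\}$. A language $L$ is in the complexity class $\mathbf{MNS}$ if there exist a polynomial $p$ and a polynomial-time computable predicate $R$ such that for every $x$: $x\in L \iff |\{y : |y|=p(|x|) \wedge R(x,y)\}| = 2^t-1$ for some $t\in\{1,2,3,\dots\}$. Mersenne-Number-SAT is the problem: given a Boolean formula in conjunctive normal form, decide whether its number of satisfying truth assignments is a Mersenne number. -}

module Defs where

open import Data.Nat using (ℕ; zero; suc; _+_; _*_; _^_; _∸_; _≤_)
open import Data.Bool using (Bool; true; false; if_then_else_)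
open import Data.Fin using (Fin; toℕ)
open import Data.List using (List; []; _∷_; _++_; length; map; concatMap; replicate; filter)
open import Data.Bool.ListAction using (all; any)
open import Data.Maybe using (Maybe; just; nothing)
open import Data.Product using (Σ; _×_; _,_)
open import Data.Vec using (Vec; lookup)
import Data.Vec as Vec
open import Relation.Binary.PropositionalEquality using (_≡_)
open import Relation.Nullary.Decidable using (does)
open import Data.Bool.Properties using () renaming (_≟_ to _≟B_)
open import Function.Bundles using (_⇔_)

Str : Set
Str = List Bool

Language : Set₁
Language = Str → Set

Poly : Set
Poly = List ℕ

evalPoly : Poly → ℕ → ℕ
evalPoly []       n = 0
evalPoly (c ∷ cs) n = c + n * evalPoly cs n

-- Deterministic single-tape Turing machines.
-- Tape alphabet Fin (3 + k): 0 = blank, 1 = bit false, 2 = bit true,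
-- the remaining symbols are auxiliary work symbols.
-- The transition function returning nothing means: halt.

data Move : Set where
  left right stay : Move

record TM : Set where
  field
    nStates : ℕ
    nExtra  : ℕ
    start   : Fin nStates
    δ       : Fin nStates → Fin (3 + nExtra) →
              Maybe (Fin nStates × Fin (3 + nExtra) × Move)

module _ (M : TM) where
  open TM M

  Sym : Set
  Sym = Fin (3 + nExtra)

  blank : Sym
  blank = Fin.zero where import Data.Fin as Fin

  encBit : Bool → Sym
  encBit false = Data.Fin.suc Data.Fin.zero
  encBit true  = Data.Fin.suc (Data.Fin.suc Data.Fin.zero)

  -- configuration: state, tape to the left of the head (nearest cell
  -- first), tape from the head rightwards (empty = blanks)
  record Config : Set where
    constructor cfg
    field
      state : Fin nStates
      lft   : List Sym
      rgt   : List Sym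

  readHead : List Sym → Sym
  readHead []      = blank
  readHead (s ∷ _) = s

  dropHead : List Sym → List Sym
  dropHead []       = []
  dropHead (_ ∷ ss) = ss

  move : Move → List Sym → List Sym → List Sym × List Sym
  move left  []       r = [] , r               -- stays at the left end
  move left  (l ∷ ls) r = ls , l ∷ r
  move right ls       [] = blank ∷ ls , []
  move right ls  (s ∷ r) = s ∷ ls , r
  move stay  ls       r = ls , r

  step : Config → Maybe Config
  step (cfg q l r) with δ q (readHead r)
  ... | nothing            = nothing
  ... | just (q' , s , m)  with move m l (s ∷ dropHead r)
  ...   | l' , r' = just (cfg q' l' r')

  haltsWithin : ℕ → Config → Maybe Config
  haltsWithin k c with step c
  haltsWithin k       c | nothing = just c
  haltsWithin zero    c | just _  = nothing
  haltsWithin (suc k) c | just c' = haltsWithin k c'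

  initial : Str → Config
  initial x = cfg start [] (map encBit x)

  readBits : List Sym → Str
  readBits [] = []
  readBits (Data.Fin.suc Data.Fin.zero ∷ r) = false ∷ readBits r
  readBits (Data.Fin.suc (Data.Fin.suc Data.Fin.zero) ∷ r) = true ∷ readBits r
  readBits (_ ∷ r) = []

  output : Config → Str
  output c = readBits (Config.rgt c)

  ComputesIn : (ℕ → ℕ) → (Str → Str) → Set
  ComputesIn T f = ∀ x → Σ Config λ c →
    haltsWithin (T (length x)) (initial x) ≡ just c × output c ≡ f x

PolyTimeComputable : (Str → Str) → Set
PolyTimeComputable f = Σ TM λ M → Σ Poly λ p → ComputesIn M (evalPoly p) f

pair : Str → Str → Str
pair x y = concatMap (λ b → b ∷ b ∷ []) x ++ (false ∷ true ∷ []) ++ y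

PolyTimePredicate : (Str → Str → Bool) → Set
PolyTimePredicate R = Σ TM λ M → Σ Poly λ p →
  ∀ x y → Σ (Config M) λ c →
    haltsWithin M (evalPoly p (length (pair x y))) (initial M (pair x y)) ≡ just c
    × output M c ≡ R x y ∷ []

allStrings : ℕ → List Str
allStrings zero    = [] ∷ []
allStrings (suc n) = map (false ∷_) (allStrings n) ++ map (true ∷_) (allStrings n)

countWitnesses : (Str → Bool) → ℕ → ℕ
countWitnesses P n = length (filter (λ y → P y ≟B true) (allStrings n))

IsMersenne : ℕ → Set
IsMersenne k = Σ ℕ λ t → 1 ≤ t × k ≡ 2 ^ t ∸ 1

MNS : Language → Set
MNS L = Σ Poly λ p → Σ (Str → Str → Bool) λ R →
  PolyTimePredicate R ×
  (∀ x → L x ⇔ IsMersenne (countWitnesses (R x) (evalPoly p (length x))))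

-- CNF formulas over variables x₀ … x_{n-1}; a literal is a variable
-- together with the truth value that satisfies it (true = positive).

Literal : ℕ → Set
Literal n = Fin n × Bool

Clause : ℕ → Set
Clause n = List (Literal n)

CNF : ℕ → Set
CNF n = List (Clause n)

litSat : ∀ {n} → Vec Bool n → Literal n → Bool
litSat a (i , b) = does (lookup a i ≟B b)

cnfSat : ∀ {n} → Vec Bool n → CNF n → Bool
cnfSat a φ = all (any (litSat a)) φ

allAssignments : (n : ℕ) → List (Vec Bool n)
allAssignments zero    = Vec.[] ∷ []
allAssignments (suc n) =
  map (false Vec.∷_) (allAssignments n) ++ map (true Vec.∷_) (allAssignments n)

#sat : ∀ {n} → CNF n → ℕ
#sat {n} φ = length (filter (λ a → cnfSat a φ ≟B true) (allAssignments n))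

-- prefix-free unary encodings
encNat : ℕ → Str
encNat k = replicate k true ++ false ∷ []

encLit : ∀ {n} → Literal n → Str
encLit (i , b) = b ∷ encNat (toℕ i)

encClause : ∀ {n} → Clause n → Str
encClause c = encNat (length c) ++ concatMap encLit c

encCNF : ∀ {n} → CNF n → Str
encCNF {n} φ = encNat n ++ concatMap encClause φ

MersenneNumberSAT : Language
MersenneNumberSAT x = Σ ℕ λ n → Σ (CNF n) λ φ → encCNF φ ≡ x × IsMersenne (#sat φ)

_≤ₚ_ : Language → Language → Set
L ≤ₚ L' = Σ (Str → Str) λ f → PolyTimeComputable f × (∀ x → L x ⇔ L' (f x))

{-# OPTIONS --safe #-}
-- Membership: after the unary number n of variables, a code lists its clauses, so one pass over
-- x with a few counters parses it and evaluates it under y. Padding y with zeros to length |x|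
-- keeps one witness per satisfying assignment; a malformed x has no witness, and 0 is no Mersenne
-- number.
--
-- Hardness: the run of the verifier on (x , y) is a sequence of cells u in which the rows of the
-- tableau, of width W, follow one another, so that u (c + W + 1) is a function of u c, u (c + 1) and
-- u (c + 2): a wall between the rows absorbs the neighbours that belong to other rows. Encoding cells
-- by K bits, the clauses say that the first row is x with free bits for y, that this recurrence
-- holds, and that no cell shows a head that has halted without reading true. Apart from y all bits
-- are determined, so the satisfying assignments correspond to the accepted y. The clauses for
-- cell c arise from a constant pattern by a shift, hence nested loops over unary counters write them.
--
-- Machines: programs with sequence, branching and while loops are compiled to single-tape machines.
-- Tape symbols carry Boolean tracks, and a counter is a track that is true exactly below its value,
-- so each counter instruction costs a few sweeps over the used part of the tape.
module Submission where

open import Defs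
open import Data.Nat using (ℕ; zero; suc; _+_; _*_; _^_; _∸_; _≤_; _<_; z≤n; s≤s; pred; NonZero; nonZero; _<ᵇ_; _≤?_; _<?_; _/_; _%_; _⊔_; _⊓_)
open import Data.Nat.Properties
open import Data.Nat.DivMod using (_mod_; [m+kn]%n≡m%n; m<n⇒m%n≡m; m<n⇒m/n≡0; m*n/n≡m; +-distrib-/-∣ʳ; m%n<n; m≡m%n+[m/n]*n; m<n*o⇒m/o<n)
open import Data.Nat.Divisibility using (n∣m*n)
open import Data.Nat.Solver using (module +-*-Solver)
open import Data.Bool using (Bool; true; false; if_then_else_; not; _∧_; _∨_)
open import Data.Bool.ListAction using (all; any)
open import Data.Bool.Properties using (∨-identityʳ; ∨-assoc; ∨-zeroʳ; ∧-zeroʳ) renaming (_≟_ to _≟B_)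
open import Data.Fin using (Fin; zero; suc; toℕ; _↑ˡ_; _↑ʳ_; splitAt; combine; remQuot)
open import Data.Fin.Properties using (splitAt-↑ˡ; splitAt-↑ʳ; remQuot-combine; toℕ-injective; toℕ<n; toℕ-fromℕ<)
open import Data.List using (List; []; _∷_; _++_; _ʳ++_; length; map; concatMap; replicate; filter; drop)
open import Data.List.Properties using (++-assoc; ++-identityʳ; length-++; length-map; length-replicate; concatMap-++; map-++; filter-++)
open import Data.Maybe using (Maybe; just; nothing)
open import Data.Product using (Σ; _×_; _,_; proj₁; proj₂)
open import Data.Sum using (_⊎_; inj₁; inj₂; [_,_]′)
open import Data.Empty using (⊥; ⊥-elim)
open import Data.Unit using (⊤; tt)
open import Data.Vec using (Vec; []; _∷_; lookup; _[_]≔_; tabulate)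
open import Function using (_∘_; id; case_of_; mk⇔; Equivalence)
open import Function.Bundles using (_⇔_)
open import Relation.Binary.PropositionalEquality using (_≡_; _≢_; refl; sym; trans; cong; cong₂; subst; subst₂)
open import Relation.Nullary using (¬_; Dec; yes; no; does)
import Data.Vec as V
import Data.Vec.Properties as VP
open import Data.List.Membership.Propositional using (_∈_)
open import Data.List.Membership.Propositional.Properties using (∈-filter⁺; ∈-filter⁻; ∈-map⁺; ∈-map⁻; ∈-++⁺ˡ; ∈-++⁺ʳ; ∈-++⁻; ∈-∃++)
open import Data.List.Relation.Unary.Any using (here; there)
import Data.List.Relation.Unary.All as All
open import Data.List.Relation.Unary.AllPairs using ([]; _∷_)
open import Data.List.Relation.Unary.Unique.Propositional using (Unique)
import Data.List.Relation.Unary.Unique.Propositional.Properties as Uniq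
import Data.Vec.Relation.Unary.All as VAll
import Data.Vec.Relation.Unary.All.Properties as VAllP

-- Structured Turing machine programs

-- A Mersenne number is recognised only by the exact count, so surplus models are as harmful as
-- missing ones. This is why a new cell must equal the canonical code of its successor instead of
-- merely decoding to it, and why a halted configuration is repeated: all rows exist and are
-- functions of the initial row. As the correspondence is exact, `IsMersenne` is transported as a
-- whole in both directions. A machine that writes clauses should not have to locate the ends of
-- rows. With a recurrence valid at every cell number, one template serves all cells; formula codes
-- are unary, so an index is written by looping over a counter. The sizes come from the time bound
-- T. Row 0 shows the tape without a head and row t + 1 the configuration after t steps, so row T +
-- 1 is final; T + 4 blanks keep the head off the right wall in every row considered. Polynomial
-- time has to be exhibited by an explicit polynomial. One number per program therefore bounds both
-- the units of time it pays for and the growth of all values, so that costs of composed programs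
-- simply add.

haltsWithin-step : ∀ {M n} c {c'} → step M c ≡ just c' → haltsWithin M (suc n) c ≡ haltsWithin M n c'
haltsWithin-step {M} c eq with step M c
haltsWithin-step c refl | just _ = refl

module Programs (e : ℕ) where

  Symbol : Set
  Symbol = Fin (3 + e)

  Tape : Set
  Tape = List Symbol × List Symbol

  infixr 5 _⨾_

  data Prog : Set where
    act   : (Symbol → Symbol × Move) → Prog
    _⨾_   : Prog → Prog → Prog
    ite   : (Symbol → Bool) → Prog → Prog → Prog
    while : (Symbol → Bool) → Prog → Prog

  size : Prog → ℕ
  size (act f)     = 1
  size (P ⨾ Q)     = size P + size Q
  size (ite g P Q) = 1 + (size P + size Q)
  size (while g P) = 1 + size P

  entry : (P : Prog) → Fin (size P)
  entry (act f)     = zero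
  entry (P ⨾ Q)     = entry P ↑ˡ size Q
  entry (ite g P Q) = zero
  entry (while g P) = zero

  -- The state `nothing` of a program is its exit.
  Response : ℕ → Set
  Response n = Maybe (Fin n) × Symbol × Move

  redirect : ∀ {m n} → (Fin m → Fin n) → Maybe (Fin n) → Maybe (Fin m) → Maybe (Fin n)
  redirect f d (just i) = just (f i)
  redirect f d nothing  = d

  redirect₁ : ∀ {m n} → (Fin m → Fin n) → Maybe (Fin n) → Response m → Response n
  redirect₁ f d (o , r) = redirect f d o , r

  next : (P : Prog) → Fin (size P) → Symbol → Response (size P)
  next (act f) i s = nothing , f s
  next (P ⨾ Q) i s =
    [ (λ j → redirect₁ (_↑ˡ size Q) (just (size P ↑ʳ entry Q)) (next P j s))
    , (λ j → redirect₁ (size P ↑ʳ_) nothing (next Q j s)) ]′ (splitAt (size P) i)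
  next (ite g P Q) zero s =
    just (suc (if g s then entry P ↑ˡ size Q else size P ↑ʳ entry Q)) , s , stay
  next (ite g P Q) (suc i) s =
    [ (λ j → redirect₁ (λ z → suc (z ↑ˡ size Q)) nothing (next P j s))
    , (λ j → redirect₁ (λ z → suc (size P ↑ʳ z)) nothing (next Q j s)) ]′ (splitAt (size P) i)
  next (while g P) zero    s = (if g s then just (suc (entry P)) else nothing) , s , stay
  next (while g P) (suc i) s = redirect₁ suc (just zero) (next P i s)

  hd : List Symbol → Symbol
  hd []      = zero
  hd (s ∷ _) = s

  tl : List Symbol → List Symbol
  tl []       = []
  tl (_ ∷ ss) = ss

  mv : Move → Tape → Tape
  mv left  ([] , r)     = [] , r
  mv left  (l ∷ ls , r) = ls , l ∷ r
  mv right (ls , [])    = zero ∷ ls , []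
  mv right (ls , s ∷ r) = s ∷ ls , r
  mv stay  t            = t

  put : Symbol → Tape → Tape
  put s (l , r) = l , s ∷ tl r

  under : Tape → Symbol
  under (l , r) = hd r

  advance : Symbol × Move → Tape → Tape
  advance (s , m) t = mv m (put s t)

  data Reach (P : Prog) : Maybe (Fin (size P)) → Tape → ℕ → Tape → Set where
    done : ∀ {t} → Reach P nothing t 0 t
    go   : ∀ {i t k t'} →
           Reach P (proj₁ (next P i (under t))) (advance (proj₂ (next P i (under t))) t) k t' →
           Reach P (just i) t (suc k) t'

  Run : Prog → Tape → ℕ → Tape → Set
  Run P t k t' = Reach P (just (entry P)) t k t'

  private
    go≡ : ∀ {P i t k t' o a} → next P i (under t) ≡ (o , a) →
          Reach P o (advance a t) k t' → Reach P (just i) t (suc k) t'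
    go≡ {P} {i} {t} eq r with next P i (under t) in eq'
    go≡ {P} {i} {t} refl r | _ = go (subst (λ z → Reach P (proj₁ z) (advance (proj₂ z) t) _ _) (sym eq') r)

    -- A run of P inside R, where states embed by f and the exit of P continues at d.
    embed : ∀ {P R} (f : Fin (size P) → Fin (size R)) (d : Maybe (Fin (size R))) →
            (∀ i s → next R (f i) s ≡ redirect₁ f d (next P i s)) →
            ∀ {o t k t' k' t''} → Reach P o t k t' → Reach R d t' k' t'' →
            Reach R (redirect f d o) t (k + k') t''
    embed f d h done r = r
    embed {P} f d h (go {i = i} {t = t} p) r = go≡ {t = t} (h i (under t)) (embed f d h p r)

  run-act : ∀ f t → Run (act f) t 1 (advance (f (under t)) t)
  run-act f t = go done

  run-seq : ∀ {P Q t t' t'' j k} → Run P t j t' → Run Q t' k t'' → Run (P ⨾ Q) t (j + k) t''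
  run-seq {P} {Q} {k = k} p q =
    embed (_↑ˡ size Q) (just (size P ↑ʳ entry Q)) (λ i s → cong [ _ , _ ]′ (splitAt-↑ˡ (size P) i (size Q))) p
      (subst (λ z → Reach (P ⨾ Q) _ _ z _) (+-identityʳ k)
        (embed (size P ↑ʳ_) nothing (λ i s → cong [ _ , _ ]′ (splitAt-↑ʳ (size P) (size Q) i)) q done))

  -- Every machine step writes, so a test writes the scanned symbol back. On an empty right part
  -- this creates an explicit blank: the list changes although the tape it stands for does not.
  refresh : Tape → Tape
  refresh t = put (under t) t

  run-ite-true : ∀ {g P Q t t' k} → g (under t) ≡ true → Run P (refresh t) k t' →
                 Run (ite g P Q) t (suc k) t'
  run-ite-true {g} {P} {Q} {t} {k = k} eq p =
    go≡ {t = t} (cong (λ b → just (suc (if b then entry P ↑ˡ size Q else size P ↑ʳ entry Q)) , _) eq)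
      (subst (λ z → Reach (ite g P Q) _ _ z _) (+-identityʳ k)
        (embed (λ z → suc (z ↑ˡ size Q)) nothing (λ i s → cong [ _ , _ ]′ (splitAt-↑ˡ (size P) i (size Q))) p done))

  run-ite-false : ∀ {g P Q t t' k} → g (under t) ≡ false → Run Q (refresh t) k t' →
                  Run (ite g P Q) t (suc k) t'
  run-ite-false {g} {P} {Q} {t} {k = k} eq p =
    go≡ {t = t} (cong (λ b → just (suc (if b then entry P ↑ˡ size Q else size P ↑ʳ entry Q)) , _) eq)
      (subst (λ z → Reach (ite g P Q) _ _ z _) (+-identityʳ k)
        (embed (λ z → suc (size P ↑ʳ z)) nothing (λ i s → cong [ _ , _ ]′ (splitAt-↑ʳ (size P) (size Q) i)) p done))

  run-while-false : ∀ {g P t} → g (under t) ≡ false → Run (while g P) t 1 (refresh t)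
  run-while-false {g} {P} {t} eq =
    go≡ {t = t} (cong (λ b → (if b then just (suc (entry P)) else nothing) , _) eq) done

  run-while-true : ∀ {g P t t' t'' j k} → g (under t) ≡ true → Run P (refresh t) j t' →
                   Run (while g P) t' k t'' → Run (while g P) t (suc (j + k)) t''
  run-while-true {g} {P} {t} eq p r =
    go≡ {t = t} (cong (λ b → (if b then just (suc (entry P)) else nothing) , _) eq)
      (embed suc (just zero) (λ i s → refl) p r)

  machine : Prog → TM
  machine P = record
    { nStates = suc (size P)
    ; nExtra  = e
    ; start   = suc (entry P)
    ; δ       = λ { zero s → nothing
                  ; (suc i) s → just (resume (proj₁ (next P i s)) , proj₂ (next P i s)) } }
    where
      resume : Maybe (Fin (size P)) → Fin (suc (size P))
      resume nothing  = zero
      resume (just i) = suc i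

  private
    state : ∀ {n} → Maybe (Fin n) → Fin (suc n)
    state nothing  = zero
    state (just i) = suc i

    move-mv : ∀ P m l r → move (machine P) m l r ≡ mv m (l , r)
    move-mv P left  []      r       = refl
    move-mv P left  (x ∷ l) r       = refl
    move-mv P right l       []      = refl
    move-mv P right l       (x ∷ r) = refl
    move-mv P stay  l       r       = refl

    cfgOf : ∀ P → Maybe (Fin (size P)) → Tape → Config (machine P)
    cfgOf P o (l , r) = cfg (state o) l r

    read-hd : ∀ P r → readHead (machine P) r ≡ hd r
    read-hd P []      = refl
    read-hd P (_ ∷ _) = refl

    drop-tl : ∀ P r → dropHead (machine P) r ≡ tl r
    drop-tl P []      = refl
    drop-tl P (_ ∷ _) = refl

    step-just : ∀ P i t → step (machine P) (cfgOf P (just i) t) ≡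
      just (cfgOf P (proj₁ (next P i (under t))) (advance (proj₂ (next P i (under t))) t))
    step-just P i (l , r) rewrite read-hd P r | drop-tl P r
      | move-mv P (proj₂ (proj₂ (next P i (hd r)))) l (proj₁ (proj₂ (next P i (hd r))) ∷ tl r)
      with proj₁ (next P i (hd r))
    ... | nothing = refl
    ... | just _  = refl

  run-machine : ∀ {P o t k t'} → Reach P o t k t' → ∀ {n} → k ≤ n →
    haltsWithin (machine P) n (cfgOf P o t) ≡ just (cfg zero (proj₁ t') (proj₂ t'))
  run-machine done {zero}  _ = refl
  run-machine done {suc n} _ = refl
  run-machine {P} (go {i} {t} r) {suc n} (s≤s le) =
    trans (haltsWithin-step (cfgOf P (just i) t) (step-just P i t)) (run-machine r le)

-- Tapes with Boolean tracks

nth : ∀ {A : Set} → A → List A → ℕ → A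
nth d []       i       = d
nth d (x ∷ xs) zero    = x
nth d (x ∷ xs) (suc i) = nth d xs i

-- Reversing the left part onto the right part turns the tape seen from the head into one with
-- absolute positions, where the head scans the cell numbered `length l`.
nth-ʳ++ : ∀ {A : Set} (d : A) l r j → nth d (l ʳ++ r) (length l + j) ≡ nth d r j
nth-ʳ++ d []      r j = refl
nth-ʳ++ d (x ∷ l) r j =
  trans (cong (nth d (l ʳ++ (x ∷ r))) (sym (+-suc (length l) j))) (nth-ʳ++ d l (x ∷ r) (suc j))

nth-ʳ++-cong : ∀ {A : Set} (d : A) l {r r'} m → (∀ j → j ≢ m → nth d r j ≡ nth d r' j) →
               ∀ i → i ≢ length l + m → nth d (l ʳ++ r) i ≡ nth d (l ʳ++ r') i
nth-ʳ++-cong d []      m h i ne = h i ne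
nth-ʳ++-cong d (x ∷ l) m h i ne =
  nth-ʳ++-cong d l (suc m)
    (λ { zero _ → refl ; (suc j) ne' → h j (ne' ∘ cong suc) }) i
    (λ eq → ne (trans eq (+-suc (length l) m)))

<ᵇ-true : ∀ {m n} → m < n → (m <ᵇ n) ≡ true
<ᵇ-true {zero}  (s≤s _)         = refl
<ᵇ-true {suc m} (s≤s lt@(s≤s _)) = <ᵇ-true lt

<ᵇ-false : ∀ {m n} → n ≤ m → (m <ᵇ n) ≡ false
<ᵇ-false z≤n     = refl
<ᵇ-false (s≤s le) = <ᵇ-false le

<ᵇ-suc : ∀ {i p} → i ≢ p → (i <ᵇ suc p) ≡ (i <ᵇ p)
<ᵇ-suc {zero}  {zero}  ne = ⊥-elim (ne refl)
<ᵇ-suc {zero}  {suc p} ne = refl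
<ᵇ-suc {suc i} {zero}  ne = refl
<ᵇ-suc {suc i} {suc p} ne = <ᵇ-suc (ne ∘ cong suc)

module Tracks (w e : ℕ) (decode : Fin (3 + e) → Vec Bool w) (encode : Vec Bool w → Fin (3 + e))
              (decode-encode : ∀ v → decode (encode v) ≡ v) where

  open Programs e public

  Content : Set
  Content = ℕ → Vec Bool w

  -- Contents are compared at absolute positions with the blank as default, so trailing blanks are
  -- invisible. Only `decode` is applied to the symbols, hence a raw input bit and a track symbol
  -- may stand for the same content.
  record Holds (h : ℕ) (C : Content) (t : Tape) : Set where
    constructor holds
    field
      pos  : length (proj₁ t) ≡ h
      cell : ∀ i → decode (nth zero (proj₁ t ʳ++ proj₂ t) i) ≡ C i

  newpos : Move → ℕ → ℕ
  newpos left  h = pred h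
  newpos right h = suc h
  newpos stay  h = h

  private
    nth-tl : ∀ {s} r j → j ≢ 0 → nth zero (s ∷ tl r) j ≡ nth zero r j
    nth-tl r       zero    ne = ⊥-elim (ne refl)
    nth-tl []      (suc j) ne = refl
    nth-tl (x ∷ r) (suc j) ne = refl

    nth-hd : ∀ r → nth zero r 0 ≡ hd r
    nth-hd []      = refl
    nth-hd (_ ∷ _) = refl

  holds-under : ∀ {h C t} → Holds h C t → decode (under t) ≡ C h
  holds-under {h} {C} {l , r} (holds refl c) =
    trans (cong decode (trans (sym (nth-hd r)) (sym (trans (cong (nth zero (l ʳ++ r)) (sym (+-identityʳ _))) (nth-ʳ++ zero l r 0)))))
          (c (length l))

  holds-put : ∀ {h C C' t s} → Holds h C t → decode s ≡ C' h → (∀ i → i ≢ h → C' i ≡ C i) →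
              Holds h C' (put s t)
  holds-put {C = C} {C'} {l , r} {s} (holds refl c) eq ne = holds refl λ i → new i (i ≟ length l)
    where
      new : ∀ i → Dec (i ≡ length l) → decode (nth zero (l ʳ++ (s ∷ tl r)) i) ≡ C' i
      new i (yes refl) = trans (cong decode (trans (cong (nth zero (l ʳ++ (s ∷ tl r))) (sym (+-identityʳ _))) (nth-ʳ++ zero l (s ∷ tl r) 0))) eq
      new i (no i≢l)   = trans (cong decode (nth-ʳ++-cong zero l 0 (nth-tl r) i (λ eq' → i≢l (trans eq' (+-identityʳ _)))))
                              (trans (c i) (sym (ne i i≢l)))

  holds-mv : ∀ {h C l s r} m → Holds h C (l , s ∷ r) → Holds (newpos m h) C (mv m (l , s ∷ r))
  holds-mv {l = []}    left  (holds refl c) = holds refl c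
  holds-mv {l = x ∷ l} left  (holds refl c) = holds refl c
  holds-mv             right (holds refl c) = holds refl c
  holds-mv             stay  (holds refl c) = holds refl c

  holds-advance : ∀ {h C C' t s} m → Holds h C t → decode s ≡ C' h → (∀ i → i ≢ h → C' i ≡ C i) →
                  Holds (newpos m h) C' (advance (s , m) t)
  holds-advance m H eq ne = holds-mv m (holds-put H eq ne)

  holds-refresh : ∀ {h C t} → Holds h C t → Holds h C (refresh t)
  holds-refresh H = holds-put H (holds-under H) (λ _ _ → refl)

  holds-cong : ∀ {h C C' t} → (∀ i → C' i ≡ C i) → Holds h C t → Holds h C' t
  holds-cong eq (holds p c) = holds p (λ i → trans (c i) (sym (eq i)))

  Moves : Prog → ℕ → Content → ℕ → ℕ → Content → Set
  Moves P h C k h' C' = ∀ {t} → Holds h C t →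
    Σ Tape λ t' → Σ ℕ λ j → j ≤ k × Run P t j t' × Holds h' C' t'

  modify : (Vec Bool w → Vec Bool w) → Move → Prog
  modify f m = act (λ s → encode (f (decode s)) , m)

  ifT : (Vec Bool w → Bool) → Prog → Prog → Prog
  ifT g = ite (g ∘ decode)

  whileT : (Vec Bool w → Bool) → Prog → Prog
  whileT g = while (g ∘ decode)

  moves-weaken : ∀ {P h C k k' h' C'} → k ≤ k' → Moves P h C k h' C' → Moves P h C k' h' C'
  moves-weaken le M H with M H
  ... | t' , j , j≤ , R , H' = t' , j , ≤-trans j≤ le , R , H'

  moves-cong : ∀ {P h C k h' C' C''} → (∀ i → C'' i ≡ C' i) → Moves P h C k h' C' → Moves P h C k h' C''
  moves-cong eq M H with M H
  ... | t' , j , j≤ , R , H' = t' , j , j≤ , R , holds-cong eq H'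

  moves-modify : ∀ {h C C'} f m → C' h ≡ f (C h) → (∀ i → i ≢ h → C' i ≡ C i) →
                 Moves (modify f m) h C 1 (newpos m h) C'
  moves-modify f m eq ne {t} H = _ , 1 , ≤-refl , run-act _ t ,
    holds-advance m H (trans (decode-encode _) (trans (cong f (holds-under H)) (sym eq))) ne

  moves-seq : ∀ {P Q h C j h' C' k h'' C''} → Moves P h C j h' C' → Moves Q h' C' k h'' C'' →
              Moves (P ⨾ Q) h C (j + k) h'' C''
  moves-seq M N H with M H
  ... | t' , _ , le , R , H' with N H'
  ... | t'' , _ , le' , R' , H'' = t'' , _ , +-mono-≤ le le' , run-seq R R' , H''

  moves-if-true : ∀ g {P Q h C k h' C'} → g (C h) ≡ true → Moves P h C k h' C' →
                  Moves (ifT g P Q) h C (suc k) h' C'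
  moves-if-true g eq M H with M (holds-refresh H)
  ... | t' , _ , le , R , H' =
    t' , _ , s≤s le , run-ite-true (trans (cong g (holds-under H)) eq) R , H'

  moves-if-false : ∀ g {P Q h C k h' C'} → g (C h) ≡ false → Moves Q h C k h' C' →
                   Moves (ifT g P Q) h C (suc k) h' C'
  moves-if-false g eq M H with M (holds-refresh H)
  ... | t' , _ , le , R , H' =
    t' , _ , s≤s le , run-ite-false (trans (cong g (holds-under H)) eq) R , H'

  moves-while-true : ∀ g {P h C j h' C' k h'' C''} → g (C h) ≡ true → Moves P h C j h' C' →
                     Moves (whileT g P) h' C' k h'' C'' → Moves (whileT g P) h C (suc (j + k)) h'' C''
  moves-while-true g eq M N H with M (holds-refresh H)
  ... | t' , _ , le , R , H' with N H'
  ... | t'' , _ , le' , R' , H'' =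
    t'' , _ , s≤s (+-mono-≤ le le') , run-while-true (trans (cong g (holds-under H)) eq) R R' , H''

  moves-while-false : ∀ g {P h C} → g (C h) ≡ false → Moves (whileT g P) h C 1 h C
  moves-while-false g eq H =
    _ , 1 , ≤-refl , run-while-false (trans (cong g (holds-under H)) eq) , holds-refresh H

  private
    replaced : ℕ → Vec Bool w → Content → Content
    replaced h v C i with i ≟ h
    ... | yes _ = v
    ... | no  _ = C i

    replaced-at : ∀ h v C → replaced h v C h ≡ v
    replaced-at h v C with h ≟ h
    ... | yes _ = refl
    ... | no ne = ⊥-elim (ne refl)

    replaced-off : ∀ h v C i → i ≢ h → replaced h v C i ≡ C i
    replaced-off h v C i ne with i ≟ h
    ... | yes eq = ⊥-elim (ne eq)
    ... | no  _  = refl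

  sweep : (Vec Bool w → Bool) → (Vec Bool w → Vec Bool w) → Prog
  sweep g f = whileT g (modify f right)

  -- Each treated cell costs two steps, the test and the action, and the failing test at `d + h`
  -- costs one more. The induction shortens the interval from the left: the rest of the sweep starts
  -- from `D`, which differs from `C` only in the cell just treated.
  moves-sweep : ∀ g f d h {C C'} →
    (∀ i → h ≤ i → i < d + h → g (C i) ≡ true × C' i ≡ f (C i)) →
    (∀ i → (i < h ⊎ d + h ≤ i) → C' i ≡ C i) → g (C (d + h)) ≡ false →
    Moves (sweep g f) h C (d + d + 1) (d + h) C'
  moves-sweep g f zero h on off end = moves-cong eq (moves-while-false g end)
    where
      eq : ∀ i → _
      eq i with i <? h
      ... | yes lt = off i (inj₁ lt)
      ... | no  ge = off i (inj₂ (≮⇒≥ ge))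
  moves-sweep g f (suc d) h {C} {C'} on off end =
    subst (λ z → Moves (sweep g f) h C z (suc d + h) C')
      (cong suc (cong (_+ 1) (sym (+-suc d d))))
      (subst (λ z → Moves (sweep g f) h C (2 + (d + d + 1)) z C') (+-suc d h)
      (moves-while-true g (proj₁ (on h ≤-refl (s≤s (m≤n+m h d))))
        (moves-modify {C' = D} f right (replaced-at h _ C) (replaced-off h _ C))
        (moves-sweep g f d (suc h) on' off' (trans (cong g (D-off _ ne)) (trans (cong (g ∘ C) (+-suc d h)) end)))))
    where
      D = replaced h (f (C h)) C
      D-off : ∀ i → i ≢ h → D i ≡ C i
      D-off = replaced-off h _ C
      ne : d + suc h ≢ h
      ne eq = <-irrefl (sym eq) (m≤n+m (suc h) d)
      on' : ∀ i → suc h ≤ i → i < d + suc h → g (D i) ≡ true × C' i ≡ f (D i)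
      on' i lo hi with on i (<⇒≤ lo) (subst (i <_) (+-suc d h) hi)
      ... | a , b = trans (cong g same) a , trans b (cong f (sym same))
        where same = D-off i (λ eq → <-irrefl (sym eq) lo)
      off' : ∀ i → (i < suc h ⊎ d + suc h ≤ i) → C' i ≡ D i
      off' i (inj₁ (s≤s le)) with i ≟ h
      ... | yes refl = proj₂ (on i ≤-refl (s≤s (m≤n+m h d)))
      ... | no  ne'  = off i (inj₁ (≤∧≢⇒< le ne'))
      off' i (inj₂ ge) with i ≟ h
      ... | yes refl = ⊥-elim (<-irrefl refl (≤-trans (m≤n+m (suc i) d) ge))
      ... | no  ne'  = off i (inj₂ (subst (_≤ i) (+-suc d h) ge))

  module _ (ℓ : Fin w) where

    rewind : Prog
    rewind = whileT (λ v → not (lookup v ℓ)) (modify id left)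

    -- A value is used as an address: if the track t is true exactly below p, the head ends on the
    -- cell numbered p.
    seek : Fin w → Prog
    seek t = rewind ⨾ sweep (λ v → lookup v t) id

    module _ {C : Content} (leftmost : ∀ i → lookup (C i) ℓ ≡ (i <ᵇ 1)) where

      moves-rewind : ∀ h → Moves rewind h C (h + h + 1) 0 C
      moves-rewind zero    = moves-while-false (λ v → not (lookup v ℓ)) (cong not (leftmost 0))
      moves-rewind (suc h) =
        subst (λ z → Moves rewind (suc h) C z 0 C) (cong suc (cong (_+ 1) (sym (+-suc h h))))
        (moves-while-true (λ v → not (lookup v ℓ)) (cong not (leftmost (suc h))) (moves-modify id left refl (λ _ _ → refl)) (moves-rewind h))

      moves-seek : ∀ h t p → (∀ i → lookup (C i) t ≡ (i <ᵇ p)) →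
                   Moves (seek t) h C (h + h + 1 + (p + p + 1)) p C
      moves-seek h t p th = moves-seq (moves-rewind h)
        (subst (λ z → Moves (sweep (λ v → lookup v t) id) 0 C (p + p + 1) z C) (+-identityʳ p)
          (moves-sweep (λ v → lookup v t) id p 0 (λ i _ lt → trans (th i) (<ᵇ-true (subst (i <_) (+-identityʳ p) lt)) , refl)
            (λ _ _ → refl) (trans (th (p + 0)) (<ᵇ-false (≤-reflexive (sym (+-identityʳ p)))))))

-- Counter programs

bitAt : Str → ℕ → Bool
bitAt = nth false

bitAt-∷ʳ-< : ∀ o b i → i < length o → bitAt (o ++ b ∷ []) i ≡ bitAt o i
bitAt-∷ʳ-< (x ∷ o) b zero    _        = refl
bitAt-∷ʳ-< (x ∷ o) b (suc i) (s≤s lt) = bitAt-∷ʳ-< o b i lt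

bitAt-∷ʳ-> : ∀ o b i → length o < i → bitAt (o ++ b ∷ []) i ≡ bitAt o i
bitAt-∷ʳ-> []      b (suc i) _        = refl
bitAt-∷ʳ-> (x ∷ o) b (suc i) (s≤s lt) = bitAt-∷ʳ-> o b i lt

bitAt-∷ʳ : ∀ o b → bitAt (o ++ b ∷ []) (length o) ≡ b
bitAt-∷ʳ []      b = refl
bitAt-∷ʳ (x ∷ o) b = bitAt-∷ʳ o b

-- A state holds suc k counters, the first of which is meant to be the length of the input,
-- and the output written so far. On the tape, a counter of value p is the track whose cells
-- carry true exactly below p; a further constant counter 1 marks the leftmost cell.
module Counters (k e : ℕ) (toFin : Vec Bool (5 + k) → Fin e) (fromFin : Fin e → Vec Bool (5 + k))
                (fromFin-toFin : ∀ v → fromFin (toFin v) ≡ v) where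

  -- A cell holding a raw input bit lies below the input length, so its track of the first counter
  -- already reads true. Thus the fresh input tape carries that counter without any preparation.
  plain : Bool → Vec Bool (5 + k)
  plain b = b ∷ false ∷ false ∷ false ∷ true ∷ V.replicate k false

  decode : Fin (3 + e) → Vec Bool (5 + k)
  decode zero                = V.replicate _ false
  decode (suc zero)          = plain false
  decode (suc (suc zero))    = plain true
  decode (suc (suc (suc i))) = fromFin i

  encode : Vec Bool (5 + k) → Fin (3 + e)
  encode v = suc (suc (suc (toFin v)))

  open Tracks (5 + k) e decode encode fromFin-toFin public

  St : Set
  St = Vec ℕ (suc k) × Str

  Counter : Set
  Counter = Fin (suc k)

  Bound : Set
  Bound = Fin (suc (suc k))

  track : Bound → Fin (5 + k)
  track b = suc (suc (suc b))

  ℓ : Fin (5 + k)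
  ℓ = track zero

  value : Vec ℕ (suc k) → Bound → ℕ
  value v b = lookup (1 ∷ v) b

  content : Str → St → Content
  content z (v , o) i = bitAt z i ∷ bitAt o i ∷ (i <ᵇ length o) ∷ V.map (i <ᵇ_) (1 ∷ v)

  content-track : ∀ z v o b i → lookup (content z (v , o) i) (track b) ≡ (i <ᵇ value v b)
  content-track z v o b i = VP.lookup-map b (i <ᵇ_) (1 ∷ v)

  content-update : ∀ z v o j m i →
    content z (v [ j ]≔ m , o) i ≡ content z (v , o) i [ track (suc j) ]≔ (i <ᵇ m)
  content-update z v o j m i =
    cong (λ u → bitAt z i ∷ bitAt o i ∷ (i <ᵇ length o) ∷ (i <ᵇ 1) ∷ u) (VP.map-[]≔ (i <ᵇ_) v j)

  content-same : ∀ z v o j m i → (i <ᵇ m) ≡ (i <ᵇ lookup v j) →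
    content z (v [ j ]≔ m , o) i ≡ content z (v , o) i
  content-same z v o j m i eq =
    trans (content-update z v o j m i)
      (trans (cong (content z (v , o) i [ track (suc j) ]≔_) (trans eq (sym (content-track z v o (suc j) i))))
        (VP.[]≔-lookup (content z (v , o) i) (track (suc j))))

  record Bdd (B : ℕ) (s : St) : Set where
    constructor _,_
    field
      counters : ∀ b → value (proj₁ s) b ≤ B
      written  : length (proj₂ s) ≤ B

  open Bdd

  bdd-mono : ∀ {B B'} → B ≤ B' → ∀ {s} → Bdd B s → Bdd B' s
  bdd-mono le (f , g) = (λ b → ≤-trans (f b) le) , ≤-trans g le

  bdd-update : ∀ {B v o} j m → m ≤ B → Bdd B (v , o) → Bdd B (v [ j ]≔ m , o)
  bdd-update {B} {v} {o} j m le (f , g) = h , g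
    where
      h : ∀ b → value (v [ j ]≔ m) b ≤ B
      h zero = f zero
      h (suc i) with i Data.Fin.≟ j
      ... | yes refl = subst (_≤ B) (sym (VP.lookup∘update i v m)) le
      ... | no  ne   = subst (_≤ B) (sym (VP.lookup∘update′ ne v m)) (f (suc i))

  -- The number of machine steps paid for one unit of cost while all values are at most B.
  unit : ℕ → ℕ
  unit B = 4 * B + 6

  unit-mono : ∀ {B B'} → B ≤ B' → unit B ≤ unit B'
  unit-mono le = +-monoˡ-≤ 6 (*-monoʳ-≤ 4 le)

  -- The single number d bounds the growth of the values, the growth of the head position and the
  -- units of time. After a program of cost d everything is at most `d + B`, which is the bound from
  -- which the next program starts; hence costs add under sequencing.
  record Tri (z : Str) (d : ℕ) (s : St) (P : Prog) (s' : St) : Set where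
    constructor tri
    field
      run : ∀ {B h} → Bdd B s → h ≤ B → Σ ℕ λ h' → h' ≤ d + B × Bdd (d + B) s' ×
            Moves P h (content z s) (d * unit (d + B)) h' (content z s')

  open Tri public

  tri-weaken : ∀ {z d d' s P s'} → d ≤ d' → Tri z d s P s' → Tri z d' s P s'
  tri-weaken {d = d} {d'} le (tri r) .run {B} b hB with r b hB
  ... | h' , h'≤ , b' , M = h' , ≤-trans h'≤ le' , bdd-mono le' b' ,
        moves-weaken (*-mono-≤ le (unit-mono le')) M
    where
      le' : d + B ≤ d' + B
      le' = +-monoˡ-≤ B le

  tri-seq : ∀ {z d e s P s' Q s''} → Tri z d s P s' → Tri z e s' Q s'' → Tri z (d + e) s (P ⨾ Q) s''
  tri-seq {d = d} {e} (tri r) (tri r') .run {B} b hB with r b hB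
  ... | h' , h'≤ , b' , M with r' b' h'≤
  ... | h'' , h''≤ , b'' , M' = h'' , ≤-trans h''≤ (≤-reflexive eq) , bdd-mono (≤-reflexive eq) b'' ,
        moves-weaken
          (≤-trans (+-mono-≤ (*-monoʳ-≤ d (unit-mono (≤-trans (m≤n+m (d + B) e) (≤-reflexive eq))))
                             (*-monoʳ-≤ e (unit-mono (≤-reflexive eq))))
                   (≤-reflexive (sym (*-distribʳ-+ (unit (d + e + B)) d e))))
          (moves-seq M M')
    where
      eq : e + (d + B) ≡ d + e + B
      eq = trans (sym (+-assoc e d B)) (cong (_+ B) (+-comm e d))

  private
    tri-unit : ∀ {z s P s'} → (∀ {B h} → Bdd B s → h ≤ B → Σ ℕ λ h' → h' ≤ 1 + B × Bdd (1 + B) s' ×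
                 Moves P h (content z s) (unit B) h' (content z s')) → Tri z 1 s P s'
    tri-unit f .run {B} b hB with f b hB
    ... | h' , h'≤ , b' , M = h' , h'≤ , b' ,
      moves-weaken (≤-trans (unit-mono (n≤1+n B)) (≤-reflexive (sym (*-identityˡ _)))) M

    -- Rewinding and seeking each pass at most B cells at two steps per cell and end with one
    -- failing test, which makes 4 * B + 2. The remaining 4 steps of `unit` pay for what is done at
    -- the target.
    seek-cost : ∀ {h p B} c → h ≤ B → p ≤ B → c ≤ 4 → (h + h + 1 + (p + p + 1)) + c ≤ 4 * B + 6
    seek-cost {h} {p} {B} c hB pB c≤ =
      ≤-trans (+-mono-≤ (+-mono-≤ (+-monoˡ-≤ 1 (+-mono-≤ hB hB)) (+-monoˡ-≤ 1 (+-mono-≤ pB pB))) c≤)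
        (≤-reflexive (solve 1 (λ B → (B :+ B :+ con 1 :+ (B :+ B :+ con 1)) :+ con 4 := con 4 :* B :+ con 6) refl B))
      where open +-*-Solver

  moves-seek-counter : ∀ z v o b h →
    Moves (seek ℓ (track b)) h (content z (v , o)) (h + h + 1 + (value v b + value v b + 1)) (value v b) (content z (v , o))
  moves-seek-counter z v o b h =
    moves-seek ℓ (λ i → refl) h (track b) (value v b) (content-track z v o b)

  -- Loop-free counter instructions and their compilation

  infixr 5 _▹_

  data LoopFree : Set where
    skip  : LoopFree
    inc   : Counter → LoopFree
    dec   : Counter → LoopFree
    reset : Counter → LoopFree
    copy  : Counter → Bound → LoopFree
    emit  : Bool → LoopFree
    _▹_   : LoopFree → LoopFree → LoopFree
    ifLt  : Counter → Bound → LoopFree → LoopFree → LoopFree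
    ifBit : Counter → LoopFree → LoopFree → LoopFree

  exec : Str → LoopFree → St → St
  exec z skip           (v , o) = v , o
  exec z (inc j)        (v , o) = V.updateAt v j suc , o
  exec z (dec j)        (v , o) = V.updateAt v j pred , o
  exec z (reset j)      (v , o) = v [ j ]≔ 0 , o
  exec z (copy j b)     (v , o) = v [ j ]≔ value v b , o
  exec z (emit b)       (v , o) = v , o ++ b ∷ []
  exec z (P ▹ Q)        s       = exec z Q (exec z P s)
  exec z (ifLt i b P Q) (v , o) = if lookup v i <ᵇ value v b then exec z P (v , o) else exec z Q (v , o)
  exec z (ifBit i P Q)  (v , o) = if bitAt z (lookup v i) then exec z P (v , o) else exec z Q (v , o)

  cost : LoopFree → ℕ
  cost (P ▹ Q)        = cost P + cost Q
  cost (ifLt i b P Q) = 1 + (cost P + cost Q)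
  cost (ifBit i P Q)  = 1 + (cost P + cost Q)
  cost _              = 1

  ⟦_⟧ : LoopFree → Prog
  ⟦ skip ⟧         = modify id stay
  ⟦ inc j ⟧        = seek ℓ (track (suc j)) ⨾ modify (_[ track (suc j) ]≔ true) stay
  ⟦ dec j ⟧        = seek ℓ (track (suc j)) ⨾ modify id left ⨾ modify (_[ track (suc j) ]≔ false) stay
  ⟦ reset j ⟧      = rewind ℓ ⨾ sweep (λ v → lookup v (track (suc j))) (_[ track (suc j) ]≔ false)
  ⟦ copy j b ⟧     = rewind ℓ ⨾ sweep (λ v → lookup v (track b) ∨ lookup v (track (suc j)))
                                      (λ v → v [ track (suc j) ]≔ lookup v (track b))
  ⟦ emit b ⟧       = seek ℓ (suc (suc zero)) ⨾ modify (λ v → v [ suc zero ]≔ b [ suc (suc zero) ]≔ true) stay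
  ⟦ P ▹ Q ⟧        = ⟦ P ⟧ ⨾ ⟦ Q ⟧
  ⟦ ifLt i b P Q ⟧ = seek ℓ (track (suc i)) ⨾ ifT (λ v → lookup v (track b)) ⟦ P ⟧ ⟦ Q ⟧
  ⟦ ifBit i P Q ⟧  = seek ℓ (track (suc i)) ⨾ ifT (λ v → lookup v zero) ⟦ P ⟧ ⟦ Q ⟧

  private
    -- Used for decrementing. For p = 0 the move left is blocked at cell 0, whose track is already
    -- false, so clearing it changes nothing, in accordance with `pred 0`.
    clear-after : ∀ {i p} → i ≢ pred p → (i <ᵇ pred p) ≡ (i <ᵇ p)
    clear-after {p = zero}  ne = refl
    clear-after {p = suc p} ne = sym (<ᵇ-suc ne)

    tri-inc : ∀ z j v o → Tri z 1 (v , o) ⟦ inc j ⟧ (v [ j ]≔ suc (lookup v j) , o)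
    tri-inc z j v o = tri-unit λ { {B} {h} b@(f , g) hB → (p , ≤-trans (f (suc j)) (n≤1+n B) ,
        bdd-update j (suc p) (s≤s (f (suc j))) (bdd-mono (n≤1+n B) b) ,
        moves-weaken (seek-cost 1 hB (f (suc j)) (s≤s z≤n))
          (moves-seq (moves-seek-counter z v o (suc j) h)
            (moves-modify (_[ track (suc j) ]≔ true) stay
              (trans (content-update z v o j (suc p) p) (cong (content z (v , o) p [ track (suc j) ]≔_) (<ᵇ-true {p} ≤-refl)))
              (λ i ne → content-same z v o j (suc p) i (<ᵇ-suc ne))))) }
      where p = lookup v j

    tri-dec : ∀ z j v o → Tri z 1 (v , o) ⟦ dec j ⟧ (v [ j ]≔ pred (lookup v j) , o)
    tri-dec z j v o = tri-unit λ { {B} {h} b@(f , g) hB → let p≤ = ≤-trans (pred[n]≤n {p}) (≤-trans (f (suc j)) (n≤1+n B)) in (pred p , p≤ ,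
        bdd-update j (pred p) p≤ (bdd-mono (n≤1+n B) b) ,
        moves-weaken (seek-cost 2 hB (f (suc j)) (s≤s (s≤s z≤n)))
          (moves-seq (moves-seek-counter z v o (suc j) h)
            (moves-seq (moves-modify {C' = content z (v , o)} id left refl (λ _ _ → refl))
            (moves-modify (_[ track (suc j) ]≔ false) stay
              (trans (content-update z v o j (pred p) (pred p)) (cong (content z (v , o) (pred p) [ track (suc j) ]≔_) (<ᵇ-false {pred p} ≤-refl)))
              (λ i ne → content-same z v o j (pred p) i (clear-after {i} {p} ne)))))) }
      where
        p = lookup v j

    -- Here q is the extent of the sweep. It must pass every cell where the old and the new track
    -- differ: for `reset` it is the old value, for `copy` the maximum of both values, because a
    -- larger old value has to be erased.
    tri-sweep : ∀ z j (g : Vec Bool (5 + k) → Bool) (f : Vec Bool (5 + k) → Vec Bool (5 + k)) v o m q →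
      (∀ {B} → Bdd B (v , o) → m ≤ B × q ≤ B) →
      (∀ i → f (content z (v , o) i) ≡ content z (v , o) i [ track (suc j) ]≔ (i <ᵇ m)) →
      (∀ i → i < q → g (content z (v , o) i) ≡ true) → g (content z (v , o) q) ≡ false →
      (∀ i → q ≤ i → (i <ᵇ m) ≡ (i <ᵇ lookup v j)) →
      Tri z 1 (v , o) (rewind ℓ ⨾ sweep g f) (v [ j ]≔ m , o)
    tri-sweep z j g f v o m q bnd feq gon goff same = tri-unit λ {B} {h} b hB →
        (q + 0 , ≤-trans (≤-reflexive (+-identityʳ q)) (≤-trans (proj₂ (bnd b)) (n≤1+n B)) ,
         bdd-mono (n≤1+n B) (bdd-update j m (proj₁ (bnd b)) b) ,
         moves-weaken (≤-trans (≤-reflexive (sym (+-identityʳ _))) (seek-cost 0 hB (proj₂ (bnd b)) z≤n))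
           (moves-seq (moves-rewind ℓ (λ i → refl) h)
             (moves-sweep g f q 0
               (λ i _ lt → gon i (subst (i <_) (+-identityʳ q) lt) , trans (content-update z v o j m i) (sym (feq i)))
               (λ { i (inj₂ ge) → content-same z v o j m i (same i (subst (_≤ i) (+-identityʳ q) ge)) })
               (trans (cong (g ∘ content z (v , o)) (+-identityʳ q)) goff))))

    tri-reset : ∀ z j v o → Tri z 1 (v , o) ⟦ reset j ⟧ (v [ j ]≔ 0 , o)
    tri-reset z j v o = tri-sweep z j (λ v → lookup v (track (suc j))) (_[ track (suc j) ]≔ false) v o 0 (lookup v j) (λ { (f , _) → z≤n , f (suc j) }) (λ i → refl)
      (λ i lt → trans (content-track z v o (suc j) i) (<ᵇ-true lt))
      (trans (content-track z v o (suc j) _) (<ᵇ-false {lookup v j} ≤-refl))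
      (λ i le → sym (<ᵇ-false le))

    ∨-<ᵇ : ∀ i m p → i < m ⊔ p → (i <ᵇ m) ∨ (i <ᵇ p) ≡ true
    ∨-<ᵇ i m p lt with i <? m
    ... | yes l = cong (_∨ (i <ᵇ p)) (<ᵇ-true l)
    ... | no ge = trans (cong (_∨ (i <ᵇ p)) (<ᵇ-false (≮⇒≥ ge)))
                    (<ᵇ-true (subst (i <_) (m≤n⇒m⊔n≡n (≮⇒≥ (λ pm → ge (subst (i <_) (m≥n⇒m⊔n≡m (<⇒≤ pm)) lt)))) lt))

    tri-copy : ∀ z j b v o → Tri z 1 (v , o) ⟦ copy j b ⟧ (v [ j ]≔ value v b , o)
    tri-copy z j b v o = tri-sweep z j (λ v → lookup v (track b) ∨ lookup v (track (suc j))) (λ v → v [ track (suc j) ]≔ lookup v (track b)) v o m (m ⊔ p) (λ { (f , _) → f b , ⊔-lub (f b) (f (suc j)) })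
      (λ i → cong (content z (v , o) i [ track (suc j) ]≔_) (content-track z v o b i))
      (λ i lt → trans (test i) (∨-<ᵇ i m p lt))
      (trans (test (m ⊔ p)) (cong₂ _∨_ (<ᵇ-false (m≤m⊔n m p)) (<ᵇ-false (m≤n⊔m m p))))
      (λ i le → trans (<ᵇ-false (≤-trans (m≤m⊔n m p) le)) (sym (<ᵇ-false (≤-trans (m≤n⊔m m p) le))))
      where
        m = value v b
        p = lookup v j
        test : ∀ i → lookup (content z (v , o) i) (track b) ∨ lookup (content z (v , o) i) (track (suc j)) ≡ (i <ᵇ m) ∨ (i <ᵇ p)
        test i = cong₂ _∨_ (content-track z v o b i) (content-track z v o (suc j) i)

    tri-emit : ∀ z b v o → Tri z 1 (v , o) ⟦ emit b ⟧ (v , o ++ b ∷ [])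
    tri-emit z b v o = tri-unit λ { {B} {h} (f , g) hB → (length o , ≤-trans g (n≤1+n B) ,
        ((λ c → ≤-trans (f c) (n≤1+n B)) , ≤-trans (≤-reflexive len) (s≤s g)) ,
        moves-weaken (seek-cost 1 hB g (s≤s z≤n))
          (moves-seq (moves-seek ℓ (λ i → refl) h (suc (suc zero)) (length o) (λ i → refl))
            (moves-modify (λ v → v [ suc zero ]≔ b [ suc (suc zero) ]≔ true) stay
              (cong₂ (λ x y → bitAt z (length o) ∷ x ∷ y ∷ V.map (length o <ᵇ_) (1 ∷ v))
                (bitAt-∷ʳ o b) (<ᵇ-true (≤-reflexive (sym len))))
              off))) }
      where
        len : length (o ++ b ∷ []) ≡ suc (length o)
        len = trans (length-++ o) (+-comm (length o) 1)
        off : ∀ i → i ≢ length o → content z (v , o ++ b ∷ []) i ≡ content z (v , o) i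
        off i ne = cong₂ (λ x y → bitAt z i ∷ x ∷ y ∷ V.map (i <ᵇ_) (1 ∷ v)) val
                     (trans (cong (i <ᵇ_) len) (<ᵇ-suc ne))
          where
            val : bitAt (o ++ b ∷ []) i ≡ bitAt o i
            val with i <? length o
            ... | yes lt = bitAt-∷ʳ-< o b i lt
            ... | no  ge = bitAt-∷ʳ-> o b i (≤∧≢⇒< (≮⇒≥ ge) (ne ∘ sym))

  -- On the cell numbered by counter i, the track of b is true exactly if i is smaller than b, and
  -- the input track shows the input bit at position i. So comparisons and bit tests are one program
  -- up to the track tested.
  tri-branch : ∀ {z} i (g : Vec Bool (5 + k) → Bool) {P Q v o s' d} b →
    g (content z (v , o) (lookup v i)) ≡ b → Tri z d (v , o) (if b then P else Q) s' →
    Tri z (1 + d) (v , o) (seek ℓ (track (suc i)) ⨾ ifT g P Q) s'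
  tri-branch {z} i g {P} {Q} {v} {o} {s'} {d} b eq (tri r) .run {B} {h} bd@(f , _) hB
    with r bd (f (suc i))
  ... | h' , h'≤ , bd' , M = h' , m≤n⇒m≤1+n h'≤ , bdd-mono (n≤1+n _) bd' ,
        moves-weaken (≤-trans (≤-reflexive (sym (+-assoc (h + h + 1 + _) 1 _)))
                       (+-mono-≤ (≤-trans (seek-cost 1 hB (f (suc i)) (s≤s z≤n)) (unit-mono (m≤n+m B (1 + d)))) (*-monoʳ-≤ d (unit-mono (n≤1+n _)))))
          (moves-seq (moves-seek-counter z v o (suc i) h) (branch b eq M))
    where
      branch : ∀ b {k h'} → g (content z (v , o) (lookup v i)) ≡ b →
        Moves (if b then P else Q) (lookup v i) (content z (v , o)) k h' (content z s') →
        Moves (ifT g P Q) (lookup v i) (content z (v , o)) (suc k) h' (content z s')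
      branch true  = moves-if-true g
      branch false = moves-if-false g

  tri-LF : ∀ z P s → Tri z (cost P) s ⟦ P ⟧ (exec z P s)
  tri-LF z skip      (v , o) = tri-unit λ {B} {h} b hB →
       (h , m≤n⇒m≤1+n hB , bdd-mono (n≤1+n B) b ,
        moves-weaken (≤-trans (s≤s z≤n) (m≤n+m 6 (4 * B))) (moves-modify id stay refl (λ _ _ → refl)))
  tri-LF z (inc j)   (v , o) = subst (λ u → Tri z 1 (v , o) ⟦ inc j ⟧ (u , o))
    (VP.updateAt-cong-local j v refl) (tri-inc z j v o)
  tri-LF z (dec j)   (v , o) = subst (λ u → Tri z 1 (v , o) ⟦ dec j ⟧ (u , o))
    (VP.updateAt-cong-local j v refl) (tri-dec z j v o)
  tri-LF z (reset j) (v , o) = tri-reset z j v o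
  tri-LF z (copy j b) (v , o) = tri-copy z j b v o
  tri-LF z (emit b)  (v , o) = tri-emit z b v o
  tri-LF z (P ▹ Q)   s = tri-seq (tri-LF z P s) (tri-LF z Q (exec z P s))
  tri-LF z (ifLt i b P Q) (v , o) with lookup v i <ᵇ value v b in eq
  ... | true  = tri-branch i (λ v → lookup v (track b)) true  (trans (content-track z v o b (lookup v i)) eq)
                  (tri-weaken (m≤m+n (cost P) (cost Q)) (tri-LF z P (v , o)))
  ... | false = tri-branch i (λ v → lookup v (track b)) false (trans (content-track z v o b (lookup v i)) eq)
                  (tri-weaken (m≤n+m (cost Q) (cost P)) (tri-LF z Q (v , o)))
  tri-LF z (ifBit i P Q) (v , o) with bitAt z (lookup v i) in eq
  ... | true  = tri-branch i (λ v → lookup v zero) true  eq (tri-weaken (m≤m+n (cost P) (cost Q)) (tri-LF z P (v , o)))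
  ... | false = tri-branch i (λ v → lookup v zero) false eq (tri-weaken (m≤n+m (cost Q) (cost P)) (tri-LF z Q (v , o)))

  tri-exec : ∀ {z s s'} P → exec z P s ≡ s' → Tri z (cost P) s ⟦ P ⟧ s'
  tri-exec {z} {s} P eq = subst (Tri z (cost P) s ⟦ P ⟧) eq (tri-LF z P s)

  -- The loop test is meaningful only on the cell numbered by i. The body may leave the head
  -- anywhere and may change i, so each round ends with a new seek.
  whileLt : Counter → Bound → Prog → Prog
  whileLt i b P = seek ℓ (track (suc i)) ⨾ whileT (λ v → lookup v (track b)) (P ⨾ seek ℓ (track (suc i)))

  below : Counter → Bound → St → Bool
  below i b (v , o) = lookup v i <ᵇ value v b

  at : St → Counter → ℕ
  at (v , o) i = lookup v i

  private
    loop : ∀ {z} i b {P d} (s : ℕ → St) n →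
      (∀ m → m < n → below i b (s m) ≡ true × Tri z d (s m) P (s (suc m))) → below i b (s n) ≡ false →
      ∀ {B} → Bdd B (s 0) → Bdd (n * suc d + B) (s n) ×
      Moves (whileT (λ v → lookup v (track b)) (P ⨾ seek ℓ (track (suc i)))) (at (s 0) i) (content z (s 0))
            (n * suc d * unit (n * suc d + B) + 1) (at (s n) i) (content z (s n))
    loop {z} i b s zero    body end bd = bd ,
      moves-while-false (λ v → lookup v (track b)) (trans (content-track z (proj₁ (s 0)) (proj₂ (s 0)) b _) end)
    loop {z} i b {P} {d} s (suc n) body end {B} bd
      with run (proj₂ (body 0 (s≤s z≤n))) bd (counters bd (suc i))
    ... | h' , h'≤ , bd' , M with loop i b (s ∘ suc) n (λ m lt → body (suc m) (s≤s lt)) end bd'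
    ... | bd'' , N = bdd-mono le bd'' ,
          moves-weaken cost≤
            (moves-while-true (λ v → lookup v (track b))
              (trans (content-track z (proj₁ (s 0)) (proj₂ (s 0)) b _) (proj₁ (body 0 (s≤s z≤n))))
              (moves-seq M (moves-seek-counter z (proj₁ (s 1)) (proj₂ (s 1)) (suc i) h')) N)
      where
        E = suc n * suc d + B
        le : n * suc d + (d + B) ≤ E
        le = ≤-trans (≤-reflexive (trans (sym (+-assoc (n * suc d) d B)) (cong (_+ B) (+-comm (n * suc d) d)))) (n≤1+n _)
        le₁ : d + B ≤ E
        le₁ = ≤-trans (m≤n+m (d + B) (n * suc d)) le
        x = h' + h' + 1 + (at (s 1) i + at (s 1) i + 1)
        y = n * suc d * unit (n * suc d + (d + B))
        x≤ : x + 1 ≤ unit E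
        x≤ = ≤-trans (seek-cost 1 h'≤ (counters bd' (suc i)) (s≤s z≤n)) (unit-mono le₁)
        cost≤ : suc (d * unit (d + B) + x + (y + 1)) ≤ suc n * suc d * unit E + 1
        cost≤ = ≤-trans (≤-reflexive (solve 3 (λ a x y → con 1 :+ (a :+ x :+ (y :+ con 1)) := (x :+ con 1) :+ a :+ y :+ con 1) refl (d * unit (d + B)) x y))
          (+-monoˡ-≤ 1 (≤-trans (+-mono-≤ (+-mono-≤ x≤ (*-monoʳ-≤ d (unit-mono le₁))) (*-monoʳ-≤ (n * suc d) (unit-mono le)))
            (≤-reflexive (sym (*-distribʳ-+ (unit E) (suc d) (n * suc d))))))
          where open +-*-Solver

  -- The run is supplied as a family of states, so that a loop invariant becomes a closed formula
  -- for `s m`. A round costs d for its body and one unit for the seek and the test; the leading 1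
  -- pays for the first seek.
  tri-while : ∀ {z} i b {P d} (s : ℕ → St) n →
    (∀ m → m < n → below i b (s m) ≡ true × Tri z d (s m) P (s (suc m))) → below i b (s n) ≡ false →
    Tri z (1 + n * suc d) (s 0) (whileLt i b P) (s n)
  tri-while {z} i b {P} {d} s n body end .run {B} {h} bd hB with loop i b s n body end bd
  ... | bd' , M = at (s n) i , ≤-trans (counters bd' (suc i)) (n≤1+n _) , bdd-mono (n≤1+n _) bd' ,
        moves-weaken cost≤ (moves-seq (moves-seek-counter z (proj₁ (s 0)) (proj₂ (s 0)) (suc i) h) M)
    where
      c = n * suc d
      x = h + h + 1 + (at (s 0) i + at (s 0) i + 1)
      cost≤ : x + (c * unit (c + B) + 1) ≤ unit (1 + c + B) + c * unit (1 + c + B)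
      cost≤ = ≤-trans (≤-reflexive (solve 2 (λ x y → x :+ (y :+ con 1) := (x :+ con 1) :+ y) refl x (c * unit (c + B))))
        (+-mono-≤ (≤-trans (seek-cost 1 hB (counters bd (suc i)) (s≤s z≤n)) (unit-mono (m≤n+m B (1 + c))))
                  (*-monoʳ-≤ c (unit-mono (n≤1+n _))))
        where open +-*-Solver

  for : Counter → Bound → Prog → Prog
  for i b P = whileLt i b (P ⨾ ⟦ inc i ⟧) ⨾ ⟦ reset i ⟧

  loopCost : ℕ → ℕ → ℕ
  loopCost n d = 1 + n * suc (d + 1) + 1

  loopCost-mono : ∀ {m n d} → m ≤ n → loopCost m d ≤ loopCost n d
  loopCost-mono {d = d} le = +-monoˡ-≤ 1 (+-monoʳ-≤ 1 (*-monoˡ-≤ (suc (d + 1)) le))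

  -- The state `s' m` comes after the body of round m but before the increment, when counter i still
  -- shows m. With both families given, the bookkeeping of the counter usually holds by computation.
  tri-for : ∀ {z} i b {P d} (s s' : ℕ → St) n {s''} →
    (∀ m → m < n → below i b (s m) ≡ true) → below i b (s n) ≡ false →
    (∀ m → m < n → Tri z d (s m) P (s' m)) → (∀ m → m < n → exec z (inc i) (s' m) ≡ s (suc m)) →
    exec z (reset i) (s n) ≡ s'' → Tri z (loopCost n d) (s 0) (for i b P) s''
  tri-for i b s s' n on off body step end =
    tri-seq (tri-while i b s n (λ m lt → on m lt , tri-seq (body m lt) (tri-exec (inc i) (step m lt))) off)
      (tri-exec (reset i) end)

-- Polynomial bounds and complete machines

PolyBounded : (ℕ → ℕ) → Set
PolyBounded f = Σ Poly λ p → ∀ n → f n ≤ evalPoly p n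

module _ where
  open +-*-Solver
  open ≤-Reasoning

  private
    addPoly : Poly → Poly → Poly
    addPoly []       q        = q
    addPoly (c ∷ p)  []       = c ∷ p
    addPoly (c ∷ p)  (d ∷ q)  = c + d ∷ addPoly p q

    addPoly-eval : ∀ p q n → evalPoly (addPoly p q) n ≡ evalPoly p n + evalPoly q n
    addPoly-eval []      q       n = refl
    addPoly-eval (c ∷ p) []      n = sym (+-identityʳ _)
    addPoly-eval (c ∷ p) (d ∷ q) n rewrite addPoly-eval p q n =
      solve 5 (λ c d n x y → c :+ d :+ n :* (x :+ y) := c :+ n :* x :+ (d :+ n :* y)) refl
        c d n (evalPoly p n) (evalPoly q n)

    scale : ℕ → Poly → Poly
    scale c = map (c *_)

    scale-eval : ∀ c q n → evalPoly (scale c q) n ≡ c * evalPoly q n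
    scale-eval c []      n = sym (*-zeroʳ c)
    scale-eval c (d ∷ q) n rewrite scale-eval c q n =
      solve 4 (λ c d n y → c :* d :+ n :* (c :* y) := c :* (d :+ n :* y)) refl c d n (evalPoly q n)

    mulPoly : Poly → Poly → Poly
    mulPoly []      q = []
    mulPoly (c ∷ p) q = addPoly (scale c q) (0 ∷ mulPoly p q)

    mulPoly-eval : ∀ p q n → evalPoly (mulPoly p q) n ≡ evalPoly p n * evalPoly q n
    mulPoly-eval []      q n = refl
    mulPoly-eval (c ∷ p) q n
      rewrite addPoly-eval (scale c q) (0 ∷ mulPoly p q) n | scale-eval c q n | mulPoly-eval p q n =
      solve 4 (λ c n x y → c :* y :+ n :* (x :* y) := (c :+ n :* x) :* y) refl c n (evalPoly p n) (evalPoly q n)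

  pb-const : ∀ c → PolyBounded (λ _ → c)
  pb-const c = (c ∷ []) , λ n → m≤m+n c _

  pb-id : PolyBounded (λ n → n)
  pb-id = (0 ∷ 1 ∷ []) , λ n →
    ≤-reflexive (solve 1 (λ n → n := n :* (con 1 :+ n :* con 0)) refl n)

  pb-+ : ∀ {f g} → PolyBounded f → PolyBounded g → PolyBounded (λ n → f n + g n)
  pb-+ (p , f≤) (q , g≤) = addPoly p q , λ n →
    ≤-trans (+-mono-≤ (f≤ n) (g≤ n)) (≤-reflexive (sym (addPoly-eval p q n)))

  pb-* : ∀ {f g} → PolyBounded f → PolyBounded g → PolyBounded (λ n → f n * g n)
  pb-* (p , f≤) (q , g≤) = mulPoly p q , λ n →
    ≤-trans (*-mono-≤ (f≤ n) (g≤ n)) (≤-reflexive (sym (mulPoly-eval p q n)))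

  pb-eval : ∀ q {f} → PolyBounded f → PolyBounded (λ n → evalPoly q (f n))
  pb-eval []      b = pb-const 0
  pb-eval (c ∷ q) b = pb-+ (pb-const c) (pb-* b (pb-eval q b))

  pb-≤ : ∀ {f g} → (∀ n → f n ≤ g n) → PolyBounded g → PolyBounded f
  pb-≤ le (p , g≤) = p , λ n → ≤-trans (le n) (g≤ n)

fromBits : ∀ {n} → Vec Bool n → Fin (2 ^ n)
fromBits []          = zero
fromBits (false ∷ v) = combine {2} zero (fromBits v)
fromBits (true ∷ v)  = combine {2} (suc zero) (fromBits v)

toBits : ∀ n → Fin (2 ^ n) → Vec Bool n
toBits zero    _ = []
toBits (suc n) i with remQuot {2} (2 ^ n) i
... | zero  , j = false ∷ toBits n j
... | suc _ , j = true ∷ toBits n j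

toBits-fromBits : ∀ {n} (v : Vec Bool n) → toBits n (fromBits v) ≡ v
toBits-fromBits []          = refl
toBits-fromBits {suc n} (false ∷ v) rewrite remQuot-combine {2} {2 ^ n} zero (fromBits v) =
  cong (false ∷_) (toBits-fromBits v)
toBits-fromBits {suc n} (true ∷ v)  rewrite remQuot-combine {2} {2 ^ n} (suc zero) (fromBits v) =
  cong (true ∷_) (toBits-fromBits v)

drop-bitAt : ∀ o h → h < length o → drop h o ≡ bitAt o h ∷ drop (suc h) o
drop-bitAt (x ∷ o) zero    _        = refl
drop-bitAt (x ∷ o) (suc h) (s≤s lt) = drop-bitAt o h lt

-- Complete machines: from the input tape to the output tape

module Complete (k e : ℕ) (toFin : Vec Bool (5 + k) → Fin e) (fromFin : Fin e → Vec Bool (5 + k))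
                (fromFin-toFin : ∀ v → fromFin (toFin v) ≡ v) where

  open Counters k e toFin fromFin fromFin-toFin public

  private
    bitSym : Bool → Symbol
    bitSym false = suc zero
    bitSym true  = suc (suc zero)

    readBits-∷ : ∀ P b r → readBits (machine P) (bitSym b ∷ r) ≡ b ∷ readBits (machine P) r
    readBits-∷ P false r = refl
    readBits-∷ P true  r = refl

    under-nth : ∀ l (s : Symbol) r → nth zero (l ʳ++ (s ∷ r)) (length l) ≡ s
    under-nth l s r = trans (cong (nth zero (l ʳ++ (s ∷ r))) (sym (+-identityʳ _))) (nth-ʳ++ zero l (s ∷ r) 0)

  release : Move → Prog
  release m = act (λ s → bitSym (lookup (decode s) (suc zero)) , m)

  releaseAll : Prog
  releaseAll = whileT (λ v → not (lookup v ℓ)) (release left)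

  -- Replaces the tracks of the output by plain bits, from its last cell to its first.
  finish : Prog
  finish = seek ℓ (suc (suc zero)) ⨾ act (λ _ → zero , left) ⨾ releaseAll ⨾ release stay

  -- Marking the leftmost cell is the only preparation: by the choice of `plain` the input tape then
  -- has the content of `start z`.
  complete : Prog → Prog
  complete P = modify (_[ ℓ ]≔ true) stay ⨾ P ⨾ finish

  private
    -- The symbols themselves matter now, not just their contents, since `readBits` recognises only
    -- plain bits. The invariant is therefore about lists: cells up to h still carry the old
    -- content, and what lies to the right of the head already reads as the rest of the output.
    release-loop : ∀ R z v o h l s r → length l ≡ h →
      (∀ i → i ≤ h → decode (nth zero (l ʳ++ (s ∷ r)) i) ≡ content z (v , o) i) → h < length o →
      readBits (machine R) r ≡ drop (suc h) o →
      Σ Symbol λ s' → Σ (List Symbol) λ r' → Run releaseAll (l , s ∷ r) (h + h + 1) ([] , s' ∷ r') ×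
        decode s' ≡ content z (v , o) 0 × readBits (machine R) r' ≡ drop 1 o
    release-loop R z v o zero [] s r refl c lt eq =
      s , r , run-while-false (cong (λ u → not (lookup u ℓ)) (c 0 z≤n)) , c 0 z≤n , eq
    release-loop R z v o (suc h) (x ∷ l) s r refl c lt eq
      with release-loop R z v o h l x (bitSym (lookup (decode s) (suc zero)) ∷ r) refl
             (λ i le → trans (cong decode (nth-ʳ++-cong zero l 1 (λ { zero _ → refl ; (suc zero) ne → ⊥-elim (ne refl) ; (suc (suc j)) _ → refl }) i
                         (λ i≡ → <-irrefl i≡ (≤-trans (s≤s le) (≤-reflexive (+-comm 1 (length l)))))))
                       (c i (m≤n⇒m≤1+n le)))
             (<⇒≤ lt)
             (trans (readBits-∷ R _ r) (trans (cong₂ _∷_ (cong (λ u → lookup u (suc zero)) s≡) eq) (sym (drop-bitAt o (suc h) lt))))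
      where
        s≡ : decode s ≡ content z (v , o) (suc h)
        s≡ = trans (cong decode (sym (under-nth (x ∷ l) s r))) (c (suc h) ≤-refl)
    ... | s' , r' , R' , d , e' = s' , r' ,
      subst (λ n → Run releaseAll (x ∷ l , s ∷ r) n ([] , s' ∷ r')) (cong suc (cong (_+ 1) (sym (+-suc h h))))
        (run-while-true (cong (λ u → not (lookup u ℓ)) s≡) (run-act _ _) R') , d , e'
      where
        s≡ : decode s ≡ content z (v , o) (suc h)
        s≡ = trans (cong decode (sym (under-nth (x ∷ l) s r))) (c (suc h) ≤-refl)

    -- The blank put behind the output makes `readBits` stop there. For an empty output it would
    -- overwrite the mark of the leftmost cell, and the walk to the left would not end; hence the
    -- output must be nonempty.
    finish-run : ∀ R z v o {h t} → Holds h (content z (v , o)) t → 0 < length o →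
      Σ Tape λ t' → Σ ℕ λ j → j ≤ h + h + 1 + (length o + length o + 1) + (1 + (length o + length o + 1 + 1)) ×
        Run finish t j t' × readBits (machine R) (proj₂ t') ≡ o
    finish-run R z v o@(b ∷ o') {h} H _
      with moves-seek ℓ {content z (v , o)} (λ i → refl) h (suc (suc zero)) (length o) (λ i → refl) H
    ... | (x ∷ l , r) , j , j≤ , S , holds leq c
      with release-loop R z v o (length o') l x (zero ∷ tl r) (suc-injective leq)
             (λ i le → trans (cong decode (nth-ʳ++-cong zero l 1 (λ { zero _ → refl ; (suc zero) ne → ⊥-elim (ne refl) ; (suc (suc j)) _ → nth-tl-suc r j }) i
                         (λ i≡ → <-irrefl i≡ (≤-trans (s≤s (subst (i ≤_) (sym (suc-injective leq)) le)) (≤-reflexive (+-comm 1 (length l)))))))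
                       (c i))
             ≤-refl (sym (drop-length o'))
      where
        nth-tl-suc : ∀ (r : List Symbol) j → nth zero (tl r) j ≡ nth zero r (suc j)
        nth-tl-suc []      j = refl
        nth-tl-suc (_ ∷ _) j = refl
        drop-length : ∀ (xs : Str) → drop (length xs) xs ≡ []
        drop-length []       = refl
        drop-length (_ ∷ xs) = drop-length xs
    ... | s' , r' , L , d , e' = _ , _ ,
      +-mono-≤ j≤ (s≤s (+-monoˡ-≤ 1 (+-monoˡ-≤ 1 (+-mono-≤ (n≤1+n _) (n≤1+n _))))) ,
      run-seq S (run-seq (run-act _ _) (run-seq L (run-act _ _))) ,
      trans (readBits-∷ R _ r') (cong₂ _∷_ (cong (λ u → lookup u (suc zero)) d) e')

    decode-input : ∀ R z i → decode (nth zero (map (encBit (machine R)) z) i) ≡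
      bitAt z i ∷ false ∷ false ∷ false ∷ (i <ᵇ length z) ∷ V.replicate k false
    decode-input R []          i       = refl
    decode-input R (false ∷ z) zero    = refl
    decode-input R (true ∷ z)  zero    = refl
    decode-input R (b ∷ z)     (suc i) = decode-input R z i

  start : Str → St
  start z = length z ∷ V.replicate k 0 , []

  private
    content-start : ∀ z i b → (i <ᵇ 1) ≡ b →
      content z (start z) i ≡ bitAt z i ∷ false ∷ false ∷ b ∷ (i <ᵇ length z) ∷ V.replicate k false
    content-start z i b eq = cong₂ (λ x u → bitAt z i ∷ false ∷ false ∷ x ∷ (i <ᵇ length z) ∷ u) eq
      (VP.map-replicate (i <ᵇ_) 0 k)

    bdd-start : ∀ z → Bdd (suc (length z)) (start z)
    bdd-start z = h , z≤n
      where
        h : ∀ b → value (proj₁ (start z)) b ≤ suc (length z)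
        h zero          = s≤s z≤n
        h (suc zero)    = n≤1+n _
        h (suc (suc b)) = ≤-trans (≤-reflexive (VP.lookup-replicate b 0)) z≤n

  -- The start state is bounded by `suc n`, the successor accounting for the constant counter 1 on
  -- an empty input. The last summand pays for the mark, the final seek and the conversion of the
  -- output, with all values at most d + suc n.
  total : ℕ → ℕ → ℕ
  total d n = d * unit (d + suc n) + (6 * (d + suc n) + 6)

  complete-computes : ∀ {z P d v o} → Tri z d (start z) P (v , o) → 0 < length o →
    ∀ {n} → total d (length z) ≤ n →
    Σ (Config (machine (complete P))) λ c →
      haltsWithin (machine (complete P)) n (initial (machine (complete P)) z) ≡ just c ×
      output (machine (complete P)) c ≡ o
  complete-computes {z} {P} {d} {v} {o} t pos {n} le
    with moves-modify {C = λ i → decode (nth zero (map (encBit (machine (complete P))) z) i)}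
           {C' = content z (start z)} (_[ ℓ ]≔ true) stay
           (trans (content-start z 0 true refl) (sym (cong (_[ ℓ ]≔ true) (decode-input (complete P) z 0))))
           (λ { zero ne → ⊥-elim (ne refl)
              ; (suc i) _ → trans (content-start z (suc i) false refl) (sym (decode-input (complete P) z (suc i))) })
           (holds {t = [] , map (encBit (machine (complete P))) z} refl (λ _ → refl))
       | run t (bdd-start z) z≤n
  ... | t₁ , j₁ , j₁≤ , R₁ , H₁ | h' , h'≤ , bd , M with M H₁
  ... | t₂ , j₂ , j₂≤ , R₂ , H₂ with finish-run (complete P) z v o H₂ pos
  ... | t₃ , j₃ , j₃≤ , R₃ , out =
    _ , run-machine (run-seq R₁ (run-seq R₂ R₃)) (≤-trans cost≤ le) , out
    where
      E = d + suc (length z)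
      cost≤ : j₁ + (j₂ + j₃) ≤ total d (length z)
      cost≤ = begin
        j₁ + (j₂ + j₃)
          ≤⟨ +-mono-≤ j₁≤ (+-mono-≤ j₂≤ (≤-trans j₃≤
               (+-mono-≤ (+-mono-≤ (+-monoˡ-≤ 1 (+-mono-≤ h'≤ h'≤)) (+-monoˡ-≤ 1 (+-mono-≤ o≤ o≤)))
                         (s≤s (+-monoˡ-≤ 1 (+-monoˡ-≤ 1 (+-mono-≤ o≤ o≤))))))) ⟩
        1 + (d * unit E + (E + E + 1 + (E + E + 1) + (1 + (E + E + 1 + 1))))
          ≡⟨ solve 2 (λ a E → con 1 :+ (a :+ (E :+ E :+ con 1 :+ (E :+ E :+ con 1) :+ (con 1 :+ (E :+ E :+ con 1 :+ con 1)))) :=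
                     a :+ (con 6 :* E :+ con 6)) refl (d * unit E) E ⟩
        total d (length z) ∎
        where
          open +-*-Solver
          open ≤-Reasoning
          o≤ : length o ≤ E
          o≤ = Bdd.written bd

  pb-total : ∀ {d} → PolyBounded d → PolyBounded (λ n → total (d n) n)
  pb-total b = pb-+ (pb-* b (pb-+ (pb-* (pb-const 4) E) (pb-const 6))) (pb-+ (pb-* (pb-const 6) E) (pb-const 6))
    where E = pb-+ b (pb-+ (pb-const 1) pb-id)

-- Membership in MNS

-- A one-pass reader of formula codes that evaluates the formula under the assignment y.
-- In `cl n m` the unary length of a clause is being read, `sgn n l b` and `idx s n l b i` stand
-- within a clause with l more literals to follow, b tells whether a literal was satisfied so far.
data Reader : Set where
  hdr  : ℕ → Reader
  cl   : ℕ → ℕ → Reader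
  sgn  : ℕ → ℕ → Bool → Reader
  idx  : Bool → ℕ → ℕ → Bool → ℕ → Reader
  dead : Reader

-- A falsified clause is treated like a syntax error: both lead to `dead`, so the final state
-- decides well-formedness and satisfaction together.
closeLiteral : ℕ → ℕ → Bool → Reader
closeLiteral n zero    true  = cl n 0
closeLiteral n zero    false = dead
closeLiteral n (suc l) b     = sgn n l b

readBit : (ℕ → Bool) → Reader → Bool → Reader
readBit y (hdr n)           true  = hdr (suc n)
readBit y (hdr n)           false = cl n 0
readBit y (cl n m)          true  = cl n (suc m)
readBit y (cl n zero)       false = dead
readBit y (cl n (suc l))    false = sgn n l false
readBit y (sgn n l b)       s     = idx s n l b 0
readBit y (idx s n l b i)   true  = idx s n l b (suc i)
readBit y (idx s n l b i)   false = if i <ᵇ n then closeLiteral n l (b ∨ does (y i ≟B s)) else dead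
readBit y dead              _     = dead

readAll : (ℕ → Bool) → Reader → Str → Reader
readAll y A []       = A
readAll y A (b ∷ xs) = readAll y (readBit y A b) xs

accepts : Reader → Bool
accepts (cl n zero) = true
accepts _           = false

variables : Reader → ℕ
variables (hdr n)         = n
variables (cl n _)        = n
variables (sgn n _ _)     = n
variables (idx _ n _ _ _) = n
variables dead            = 0

verify : Str → Str → Bool
verify x y = accepts A ∧ not (any id (drop (variables A) y))
  where A = readAll (bitAt y) (hdr 0) x

readAll-dead : ∀ y xs → readAll y dead xs ≡ dead
readAll-dead y []       = refl
readAll-dead y (x ∷ xs) = readAll-dead y xs

module _ {n} (y : ℕ → Bool) (a : Vec Bool n) (agree : ∀ i → y (toℕ i) ≡ lookup a i) where

  private
    read-hdr : ∀ k m w → readAll y (hdr m) (encNat k ++ w) ≡ readAll y (cl (k + m) 0) w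
    read-hdr zero    m w = refl
    read-hdr (suc k) m w = trans (read-hdr k (suc m) w) (cong (λ z → readAll y (cl z 0) w) (+-suc k m))

    read-idx : ∀ s l b k i w → readAll y (idx s n l b i) (encNat k ++ w) ≡
               readAll y (if k + i <ᵇ n then closeLiteral n l (b ∨ does (y (k + i) ≟B s)) else dead) w
    read-idx s l b zero    i w = refl
    read-idx s l b (suc k) i w = trans (read-idx s l b k (suc i) w)
      (cong (λ z → readAll y (if z <ᵇ n then closeLiteral n l (b ∨ does (y z ≟B s)) else dead) w) (+-suc k i))

    read-lit : ∀ l b p w → readAll y (sgn n l b) (encLit p ++ w) ≡ readAll y (closeLiteral n l (b ∨ litSat a p)) w
    read-lit l b (i , s) w = trans (read-idx s l b (toℕ i) 0 w) (cong (λ A → readAll y A w) eq)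
      where
        eq : (if toℕ i + 0 <ᵇ n then closeLiteral n l (b ∨ does (y (toℕ i + 0) ≟B s)) else dead) ≡
             closeLiteral n l (b ∨ litSat a (i , s))
        eq rewrite +-identityʳ (toℕ i) | <ᵇ-true (toℕ<n i) | agree i = refl

    read-lits : ∀ c b p w → readAll y (sgn n (length c) b) (concatMap encLit (p ∷ c) ++ w) ≡
                readAll y (closeLiteral n 0 (b ∨ any (litSat a) (p ∷ c))) w
    read-lits [] b p w = trans (cong (readAll y (sgn n 0 b)) (++-assoc (encLit p) [] w))
      (trans (read-lit 0 b p w) (cong (λ z → readAll y (closeLiteral n 0 (b ∨ z)) w) (sym (∨-identityʳ (litSat a p)))))
    read-lits (q ∷ c) b p w = trans (cong (readAll y (sgn n (suc (length c)) b)) (++-assoc (encLit p) (concatMap encLit (q ∷ c)) w))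
      (trans (read-lit (suc (length c)) b p _) (trans (read-lits c (b ∨ litSat a p) q w)
        (cong (λ z → readAll y (closeLiteral n 0 z) w) (∨-assoc b (litSat a p) _))))

    read-cl : ∀ k m w → readAll y (cl n m) (encNat k ++ w) ≡ readAll y (readBit y (cl n (k + m)) false) w
    read-cl zero    m w = refl
    read-cl (suc k) m w = trans (read-cl k (suc m) w) (cong (λ z → readAll y (readBit y (cl n z) false) w) (+-suc k m))

    read-clause : ∀ c w → readAll y (cl n 0) (encClause c ++ w) ≡ readAll y (closeLiteral n 0 (any (litSat a) c)) w
    read-clause [] w = refl
    read-clause (p ∷ c) w = trans (cong (readAll y (cl n 0)) (++-assoc (encNat (suc (length c))) (concatMap encLit (p ∷ c)) w))
      (trans (read-cl (suc (length c)) 0 _)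
        (trans (cong (λ z → readAll y (readBit y (cl n (suc z)) false) (concatMap encLit (p ∷ c) ++ w)) (+-identityʳ (length c)))
          (read-lits c false p w)))

    read-clauses : ∀ (φ : CNF n) → readAll y (cl n 0) (concatMap encClause φ) ≡ (if cnfSat a φ then cl n 0 else dead)
    read-clauses []      = refl
    read-clauses (c ∷ φ) with any (litSat a) c | read-clause c (concatMap encClause φ)
    ... | true  | eq = trans eq (read-clauses φ)
    ... | false | eq = trans eq (readAll-dead y (concatMap encClause φ))

  readAll-encCNF : ∀ (φ : CNF n) → readAll y (hdr 0) (encCNF φ) ≡ (if cnfSat a φ then cl n 0 else dead)
  readAll-encCNF φ = trans (read-hdr n 0 (concatMap encClause φ))
    (trans (cong (λ z → readAll y (cl z 0) (concatMap encClause φ)) (+-identityʳ n)) (read-clauses φ))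

private
  bitAt-toList : ∀ {n} (a : Vec Bool n) r i → bitAt (V.toList a ++ r) (toℕ i) ≡ lookup a i
  bitAt-toList (x ∷ a) r zero    = refl
  bitAt-toList (x ∷ a) r (suc i) = bitAt-toList a r i

  drop-toList : ∀ {n} (a : Vec Bool n) (r : Str) → drop n (V.toList a ++ r) ≡ r
  drop-toList []      r = refl
  drop-toList (x ∷ a) r = drop-toList a r

verify-encCNF : ∀ {n} (φ : CNF n) a r → verify (encCNF φ) (V.toList a ++ r) ≡ cnfSat a φ ∧ not (any id r)
verify-encCNF φ a r
  rewrite readAll-encCNF (bitAt (V.toList a ++ r)) a (bitAt-toList a r) φ with cnfSat a φ
... | true  = cong (λ z → not (any id z)) (drop-toList a r)
... | false = refl

-- The syntax still expected in each state. The truth values seen so far are ignored, because an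
-- accepted assignment is used here only as evidence that x is the code of some formula.
Parsed : Reader → Str → Set
Parsed (hdr m) xs = Σ ℕ λ n → Σ (CNF n) λ φ → Σ ℕ λ k → n ≡ k + m × xs ≡ encNat k ++ concatMap encClause φ
Parsed (cl n m) xs = (xs ≡ [] × m ≡ 0) ⊎ Σ (Clause n) λ c → Σ (CNF n) λ φ → Σ ℕ λ k →
  length c ≡ k + m × xs ≡ encNat k ++ concatMap encLit c ++ concatMap encClause φ
Parsed (sgn n l b) xs = Σ (Clause n) λ c → Σ (CNF n) λ φ →
  length c ≡ suc l × xs ≡ concatMap encLit c ++ concatMap encClause φ
Parsed (idx s n l b i) xs = Σ (Clause n) λ c → Σ (CNF n) λ φ → Σ ℕ λ k →
  k + i < n × length c ≡ l × xs ≡ encNat k ++ concatMap encLit c ++ concatMap encClause φ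
Parsed dead xs = ⊥

private
  <ᵇ⁻ : ∀ {m n} → (m <ᵇ n) ≡ true → m < n
  <ᵇ⁻ {m} {n} eq with m <? n
  ... | yes lt = lt
  ... | no ge with trans (sym eq) (<ᵇ-false (≮⇒≥ ge))
  ... | ()

  parsed-cl : ∀ {n xs} → Parsed (cl n 0) xs → Σ (CNF n) λ φ → xs ≡ concatMap encClause φ
  parsed-cl (inj₁ (refl , _)) = [] , refl
  parsed-cl (inj₂ (c , φ , k , eq , refl)) = c ∷ φ ,
    trans (cong (λ j → encNat j ++ concatMap encLit c ++ concatMap encClause φ) (sym (trans eq (+-identityʳ k))))
      (sym (++-assoc (encNat (length c)) (concatMap encLit c) (concatMap encClause φ)))

parse : ∀ y xs A → accepts (readAll y A xs) ≡ true → Parsed A xs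
parse y [] (cl n zero) acc = inj₁ (refl , refl)
parse y (true ∷ xs) (hdr m) acc with parse y xs (hdr (suc m)) acc
... | n , φ , k , refl , refl = n , φ , suc k , +-suc k m , refl
parse y (false ∷ xs) (hdr m) acc with parsed-cl (parse y xs (cl m 0) acc)
... | φ , refl = m , φ , 0 , refl , refl
parse y (true ∷ xs) (cl n m) acc with parse y xs (cl n (suc m)) acc
... | inj₂ (c , φ , k , eq , refl) = inj₂ (c , φ , suc k , trans eq (+-suc k m) , refl)
parse y (false ∷ xs) (cl n zero) acc = ⊥-elim (parse y xs dead acc)
parse y (false ∷ xs) (cl n (suc l)) acc with parse y xs (sgn n l false) acc
... | c , φ , eq , refl = inj₂ (c , φ , 0 , eq , refl)
parse y (s ∷ xs) (sgn n l b) acc with parse y xs (idx s n l b 0) acc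
... | c , φ , k , lt , eq , refl = (i , s) ∷ c , φ , cong suc eq ,
  cong (s ∷_) (trans (cong (λ j → encNat j ++ concatMap encLit c ++ concatMap encClause φ) (sym toℕ-i))
    (sym (++-assoc (encNat (toℕ i)) (concatMap encLit c) (concatMap encClause φ))))
  where
    k<n = subst (_< n) (+-identityʳ k) lt
    i = Data.Fin.fromℕ< k<n
    toℕ-i : toℕ i ≡ k
    toℕ-i = toℕ-fromℕ< k<n
parse y (true ∷ xs) (idx s n l b i) acc with parse y xs (idx s n l b (suc i)) acc
... | c , φ , k , lt , eq , refl = c , φ , suc k , subst (_< n) (+-suc k i) lt , eq , refl
parse y (false ∷ xs) (idx s n l b i) acc with i <ᵇ n in i<n
... | false = ⊥-elim (parse y xs dead acc)
... | true  with l | b ∨ does (y i ≟B s)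
...   | suc l | b' with parse y xs (sgn n l b') acc
...     | c , φ , eq , refl = c , φ , 0 , <ᵇ⁻ i<n , eq , refl
parse y (false ∷ xs) (idx s n l b i) acc | true | zero | true with parsed-cl (parse y xs (cl n 0) acc)
...     | φ , refl = [] , φ , 0 , <ᵇ⁻ i<n , refl , refl
parse y (false ∷ xs) (idx s n l b i) acc | true | zero | false = ⊥-elim (parse y xs dead acc)
parse y (b ∷ xs) dead acc = parse y xs dead acc

verify-parse : ∀ x y → verify x y ≡ true → Σ ℕ λ n → Σ (CNF n) λ φ → encCNF φ ≡ x
verify-parse x y eq with accepts (readAll (bitAt y) (hdr 0) x) in acc
... | true with parse (bitAt y) x (hdr 0) acc
...   | _ , φ , k , refl , refl = _ , φ , cong (λ j → encNat j ++ concatMap encClause φ) (+-identityʳ k)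

-- Counting padded witnesses

count : ∀ {A : Set} → (A → Bool) → List A → ℕ
count P xs = length (filter (λ a → P a ≟B true) xs)

count-++ : ∀ {A : Set} (P : A → Bool) xs ys → count P (xs ++ ys) ≡ count P xs + count P ys
count-++ P xs ys = trans (cong length (filter-++ (λ a → P a ≟B true) xs ys)) (length-++ (filter (λ a → P a ≟B true) xs))

count-map : ∀ {A B : Set} (P : B → Bool) (f : A → B) xs → count P (map f xs) ≡ count (P ∘ f) xs
count-map P f []       = refl
count-map P f (x ∷ xs) with P (f x)
... | true  = cong suc (count-map P f xs)
... | false = count-map P f xs

count-cong : ∀ {A : Set} {P Q : A → Bool} → (∀ a → P a ≡ Q a) → ∀ xs → count P xs ≡ count Q xs
count-cong eq []       = refl
count-cong {P = P} {Q} eq (x ∷ xs) with P x | Q x | eq x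
... | true  | _ | refl = cong suc (count-cong eq xs)
... | false | _ | refl = count-cong eq xs

count-false : ∀ {A : Set} (xs : List A) → count (λ _ → false) xs ≡ 0
count-false []       = refl
count-false (x ∷ xs) = count-false xs

count-witness : ∀ {A : Set} (P : A → Bool) xs → 1 ≤ count P xs → Σ A λ a → P a ≡ true
count-witness P (x ∷ xs) le with P x in eq
... | true  = x , eq
... | false = count-witness P xs le

private
  -- Among the strings of length m only the zero string passes. The right-hand side is a count over
  -- the one empty assignment because it serves as the base case of `count-padded`.
  count-zeros : ∀ b m → count (λ r → b ∧ not (any id r)) (allStrings m) ≡ count (λ (_ : Vec Bool 0) → b) ([] ∷ [])
  count-zeros b     zero    = count-zeros₀ b
    where
      count-zeros₀ : ∀ b → count (λ r → b ∧ not (any id r)) ([] ∷ []) ≡ count (λ (_ : Vec Bool 0) → b) ([] ∷ [])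
      count-zeros₀ true  = refl
      count-zeros₀ false = refl
  count-zeros b (suc m) = trans (count-++ _ (map (false ∷_) (allStrings m)) (map (true ∷_) (allStrings m)))
    (trans (cong₂ _+_ (trans (count-map _ (false ∷_) (allStrings m)) (count-zeros b m))
                      (trans (count-map _ (true ∷_) (allStrings m))
                        (trans (count-cong (λ _ → ∧-zeroʳ b) (allStrings m)) (count-false (allStrings m)))))
      (+-identityʳ _))

count-padded : ∀ n m (P : Str → Bool) (Q : Vec Bool n → Bool) →
  (∀ a r → P (V.toList a ++ r) ≡ Q a ∧ not (any id r)) →
  count P (allStrings (n + m)) ≡ count Q (allAssignments n)
count-padded zero m P Q h = trans (count-cong (h []) (allStrings m))
  (trans (count-zeros (Q []) m) (count-cong {P = λ _ → Q []} {Q} (λ { [] → refl }) ([] ∷ [])))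
count-padded (suc n) m P Q h =
  trans (count-++ P (map (false ∷_) (allStrings (n + m))) (map (true ∷_) (allStrings (n + m))))
  (trans (cong₂ _+_ (half false) (half true))
  (sym (count-++ Q (map (false ∷_) (allAssignments n)) (map (true ∷_) (allAssignments n)))))
  where
    half : ∀ b → count P (map (b ∷_) (allStrings (n + m))) ≡ count Q (map (b ∷_) (allAssignments n))
    half b = trans (count-map P (b ∷_) (allStrings (n + m)))
      (trans (count-padded n m (P ∘ (b ∷_)) (Q ∘ (b ∷_)) (λ a r → h (b ∷ a) r))
             (sym (count-map Q (b ∷_) (allAssignments n))))

#sat-verify : ∀ {n} (φ : CNF n) → countWitnesses (verify (encCNF φ)) (length (encCNF φ)) ≡ #sat φ
#sat-verify {n} φ = trans (cong (countWitnesses (verify (encCNF φ))) len)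
  (count-padded n (length (encCNF φ) ∸ n) (verify (encCNF φ)) (λ a → cnfSat a φ) (verify-encCNF φ))
  where
    le : n ≤ length (encCNF φ)
    le = ≤-trans (≤-trans (≤-reflexive (sym (length-replicate n))) (m≤m+n _ 1))
      (≤-trans (≤-reflexive (sym (length-++ (replicate n true))))
        (≤-trans (m≤m+n _ _) (≤-reflexive (sym (length-++ (encNat n))))))
    len : length (encCNF φ) ≡ n + (length (encCNF φ) ∸ n)
    len = sym (m+[n∸m]≡n le)

mersenne-positive : ∀ {m} → IsMersenne m → 1 ≤ m
mersenne-positive (suc t , _ , refl) = ∸-monoˡ-≤ 1 (*-monoʳ-≤ 2 (m^n>0 2 t))

mersenneSAT-verify : ∀ x → MersenneNumberSAT x ⇔ IsMersenne (countWitnesses (verify x) (length x))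
mersenneSAT-verify x = mk⇔
  (λ { (n , φ , refl , m) → subst IsMersenne (sym (#sat-verify φ)) m })
  (λ m → case count-witness (verify x) (allStrings (length x)) (mersenne-positive m) of λ
    { (y , eq) → case verify-parse x y eq of λ { (n , φ , refl) → n , φ , refl , subst IsMersenne (#sat-verify φ) m } })

-- Unique readability of codes is bypassed: two formulas with the same code have equally many
-- satisfying assignments, since both numbers are the count of witnesses of `verify` for this one
-- string.
mersenneSAT-encCNF : ∀ {n} (φ : CNF n) → MersenneNumberSAT (encCNF φ) ⇔ IsMersenne (#sat φ)
mersenneSAT-encCNF φ = mk⇔
  (λ L → subst IsMersenne (#sat-verify φ) (Equivalence.to (mersenneSAT-verify (encCNF φ)) L))
  (λ m → _ , φ , refl , m)

-- Positions in paired strings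

double : ℕ → ℕ
double zero    = zero
double (suc n) = suc (suc (double n))

n≤double : ∀ n → n ≤ double n
n≤double zero    = z≤n
n≤double (suc n) = s≤s (m≤n⇒m≤1+n (n≤double n))

double-mono-≤ : ∀ {m n} → m ≤ n → double m ≤ double n
double-mono-≤ z≤n      = z≤n
double-mono-≤ (s≤s le) = s≤s (s≤s (double-mono-≤ le))

length-pair : ∀ x y → length (pair x y) ≡ length y + (2 + double (length x))
length-pair []      y = +-comm 2 (length y)
length-pair (b ∷ x) y = trans (cong (2 +_) (length-pair x y))
  (sym (trans (+-suc (length y) _) (cong suc (+-suc (length y) _))))

pair-bit₀ : ∀ x y m → m < length x → bitAt (pair x y) (double m) ≡ bitAt x m
pair-bit₀ (b ∷ x) y zero    _        = refl
pair-bit₀ (b ∷ x) y (suc m) (s≤s lt) = pair-bit₀ x y m lt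

pair-bit₁ : ∀ x y m → m < length x → bitAt (pair x y) (suc (double m)) ≡ bitAt x m
pair-bit₁ (b ∷ x) y zero    _        = refl
pair-bit₁ (b ∷ x) y (suc m) (s≤s lt) = pair-bit₁ x y m lt

pair-sep₀ : ∀ x y → bitAt (pair x y) (double (length x)) ≡ false
pair-sep₀ []      y = refl
pair-sep₀ (b ∷ x) y = pair-sep₀ x y

pair-sep₁ : ∀ x y → bitAt (pair x y) (suc (double (length x))) ≡ true
pair-sep₁ []      y = refl
pair-sep₁ (b ∷ x) y = pair-sep₁ x y

pair-rest : ∀ x y i → bitAt (pair x y) (i + (2 + double (length x))) ≡ bitAt y i
pair-rest []      y i = cong (bitAt (false ∷ true ∷ y)) (+-comm i 2)
pair-rest (b ∷ x) y i = trans
  (cong (bitAt (b ∷ b ∷ pair x y)) (trans (+-suc i _) (cong suc (+-suc i _)))) (pair-rest x y i)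

-- The newest test enters on the right, as in the accumulator of a loop.
anyBelow : (ℕ → Bool) → ℕ → Bool
anyBelow f zero    = false
anyBelow f (suc k) = anyBelow f k ∨ f k

anyBelow-drop : ∀ ys n → anyBelow (λ m → bitAt ys (m + n)) (length ys ∸ n) ≡ any id (drop n ys)
anyBelow-drop ys zero = trans (ext _ _ (λ i → cong (bitAt ys) (+-identityʳ i)) (length ys)) (whole ys)
  where
    ext : ∀ f g → (∀ i → f i ≡ g i) → ∀ k → anyBelow f k ≡ anyBelow g k
    ext f g eq zero    = refl
    ext f g eq (suc k) = cong₂ _∨_ (ext f g eq k) (eq k)
    front : ∀ f k → anyBelow f (suc k) ≡ f 0 ∨ anyBelow (f ∘ suc) k
    front f zero    = sym (∨-identityʳ (f 0))
    front f (suc k) = trans (cong (_∨ f (suc k)) (front f k)) (∨-assoc (f 0) _ _)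
    whole : ∀ ys → anyBelow (bitAt ys) (length ys) ≡ any id ys
    whole []       = refl
    whole (b ∷ ys) = trans (front (bitAt (b ∷ ys)) (length ys)) (cong (b ∨_) (whole ys))
anyBelow-drop []       (suc n) = refl
anyBelow-drop (b ∷ ys) (suc n) = trans (ext′ (length ys ∸ n)) (anyBelow-drop ys n)
  where
    ext′ : ∀ k → anyBelow (λ m → bitAt (b ∷ ys) (m + suc n)) k ≡ anyBelow (λ m → bitAt ys (m + n)) k
    ext′ zero    = refl
    ext′ (suc k) = cong₂ _∨_ (ext′ k) (cong (bitAt (b ∷ ys)) (+-suc k n))

<ᵇ-+ʳ : ∀ m n k → (m + k <ᵇ n + k) ≡ (m <ᵇ n)
<ᵇ-+ʳ m n k with m <? n
... | yes lt = trans (<ᵇ-true (+-monoˡ-< k lt)) (sym (<ᵇ-true lt))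
... | no  ge = trans (<ᵇ-false (+-monoˡ-≤ k (≮⇒≥ ge))) (sym (<ᵇ-false (≮⇒≥ ge)))

flag : Bool → ℕ
flag false = 0
flag true  = 1

-- The verifying machine

module Verifier (e : ℕ) (toFin : Vec Bool 14 → Fin e) (fromFin : Fin e → Vec Bool 14)
                (fromFin-toFin : ∀ v → fromFin (toFin v) ≡ v) where

  open Complete 9 e toFin fromFin fromFin-toFin public

  -- Counters: input position, end of x, start of y, start of y plus number of variables, start of y
  -- plus variable index, literals left in the clause, clause satisfied, mode of the reader, flag.
  cA cE cS cN cV cL cB cM cG : Counter
  cA = suc zero
  cE = suc (suc zero)
  cS = suc (suc (suc zero))
  cN = suc (suc (suc (suc zero)))
  cV = suc (suc (suc (suc (suc zero))))
  cL = suc (suc (suc (suc (suc (suc zero)))))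
  cB = suc (suc (suc (suc (suc (suc (suc zero))))))
  cM = suc (suc (suc (suc (suc (suc (suc (suc zero)))))))
  cG = suc (suc (suc (suc (suc (suc (suc (suc (suc zero))))))))

  mode : ℕ → LoopFree
  mode zero    = skip
  mode (suc n) = inc cM ▹ mode n

  die : LoopFree
  die = copy cV (suc cS) ▹ copy cN (suc cS) ▹ reset cL ▹ reset cB ▹ mode 5

  setB : LoopFree
  setB = reset cB ▹ inc cB

  closeLF : LoopFree
  closeLF = copy cV (suc cS) ▹ dec cL ▹ ifLt cL zero (ifLt cB zero die (reset cB ▹ mode 1)) (mode 2)

  -- Each alternative is entered with the mode counter at 0.
  switch : LoopFree → LoopFree → LoopFree → LoopFree → LoopFree → LoopFree → LoopFree
  switch P₀ P₁ P₂ P₃ P₄ P₅ =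
    ifLt cM zero P₀ (dec cM ▹ ifLt cM zero P₁ (dec cM ▹ ifLt cM zero P₂ (dec cM ▹
    ifLt cM zero P₃ (dec cM ▹ ifLt cM zero P₄ (dec cM ▹ P₅)))))

  evalIdx : Bool → LoopFree
  evalIdx false = ifBit cV skip setB
  evalIdx true  = ifBit cV setB skip

  readHdr readCl readSgn : LoopFree
  readHdr = ifBit cA (inc cN) (mode 1)
  readCl  = ifBit cA (inc cL ▹ mode 1) (ifLt cL zero die (mode 2))
  readSgn = ifBit cA (mode 4) (mode 3)

  readIdx : Bool → LoopFree
  readIdx r = ifBit cA (inc cV ▹ mode (if r then 4 else 3)) (ifLt cV (suc cN) (evalIdx r ▹ closeLF) die)

  advanceLF : LoopFree
  advanceLF = inc cA ▹ inc cA

  readLF : LoopFree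
  readLF = switch readHdr readCl readSgn (readIdx false) (readIdx true) (mode 5) ▹ advanceLF

  code index left-over sat : Reader → ℕ
  code (hdr _)             = 0
  code (cl _ _)            = 1
  code (sgn _ _ _)         = 2
  code (idx false _ _ _ _) = 3
  code (idx true _ _ _ _)  = 4
  code dead                = 5
  index (idx _ _ _ _ i) = i
  index _               = 0
  left-over (cl _ m)        = m
  left-over (sgn _ l _)     = suc l
  left-over (idx _ _ l _ _) = suc l
  left-over _               = 0
  sat (sgn _ _ b)     = flag b
  sat (idx _ _ _ b _) = flag b
  sat _               = 0

  -- The number of variables and the variable index are stored with the offset s, the start of y in
  -- the input. Then bit i of y is the input bit at `cV`, and testing i < n is a comparison of two
  -- counters.
  readerIn : ℕ → (N a E s g : ℕ) → Reader → St
  readerIn m N a E s g A =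
    N ∷ a ∷ E ∷ s ∷ variables A + s ∷ index A + s ∷ left-over A ∷ sat A ∷ m ∷ g ∷ [] , []

  reader : (N a E s g : ℕ) → Reader → St
  reader N a E s g A = readerIn (code A) N a E s g A

  exec-ifBit : ∀ z i P Q s b → bitAt z (at s i) ≡ b → exec z (ifBit i P Q) s ≡ exec z (if b then P else Q) s
  exec-ifBit z i P Q (v , o) b     eq with bitAt z (lookup v i)
  exec-ifBit z i P Q (v , o) true  refl | _ = refl
  exec-ifBit z i P Q (v , o) false refl | _ = refl

  exec-ifLt : ∀ z i c P Q s b → below i c s ≡ b → exec z (ifLt i c P Q) s ≡ exec z (if b then P else Q) s
  exec-ifLt z i c P Q (v , o) b     eq with lookup v i <ᵇ value v c
  exec-ifLt z i c P Q (v , o) true  refl | _ = refl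
  exec-ifLt z i c P Q (v , o) false refl | _ = refl

  alternative : Reader → LoopFree
  alternative (hdr _)         = readHdr
  alternative (cl _ _)        = readCl
  alternative (sgn _ _ _)     = readSgn
  alternative (idx r _ _ _ _) = readIdx r
  alternative dead            = mode 5

  module _ (z : Str) (N a E s g : ℕ) where

    entered : Reader → St
    entered = readerIn 0 N a E s g

    exec-switch : ∀ A → exec z readLF (reader N a E s g A) ≡
      exec z advanceLF (exec z (alternative A) (entered A))
    exec-switch (hdr _)             = refl
    exec-switch (cl _ _)            = refl
    exec-switch (sgn _ _ _)         = refl
    exec-switch (idx false _ _ _ _) = refl
    exec-switch (idx true _ _ _ _)  = refl
    exec-switch dead                = refl

    -- Once r, b, w and the form of l are known, every test in the program is decided by
    -- computation, so the sixteen cases are immediate.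
    exec-close : ∀ r n l b i w →
      exec z advanceLF (exec z closeLF (exec z (if w then (if r then setB else skip) else (if r then skip else setB))
        (entered (idx r n l b i)))) ≡ reader N (2 + a) E s g (closeLiteral n l (b ∨ does (w ≟B r)))
    exec-close false n zero    true  i true  = refl
    exec-close false n zero    false i true  = refl
    exec-close false n (suc l) true  i true  = refl
    exec-close false n (suc l) false i true  = refl
    exec-close false n zero    true  i false = refl
    exec-close false n zero    false i false = refl
    exec-close false n (suc l) true  i false = refl
    exec-close false n (suc l) false i false = refl
    exec-close true  n zero    true  i true  = refl
    exec-close true  n zero    false i true  = refl
    exec-close true  n (suc l) true  i true  = refl
    exec-close true  n (suc l) false i true  = refl
    exec-close true  n zero    true  i false = refl
    exec-close true  n zero    false i false = refl
    exec-close true  n (suc l) true  i false = refl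
    exec-close true  n (suc l) false i false = refl

    exec-evalIdx : ∀ r n l b i w → bitAt z (i + s) ≡ w →
      exec z (evalIdx r) (entered (idx r n l b i)) ≡
      exec z (if w then (if r then setB else skip) else (if r then skip else setB)) (entered (idx r n l b i))
    exec-evalIdx false n l b i w eq = exec-ifBit z cV skip setB (entered (idx false n l b i)) w eq
    exec-evalIdx true  n l b i w eq = exec-ifBit z cV setB skip (entered (idx true n l b i)) w eq

    exec-idx : ∀ r n l b i w → bitAt z (i + s) ≡ w →
      exec z advanceLF (exec z (ifLt cV (suc cN) (evalIdx r ▹ closeLF) die) (entered (idx r n l b i))) ≡
      reader N (2 + a) E s g (if i <ᵇ n then closeLiteral n l (b ∨ does (w ≟B r)) else dead)
    exec-idx r n l b i w eq with i <ᵇ n in lt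
    ... | false = cong (exec z advanceLF)
            (exec-ifLt z cV (suc cN) (evalIdx r ▹ closeLF) die (entered (idx r n l b i)) false (trans (<ᵇ-+ʳ i n s) lt))
    ... | true  = trans (cong (exec z advanceLF)
            (exec-ifLt z cV (suc cN) (evalIdx r ▹ closeLF) die (entered (idx r n l b i)) true (trans (<ᵇ-+ʳ i n s) lt)))
            (trans (cong (exec z advanceLF ∘ exec z closeLF) (exec-evalIdx r n l b i w eq))
              (exec-close r n l b i w))

    exec-alternative : ∀ A b y → bitAt z a ≡ b → (∀ i → bitAt z (i + s) ≡ y i) →
      exec z advanceLF (exec z (alternative A) (entered A)) ≡ reader N (2 + a) E s g (readBit y A b)
    exec-alternative (hdr n) true y eq h =
      cong (exec z advanceLF) (exec-ifBit z cA (inc cN) (mode 1) (entered (hdr n)) true eq)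
    exec-alternative (hdr n) false y eq h =
      cong (exec z advanceLF) (exec-ifBit z cA (inc cN) (mode 1) (entered (hdr n)) false eq)
    exec-alternative (cl n m) true y eq h =
      cong (exec z advanceLF) (exec-ifBit z cA (inc cL ▹ mode 1) (ifLt cL zero die (mode 2)) (entered (cl n m)) true eq)
    exec-alternative (cl n zero) false y eq h =
      cong (exec z advanceLF) (exec-ifBit z cA (inc cL ▹ mode 1) (ifLt cL zero die (mode 2)) (entered (cl n zero)) false eq)
    exec-alternative (cl n (suc m)) false y eq h =
      cong (exec z advanceLF) (exec-ifBit z cA (inc cL ▹ mode 1) (ifLt cL zero die (mode 2)) (entered (cl n (suc m))) false eq)
    exec-alternative (sgn n l b) true y eq h =
      cong (exec z advanceLF) (exec-ifBit z cA (mode 4) (mode 3) (entered (sgn n l b)) true eq)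
    exec-alternative (sgn n l b) false y eq h =
      cong (exec z advanceLF) (exec-ifBit z cA (mode 4) (mode 3) (entered (sgn n l b)) false eq)
    exec-alternative (idx false n l b i) true y eq h =
      cong (exec z advanceLF) (exec-ifBit z cA (inc cV ▹ mode 3) (ifLt cV (suc cN) (evalIdx false ▹ closeLF) die) (entered (idx false n l b i)) true eq)
    exec-alternative (idx true n l b i) true y eq h =
      cong (exec z advanceLF) (exec-ifBit z cA (inc cV ▹ mode 4) (ifLt cV (suc cN) (evalIdx true ▹ closeLF) die) (entered (idx true n l b i)) true eq)
    exec-alternative (idx r n l b i) false y eq h =
      trans (cong (exec z advanceLF) (exec-ifBit z cA (inc cV ▹ mode (if r then 4 else 3))
              (ifLt cV (suc cN) (evalIdx r ▹ closeLF) die) (entered (idx r n l b i)) false eq))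
        (exec-idx r n l b i (y i) (h i))
    exec-alternative dead b y eq h = refl

    exec-readLF : ∀ A b y → bitAt z a ≡ b → (∀ i → bitAt z (i + s) ≡ y i) →
      exec z readLF (reader N a E s g A) ≡ reader N (2 + a) E s g (readBit y A b)
    exec-readLF A b y eq h = trans (exec-switch A) (exec-alternative A b y eq h)

  -- The two copies of a bit of x agree, while the separator is false followed by true. So a pair
  -- starting with true is a bit, and only after false must the second cell be inspected. On the
  -- separator the position steps back to its beginning and the flag is raised.
  sepLF : LoopFree
  sepLF = ifBit cE (inc cE ▹ inc cE) (inc cE ▹ ifBit cE (inc cG ▹ dec cE) (inc cE))

  readyLF : LoopFree
  readyLF = copy cS (suc cE) ▹ inc cS ▹ inc cS ▹ copy cN (suc cS) ▹ copy cV (suc cS) ▹ reset cG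

  tailLF : LoopFree
  tailLF = ifBit cN (reset cG ▹ inc cG) skip ▹ inc cN

  finalLF : LoopFree
  finalLF = ifLt cM zero (emit false) (dec cM ▹
    ifLt cM zero (ifLt cL zero (ifLt cG zero (emit true) (emit false)) (emit false)) (emit false))

  verifier : Prog
  verifier = whileLt cG zero ⟦ sepLF ⟧ ⨾ ⟦ readyLF ⟧ ⨾ whileLt cA (suc cE) ⟦ readLF ⟧ ⨾
             whileLt cN (suc zero) ⟦ tailLF ⟧ ⨾ ⟦ finalLF ⟧

  verifierCost : ℕ → ℕ
  verifierCost N = (1 + N * suc (cost sepLF)) + (cost readyLF + ((1 + N * suc (cost readLF)) +
                   ((1 + N * suc (cost tailLF)) + cost finalLF)))

  module _ (x y : Str) where

    private
      z : Str
      z = pair x y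
      N : ℕ
      N = length z
      E : ℕ
      E = double (length x)
      s : ℕ
      s = 2 + E

      N≡ : N ≡ length y + s
      N≡ = length-pair x y

      separate : ℕ → ℕ → St
      separate E g = N ∷ 0 ∷ E ∷ 0 ∷ 0 ∷ 0 ∷ 0 ∷ 0 ∷ 0 ∷ g ∷ [] , []

      exec-sep : ∀ m → m < length x → exec z sepLF (separate (double m) 0) ≡ separate (double (suc m)) 0
      exec-sep m lt with bitAt x m | pair-bit₀ x y m lt | pair-bit₁ x y m lt
      ... | true  | p | q rewrite p     = refl
      ... | false | p | q rewrite p | q = refl

      exec-sep-end : exec z sepLF (separate E 0) ≡ separate E 1
      exec-sep-end rewrite pair-sep₀ x y | pair-sep₁ x y = refl

      tri-sep : Tri z (1 + N * suc (cost sepLF)) (start z) (whileLt cG zero ⟦ sepLF ⟧) (separate E 1)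
      tri-sep = tri-weaken (+-monoʳ-≤ 1 (*-monoˡ-≤ (suc (cost sepLF)) le))
        (subst (λ s' → Tri z (1 + suc (length x) * suc (cost sepLF)) s' (whileLt cG zero ⟦ sepLF ⟧) (separate E 1)) first
          (subst (Tri z (1 + suc (length x) * suc (cost sepLF)) (family 0) (whileLt cG zero ⟦ sepLF ⟧)) last
          (tri-while cG zero {⟦ sepLF ⟧} family (suc (length x)) body end)))
        where
          le : suc (length x) ≤ N
          le = ≤-trans (s≤s (≤-trans (n≤double (length x)) (n≤1+n E))) (≤-trans (m≤n+m s (length y)) (≤-reflexive (sym N≡)))
          -- Minimum and truncated difference put all rounds into one formula: during x the position
          -- grows and the flag is 0; in the additional round the position stays and the flag
          -- becomes 1.
          family : ℕ → St
          family m = separate (double (m ⊓ length x)) (m ∸ length x)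
          first : family 0 ≡ start z
          first rewrite 0∸n≡0 (length x) = refl
          last : family (suc (length x)) ≡ separate E 1
          last rewrite m≥n⇒m⊓n≡n (n≤1+n (length x)) | m+n∸n≡m 1 (length x) = refl
          end : below cG zero (family (suc (length x))) ≡ false
          end = cong (below cG zero) last
          body : ∀ m → m < suc (length x) → below cG zero (family m) ≡ true ×
                 Tri z (cost sepLF) (family m) ⟦ sepLF ⟧ (family (suc m))
          body m (s≤s m≤) with m ≟ length x
          ... | yes refl = cong (_<ᵇ 1) (m≤n⇒m∸n≡0 m≤) ,
                tri-exec sepLF (trans (cong (exec z sepLF) now) (trans exec-sep-end (sym last)))
            where
              now : family m ≡ separate E 0
              now rewrite m≤n⇒m⊓n≡m m≤ | n∸n≡0 m = refl
          ... | no ne = cong (_<ᵇ 1) (m≤n⇒m∸n≡0 m≤) ,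
                tri-exec sepLF (trans (cong (exec z sepLF) now) (trans (exec-sep m lt) (sym then)))
            where
              lt = ≤∧≢⇒< m≤ ne
              now : family m ≡ separate (double m) 0
              now rewrite m≤n⇒m⊓n≡m m≤ | m≤n⇒m∸n≡0 m≤ = refl
              then : family (suc m) ≡ separate (double (suc m)) 0
              then rewrite m≤n⇒m⊓n≡m lt | m≤n⇒m∸n≡0 lt = refl

      -- The reader after m bits, with the recursion at the latest bit as a loop needs it; `readAll`
      -- consumes the string from the front instead.
      prefix : Reader → Str → ℕ → Reader
      prefix A xs zero    = A
      prefix A xs (suc m) = readBit (bitAt y) (prefix A xs m) (bitAt xs m)

      prefix-∷ : ∀ A b xs m → prefix A (b ∷ xs) (suc m) ≡ prefix (readBit (bitAt y) A b) xs m
      prefix-∷ A b xs zero    = refl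
      prefix-∷ A b xs (suc m) = cong (λ B → readBit (bitAt y) B (bitAt xs m)) (prefix-∷ A b xs m)

      prefix-all : ∀ A xs → prefix A xs (length xs) ≡ readAll (bitAt y) A xs
      prefix-all A []       = refl
      prefix-all A (b ∷ xs) = trans (prefix-∷ A b xs (length xs)) (prefix-all (readBit (bitAt y) A b) xs)

      R : Reader
      R = readAll (bitAt y) (hdr 0) x

      ready : exec z readyLF (separate E 1) ≡ reader N 0 E s 0 (hdr 0)
      ready = refl

      tri-read : Tri z (1 + N * suc (cost readLF)) (reader N 0 E s 0 (hdr 0)) (whileLt cA (suc cE) ⟦ readLF ⟧)
                   (reader N E E s 0 R)
      tri-read = tri-weaken (+-monoʳ-≤ 1 (*-monoˡ-≤ (suc (cost readLF)) le))
        (subst (λ A → Tri z (1 + length x * suc (cost readLF)) (reader N 0 E s 0 (hdr 0)) (whileLt cA (suc cE) ⟦ readLF ⟧) (reader N E E s 0 A)) (prefix-all (hdr 0) x)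
          (tri-while cA (suc cE) {⟦ readLF ⟧} (λ m → reader N (double m) E s 0 (prefix (hdr 0) x m)) (length x)
            (λ m lt → <ᵇ-true (≤-trans (n≤1+n _) (double-mono-≤ lt)) ,
              tri-exec readLF (exec-readLF z N (double m) E s 0 (prefix (hdr 0) x m) (bitAt x m) (bitAt y)
                (pair-bit₀ x y m lt) (pair-rest x y)))
            (<ᵇ-false {E} ≤-refl)))
        where
          le : length x ≤ N
          le = ≤-trans (≤-trans (n≤double (length x)) (m≤n+m E 2)) (≤-trans (m≤n+m s (length y)) (≤-reflexive (sym N≡)))

      n = variables R

      tailing : ℕ → Bool → St
      tailing m g = N ∷ E ∷ E ∷ s ∷ m + (n + s) ∷ index R + s ∷ left-over R ∷ sat R ∷ code R ∷ flag g ∷ [] , []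

      exec-tail : ∀ m g → exec z tailLF (tailing m g) ≡ tailing (suc m) (g ∨ bitAt y (m + n))
      exec-tail m g rewrite sym (pair-rest x y (m + n)) | +-assoc m n s with bitAt z (m + (n + s)) | g
      ... | true  | true  = refl
      ... | true  | false = refl
      ... | false | true  = refl
      ... | false | false = refl

      tri-tail : Tri z (1 + N * suc (cost tailLF)) (reader N E E s 0 R) (whileLt cN (suc zero) ⟦ tailLF ⟧)
                   (tailing (length y ∸ n) (any id (drop n y)))
      tri-tail = tri-weaken (+-monoʳ-≤ 1 (*-monoˡ-≤ (suc (cost tailLF)) le))
        (subst (λ g → Tri z (1 + (length y ∸ n) * suc (cost tailLF)) (reader N E E s 0 R) (whileLt cN (suc zero) ⟦ tailLF ⟧) (tailing (length y ∸ n) g)) (anyBelow-drop y n)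
          (tri-while cN (suc zero) {⟦ tailLF ⟧} (λ m → tailing m (anyBelow (λ j → bitAt y (j + n)) m)) (length y ∸ n)
            (λ m lt → <ᵇ-true (lt' m lt) , tri-exec tailLF (exec-tail m _))
            (<ᵇ-false end)))
        where
          le : length y ∸ n ≤ N
          le = ≤-trans (m∸n≤m (length y) n) (≤-trans (m≤m+n (length y) s) (≤-reflexive (sym N≡)))
          lt' : ∀ m → m < length y ∸ n → m + (n + s) < N
          lt' m lt = subst (m + (n + s) <_) (sym N≡) (subst (_< length y + s) (+-assoc m n s)
            (+-monoˡ-< s (subst (m + n <_) (m∸n+n≡m n≤) (+-monoˡ-< n lt))))
            where
              n≤ : n ≤ length y
              n≤ = <⇒≤ (m∸n≢0⇒n<m (λ eq → n≮0 (subst (m <_) eq lt)))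
          end : N ≤ (length y ∸ n) + (n + s)
          end = ≤-trans (≤-reflexive N≡) (≤-trans (+-monoˡ-≤ s (m≤n+m∸n (length y) n))
            (≤-reflexive (trans (cong (_+ s) (+-comm n (length y ∸ n))) (+-assoc (length y ∸ n) n s))))

      exec-final : ∀ m g A v → proj₂ (exec z finalLF
        (N ∷ E ∷ E ∷ s ∷ m ∷ v ∷ left-over A ∷ sat A ∷ code A ∷ flag g ∷ [] , [])) ≡ accepts A ∧ not g ∷ []
      exec-final m g     (hdr _)             v = refl
      exec-final m true  (cl _ zero)         v = refl
      exec-final m false (cl _ zero)         v = refl
      exec-final m g     (cl _ (suc _))      v = refl
      exec-final m g     (sgn _ _ _)         v = refl
      exec-final m g     (idx false _ _ _ _) v = refl
      exec-final m g     (idx true _ _ _ _)  v = refl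
      exec-final m g     dead                v = refl

    tri-verifier : Σ (Vec ℕ 10) λ v → Tri z (verifierCost (length z)) (start z) verifier (v , verify x y ∷ [])
    tri-verifier = proj₁ last , tri-seq tri-sep (tri-seq (tri-exec readyLF ready) (tri-seq tri-read (tri-seq tri-tail
      (tri-exec finalLF (cong (proj₁ last ,_) (exec-final (length y ∸ n + (n + s)) (any id (drop n y)) R (index R + s)))))))
      where
        last : St
        last = exec z finalLF (tailing (length y ∸ n) (any id (drop n y)))

  pb-verifierCost : PolyBounded verifierCost
  pb-verifierCost = pb-+ (linear (suc (cost sepLF))) (pb-+ (pb-const (cost readyLF)) (pb-+ (linear (suc (cost readLF)))
      (pb-+ (linear (suc (cost tailLF))) (pb-const (cost finalLF)))))
    where
      linear : ∀ c → PolyBounded (λ n → 1 + n * c)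
      linear c = pb-+ (pb-const 1) (pb-* pb-id (pb-const c))

  verify-polyTime : PolyTimePredicate verify
  verify-polyTime = machine (complete verifier) , proj₁ bound , λ x y →
    complete-computes (proj₂ (tri-verifier x y)) (s≤s z≤n) (proj₂ bound (length (pair x y)))
    where
      bound : PolyBounded (λ n → total (verifierCost n) n)
      bound = pb-total pb-verifierCost

mersenneSAT∈MNS : MNS MersenneNumberSAT
-- The coefficients 0 and 1 denote the polynomial n: witnesses have the length of x, which is large
-- enough because the unary header alone is longer than the number of variables.
mersenneSAT∈MNS = (0 ∷ 1 ∷ []) , verify , verify-polyTime , λ x →
  subst (λ n → MersenneNumberSAT x ⇔ IsMersenne (countWitnesses (verify x) n))
    (sym (trans (*-comm (length x) (1 + length x * 0)) (trans (cong (λ n → length x + n * length x) (*-zeroʳ (length x))) (+-identityʳ (length x)))))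
    (mersenneSAT-verify x)
  -- The alphabet becomes concrete only here, with one symbol for each setting of the 5 + 9 tracks;
  -- inside the module its size is a variable.
  where open Verifier (2 ^ 14) fromBits (toBits 14) toBits-fromBits

-- Counting and clause templates

-- The partner of the head is removed from `ys`. By injectivity no later element has the same
-- partner, so the induction continues with the remaining list.
length-injection : ∀ {A B : Set} (Rel : A → B → Set) {xs : List A} {ys : List B} → Unique xs →
  (∀ {x} → x ∈ xs → Σ B λ y → y ∈ ys × Rel x y) →
  (∀ {x x' y} → x ∈ xs → x' ∈ xs → Rel x y → Rel x' y → x ≡ x') → length xs ≤ length ys
length-injection Rel {[]} _ _ _ = z≤n
length-injection {A} {B} Rel {x ∷ xs} (x∉ ∷ u) f inj with f (here refl)
... | y , y∈ , r with ∈-∃++ y∈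
... | as , bs , refl = ≤-trans (s≤s (length-injection Rel {xs} {as ++ bs} u f' (λ p q → inj (there p) (there q)))) (≤-reflexive len)
  where
    f' : ∀ {x'} → x' ∈ xs → Σ B λ y' → y' ∈ as ++ bs × Rel x' y'
    f' x'∈ with f (there x'∈)
    ... | y' , y'∈ , r' with ∈-++⁻ as y'∈
    ... | inj₁ p            = y' , ∈-++⁺ˡ p , r'
    ... | inj₂ (there p)    = y' , ∈-++⁺ʳ as p , r'
    ... | inj₂ (here refl)  = ⊥-elim (All.lookup x∉ x'∈ (inj (here refl) (there x'∈) r r'))
    len : suc (length (as ++ bs)) ≡ length (as ++ y ∷ bs)
    len = trans (cong suc (length-++ as)) (trans (sym (+-suc (length as) (length bs))) (sym (length-++ as)))

-- A relation fits better than a function: a satisfying assignment yields its string only through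
-- the soundness proof. Injectivity towards B is restricted to members of `ys`, since there the
-- strings are known to have the right length.
count-bijection : ∀ {A B : Set} (Rel : A → B → Set) {xs : List A} {ys : List B} (P : A → Bool) (Q : B → Bool) →
  Unique xs → Unique ys →
  (∀ {x} → x ∈ xs → P x ≡ true → Σ B λ y → y ∈ ys × Q y ≡ true × Rel x y) →
  (∀ {y} → y ∈ ys → Q y ≡ true → Σ A λ x → x ∈ xs × P x ≡ true × Rel x y) →
  (∀ {x x' y} → Rel x y → Rel x' y → x ≡ x') →
  (∀ {x y y'} → y ∈ ys → y' ∈ ys → Rel x y → Rel x y' → y ≡ y') → count P xs ≡ count Q ys
count-bijection Rel P Q ux uy f g injˡ injʳ = ≤-antisym
  (length-injection Rel (Uniq.filter⁺ P? ux)
    (λ x∈ → case ∈-filter⁻ P? x∈ of λ { (m , p) → case f m p of λ { (y , y∈ , q , r) → y , ∈-filter⁺ Q? y∈ q , r } })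
    (λ _ _ → injˡ))
  (length-injection (λ y x → Rel x y) (Uniq.filter⁺ Q? uy)
    (λ y∈ → case ∈-filter⁻ Q? y∈ of λ { (m , q) → case g m q of λ { (x , x∈ , p , r) → x , ∈-filter⁺ P? x∈ p , r } })
    (λ y∈ y'∈ → injʳ (proj₁ (∈-filter⁻ Q? y∈)) (proj₁ (∈-filter⁻ Q? y'∈))))
  where
    P? = λ a → P a ≟B true
    Q? = λ a → Q a ≟B true

∈-allAssignments : ∀ {n} (v : Vec Bool n) → v ∈ allAssignments n
∈-allAssignments []          = here refl
∈-allAssignments (false ∷ v) = ∈-++⁺ˡ (∈-map⁺ (false ∷_) (∈-allAssignments v))
∈-allAssignments (true ∷ v)  = ∈-++⁺ʳ _ (∈-map⁺ (true ∷_) (∈-allAssignments v))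

∈-allStrings : ∀ y → y ∈ allStrings (length y)
∈-allStrings []          = here refl
∈-allStrings (false ∷ y) = ∈-++⁺ˡ (∈-map⁺ (false ∷_) (∈-allStrings y))
∈-allStrings (true ∷ y)  = ∈-++⁺ʳ _ (∈-map⁺ (true ∷_) (∈-allStrings y))

∈-allStrings⁻ : ∀ n {y} → y ∈ allStrings n → length y ≡ n
∈-allStrings⁻ zero    (here refl) = refl
∈-allStrings⁻ (suc n) y∈ with ∈-++⁻ (map (false ∷_) (allStrings n)) y∈
... | inj₁ p = case ∈-map⁻ (false ∷_) p of λ { (_ , q , refl) → cong suc (∈-allStrings⁻ n q) }
... | inj₂ p = case ∈-map⁻ (true ∷_) p of λ { (_ , q , refl) → cong suc (∈-allStrings⁻ n q) }

unique-allAssignments : ∀ n → Unique (allAssignments n)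
unique-allAssignments zero    = All.[] ∷ []
unique-allAssignments (suc n) = Uniq.++⁺ (Uniq.map⁺ (λ { refl → refl }) (unique-allAssignments n))
  (Uniq.map⁺ (λ { refl → refl }) (unique-allAssignments n))
  (λ { (p , q) → case ∈-map⁻ (false ∷_) p of λ { (_ , _ , refl) → case ∈-map⁻ (true ∷_) q of λ { (_ , _ , ()) } } })

unique-allStrings : ∀ n → Unique (allStrings n)
unique-allStrings zero    = All.[] ∷ []
unique-allStrings (suc n) = Uniq.++⁺ (Uniq.map⁺ (λ { refl → refl }) (unique-allStrings n))
  (Uniq.map⁺ (λ { refl → refl }) (unique-allStrings n))
  (λ { (p , q) → case ∈-map⁻ (false ∷_) p of λ { (_ , _ , refl) → case ∈-map⁻ (true ∷_) q of λ { (_ , _ , ()) } } })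

all-∈ : ∀ {A : Set} (p : A → Bool) {xs x} → all p xs ≡ true → x ∈ xs → p x ≡ true
all-∈ p {y ∷ ys} eq m with p y in py
all-∈ p {y ∷ ys} eq (here refl) | true = py
all-∈ p {y ∷ ys} eq (there m)   | true = all-∈ p eq m

∈-all : ∀ {A : Set} (p : A → Bool) xs → (∀ {x} → x ∈ xs → p x ≡ true) → all p xs ≡ true
∈-all p []       h = refl
∈-all p (y ∷ ys) h rewrite h (here refl) = ∈-all p ys (h ∘ there)

all-++ : ∀ {A : Set} (p : A → Bool) xs ys → all p (xs ++ ys) ≡ all p xs ∧ all p ys
all-++ p []       ys = refl
all-++ p (x ∷ xs) ys with p x
... | true  = all-++ p xs ys
... | false = refl

-- Formulas whose variables are plain numbers

RawClause RawCNF : Set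
RawClause = List (ℕ × Bool)
RawCNF    = List RawClause

rawLit : (ℕ → Bool) → ℕ × Bool → Bool
rawLit α (i , b) = does (α i ≟B b)

rawSat : (ℕ → Bool) → RawCNF → Bool
rawSat α = all (any (rawLit α))

encRawLit : ℕ × Bool → Str
encRawLit (i , b) = b ∷ encNat i

encRawClause : RawClause → Str
encRawClause c = encNat (length c) ++ concatMap encRawLit c

-- Reduction modulo n makes the conversion total without bounds stored in the formula. For indices
-- below n it changes nothing, so the code is preserved as well.
toClause : ∀ n → .{{NonZero n}} → RawClause → Clause n
toClause n = map (λ { (i , b) → i mod n , b })

toCNF : ∀ n → .{{NonZero n}} → RawCNF → CNF n
toCNF n = map (toClause n)

cnfSat-toCNF : ∀ n .{{_ : NonZero n}} a φ → cnfSat a (toCNF n φ) ≡ rawSat (λ i → lookup a (i mod n)) φ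
cnfSat-toCNF n a []      = refl
cnfSat-toCNF n a (c ∷ φ) = cong₂ _∧_ (clause c) (cnfSat-toCNF n a φ)
  where
    clause : ∀ c → any (litSat a) (toClause n c) ≡ any (rawLit (λ i → lookup a (i mod n))) c
    clause []            = refl
    clause ((i , b) ∷ c) = cong (does (lookup a (i mod n) ≟B b) ∨_) (clause c)

Below : ℕ → RawCNF → Set
Below n φ = ∀ {c} → c ∈ φ → ∀ {l} → l ∈ c → proj₁ l < n

toℕ-mod : ∀ {i n} .{{_ : NonZero n}} → i < n → toℕ (i mod n) ≡ i
toℕ-mod {i} {n} lt = trans (toℕ-fromℕ< (m%n<n i n)) (m<n⇒m%n≡m lt)

encCNF-toCNF : ∀ n .{{_ : NonZero n}} φ → Below n φ → encCNF (toCNF n φ) ≡ encNat n ++ concatMap encRawClause φ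
encCNF-toCNF n φ below = cong (encNat n ++_) (clauses φ below)
  where
    lits : ∀ c → (∀ {l} → l ∈ c → proj₁ l < n) →
           concatMap encLit (toClause n c) ≡ concatMap encRawLit c
    lits []            h = refl
    lits ((i , b) ∷ c) h = cong₂ (λ j w → b ∷ encNat j ++ w) (toℕ-mod (h (here refl))) (lits c (h ∘ there))
    clauses : ∀ φ → Below n φ → concatMap encClause (toCNF n φ) ≡ concatMap encRawClause φ
    clauses []      h = refl
    clauses (c ∷ φ) h = cong₂ _++_ (cong₂ (λ k w → encNat k ++ w) (length-map _ c) (lits c (h (here refl))))
                          (clauses φ (h ∘ there))

-- A slot (far , o) names the variable at distance o from the beginning of the current cell,
-- or, if far, from the beginning of the cell L positions later. Cells consist of K variables.
Slot : Set
Slot = Bool × ℕ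

Block : Set
Block = List (List (Slot × Bool))

-- A clause that fails for exactly one setting of the slots, namely `β`. Conjoining it over all
-- rejected settings gives the canonical conjunctive normal form; it may be exponential in the
-- number of slots, but in the templates of the reduction that number depends on the machine only.
differ : ∀ {m} → Vec Slot m → Vec Bool m → List (Slot × Bool)
differ []       []      = []
differ (s ∷ ss) (b ∷ β) = (s , not b) ∷ differ ss β

-- G holds of the values of the slots that stay allowed.
forbid : ∀ {m} → Vec Slot m → (Vec Bool m → Bool) → Block
forbid {m} ss G = map (differ ss) (filter (λ β → not (G β) ≟B true) (allAssignments m))

near : ∀ K → ℕ → Vec Slot K
near K d = tabulate (λ k → false , toℕ k + d * K)

far : ∀ K → Vec Slot K
far K = tabulate (λ k → true , toℕ k)

module Blocks (K L : ℕ) where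

  lag : Bool → ℕ
  lag far = if far then L * K else 0

  -- The bracketing follows the order of writing: first the ones for the current cell, then those
  -- for the lag, finally those for the offset.
  index : ℕ → Slot → ℕ
  index c (far , o) = c * K + (lag far + o)

  place : ℕ → Slot × Bool → ℕ × Bool
  place c (s , b) = index c s , b

  instantiate : ℕ → Block → RawCNF
  instantiate c = map (map (place c))

  sequence : ℕ → List Block → RawCNF
  sequence c []       = []
  sequence c (B ∷ Bs) = instantiate c B ++ sequence (suc c) Bs

  sequence-++ : ∀ c As Bs → sequence c (As ++ Bs) ≡ sequence c As ++ sequence (length As + c) Bs
  sequence-++ c []       Bs = refl
  sequence-++ c (A ∷ As) Bs = trans (cong (instantiate c A ++_)
      (trans (sequence-++ (suc c) As Bs) (cong (λ d → sequence (suc c) As ++ sequence d Bs) (+-suc (length As) c))))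
    (sym (++-assoc (instantiate c A) _ _))

  module _ (α : ℕ → Bool) where

    SatFrom : ℕ → List Block → Set
    SatFrom c []       = ⊤
    SatFrom c (B ∷ Bs) = rawSat α (instantiate c B) ≡ true × SatFrom (suc c) Bs

    sequence-SatFrom : ∀ c Bs → rawSat α (sequence c Bs) ≡ true → SatFrom c Bs
    sequence-SatFrom c []       eq = tt
    sequence-SatFrom c (B ∷ Bs) eq with rawSat α (instantiate c B) in e | trans (sym eq) (all-++ (any (rawLit α)) (instantiate c B) (sequence (suc c) Bs))
    ... | true | eq' = refl , sequence-SatFrom (suc c) Bs (sym eq')

    SatFrom-sequence : ∀ c Bs → SatFrom c Bs → rawSat α (sequence c Bs) ≡ true
    SatFrom-sequence c []       _       = refl
    SatFrom-sequence c (B ∷ Bs) (h , t) = trans (all-++ (any (rawLit α)) (instantiate c B) (sequence (suc c) Bs))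
      (cong₂ _∧_ h (SatFrom-sequence (suc c) Bs t))

    SatFrom-replicate : ∀ n c B → SatFrom c (replicate n B) → ∀ i → i < n → rawSat α (instantiate (i + c) B) ≡ true
    SatFrom-replicate (suc n) c B (h , t) zero    _        = h
    SatFrom-replicate (suc n) c B (h , t) (suc i) (s≤s lt) =
      subst (λ d → rawSat α (instantiate d B) ≡ true) (+-suc i c) (SatFrom-replicate n (suc c) B t i lt)

    replicate-SatFrom : ∀ n c B → (∀ i → i < n → rawSat α (instantiate (i + c) B) ≡ true) → SatFrom c (replicate n B)
    replicate-SatFrom zero    c B h = tt
    replicate-SatFrom (suc n) c B h = h 0 (s≤s z≤n) , replicate-SatFrom n (suc c) B
      (λ i lt → subst (λ d → rawSat α (instantiate d B) ≡ true) (sym (+-suc i c)) (h (suc i) (s≤s lt)))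

  module _ (α : ℕ → Bool) (c : ℕ) where

    private
      read : ∀ {m} → Vec Slot m → Vec Bool m
      read = V.map (α ∘ index c)

      clause : List (Slot × Bool) → Bool
      clause d = any (rawLit α) (map (place c) d)

      differ-same : ∀ {m} (ss : Vec Slot m) → clause (differ ss (read ss)) ≡ false
      differ-same []       = refl
      differ-same (s ∷ ss) with α (index c s)
      ... | true  = differ-same ss
      ... | false = differ-same ss

      differ-other : ∀ {m} (ss : Vec Slot m) β → β ≢ read ss → clause (differ ss β) ≡ true
      differ-other []       []      ne = ⊥-elim (ne refl)
      differ-other (s ∷ ss) (b ∷ β) ne with α (index c s) | b
      ... | true  | true  = differ-other ss β (λ e → ne (cong (true ∷_) e))
      ... | false | false = differ-other ss β (λ e → ne (cong (false ∷_) e))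
      ... | true  | false = refl
      ... | false | true  = refl

    forbid-sound : ∀ {m} (ss : Vec Slot m) G → rawSat α (instantiate c (forbid ss G)) ≡ true →
                   G (V.map (α ∘ index c) ss) ≡ true
    forbid-sound ss G eq with G (read ss) in g
    ... | true  = refl
    ... | false = case trans (sym (differ-same ss))
                    (all-∈ (any (rawLit α)) eq (∈-map⁺ _ (∈-map⁺ (differ ss)
                      (∈-filter⁺ (λ β → not (G β) ≟B true) (∈-allAssignments (read ss)) (cong not g))))) of λ ()

    forbid-complete : ∀ {m} (ss : Vec Slot m) G → G (V.map (α ∘ index c) ss) ≡ true →
                      rawSat α (instantiate c (forbid ss G)) ≡ true
    forbid-complete ss G g = ∈-all (any (rawLit α)) (instantiate c (forbid ss G)) λ x∈ → case ∈-map⁻ (map (place c)) x∈ of λ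
      { (d , d∈ , refl) → case ∈-map⁻ (differ ss) d∈ of λ
        { (β , β∈ , refl) → differ-other ss β λ e → case
            trans (sym (proj₂ (∈-filter⁻ (λ β → not (G β) ≟B true) {xs = allAssignments _} β∈))) (trans (cong (not ∘ G) e) (cong not g)) of λ () } }

  cell : (ℕ → Bool) → ℕ → Vec Bool K
  cell α c = tabulate (λ k → α (toℕ k + c * K))

  read-near : ∀ α c d → V.map (α ∘ index c) (near K d) ≡ cell α (d + c)
  read-near α c d = trans (sym (VP.tabulate-∘ (α ∘ index c) (λ k → false , toℕ k + d * K)))
    (VP.tabulate-cong (λ k → cong α (solve 4 (λ c K k d → c :* K :+ (k :+ d :* K) := k :+ (d :+ c) :* K) refl c K (toℕ k) d)))
    where open +-*-Solver

  read-far : ∀ α c → V.map (α ∘ index c) (far K) ≡ cell α (L + c)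
  read-far α c = trans (sym (VP.tabulate-∘ (α ∘ index c) (λ k → true , toℕ k)))
    (VP.tabulate-cong (λ k → cong α (solve 4 (λ c K k L → c :* K :+ (L :* K :+ k) := k :+ (L :+ c) :* K) refl c K (toℕ k) L)))
    where open +-*-Solver

∈-replicate : ∀ {A : Set} m {a b : A} → b ∈ replicate m a → b ≡ a
∈-replicate (suc m) (here eq) = eq
∈-replicate (suc m) (there p) = ∈-replicate m p

cut : ∀ {A : Set} m {n} → Vec A (m + n) → Vec A m × Vec A n
cut zero    v       = [] , v
cut (suc m) (x ∷ v) = x ∷ proj₁ (cut m v) , proj₂ (cut m v)

cut-++ : ∀ {A : Set} {m n} (u : Vec A m) (v : Vec A n) → cut m (u V.++ v) ≡ (u , v)
cut-++ []      v = refl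
cut-++ (x ∷ u) v rewrite cut-++ u v = refl

-- Tableaux

-- Decoding must be total. The argument d shows that `Fin n` is inhabited; only the values on
-- one-hot vectors matter.
findTrue : ∀ {n} → Fin n → Vec Bool n → Fin n
findTrue {suc n}       d       (true ∷ v)  = zero
findTrue {suc zero}    d       (false ∷ v) = d
findTrue {suc (suc n)} zero    (false ∷ v) = suc (findTrue zero v)
findTrue {suc (suc n)} (suc d) (false ∷ v) = suc (findTrue d v)

oneHot : ∀ {n} → Fin n → Vec Bool n
oneHot {suc n} zero    = true ∷ V.replicate n false
oneHot {suc n} (suc i) = false ∷ oneHot i

findTrue-oneHot : ∀ {n} (d i : Fin n) → findTrue d (oneHot i) ≡ i
findTrue-oneHot {suc n}       d       zero    = refl
findTrue-oneHot {suc (suc n)} zero    (suc i) = cong suc (findTrue-oneHot zero i)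
findTrue-oneHot {suc (suc n)} (suc d) (suc i) = cong suc (findTrue-oneHot d i)

module Tableau (M : TM) where
  open TM M

  data Cell : Set where
    wall₀ wall : Cell
    sym₁       : Sym M → Cell
    head       : Fin nStates → Sym M → Cell

  K : ℕ
  K = 3 + ((3 + nExtra) + nStates)

  encCell : Cell → Vec Bool K
  encCell wall₀      = true ∷ false ∷ false ∷ (V.replicate (3 + nExtra) false V.++ V.replicate nStates false)
  encCell wall       = false ∷ true ∷ false ∷ (V.replicate (3 + nExtra) false V.++ V.replicate nStates false)
  encCell (sym₁ s)   = false ∷ false ∷ false ∷ (oneHot s V.++ V.replicate nStates false)
  encCell (head q s) = false ∷ false ∷ true ∷ (oneHot s V.++ oneHot q)

  decCell : Vec Bool K → Cell
  decCell (true ∷ _ ∷ _ ∷ v)          = wall₀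
  decCell (false ∷ true ∷ _ ∷ v)      = wall
  decCell (false ∷ false ∷ false ∷ v) = sym₁ (findTrue zero (proj₁ (cut (3 + nExtra) v)))
  decCell (false ∷ false ∷ true ∷ v)  =
    head (findTrue start (proj₂ (cut (3 + nExtra) v))) (findTrue zero (proj₁ (cut (3 + nExtra) v)))

  decCell-encCell : ∀ c → decCell (encCell c) ≡ c
  decCell-encCell wall₀      = refl
  decCell-encCell wall       = refl
  decCell-encCell (sym₁ s)   = cong sym₁ (trans (cong (findTrue zero ∘ proj₁) (cut-++ (oneHot s) (V.replicate nStates false))) (findTrue-oneHot zero s))
  decCell-encCell (head q s) = cong₂ head
    (trans (cong (findTrue start ∘ proj₂) (cut-++ (oneHot s) (oneHot q))) (findTrue-oneHot start q))
    (trans (cong (findTrue zero ∘ proj₁) (cut-++ (oneHot s) (oneHot q))) (findTrue-oneHot zero s))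

  Action : Set
  Action = Maybe (Fin nStates × Sym M × Move)

  leavesRight leavesLeft : Action → Maybe (Fin nStates)
  leavesRight (just (q , _ , right)) = just q
  leavesRight _                      = nothing
  leavesLeft (just (q , _ , left))   = just q
  leavesLeft _                       = nothing

  -- The state in which the head enters from the left or right neighbour. The head of the
  -- initial configuration emerges from wall₀.
  fromLeft fromRight : Cell → Maybe (Fin nStates)
  fromLeft wall₀       = just start
  fromLeft (head q s)  = leavesRight (δ q s)
  fromLeft _           = nothing
  fromRight (head q s) = leavesLeft (δ q s)
  fromRight _          = nothing

  enter : Maybe (Fin nStates) → Maybe (Fin nStates) → Sym M → Cell
  enter (just q) _        s = head q s
  enter nothing  (just q) s = head q s
  enter nothing  nothing  s = sym₁ s

  act : Cell → Fin nStates → Sym M → Action → Cell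
  act a    q s nothing                  = head q s
  act a    q s (just (q' , s' , stay))  = head q' s'
  act a    q s (just (q' , s' , right)) = sym₁ s'
  -- At the left end the machine writes and changes its state, but its head stays where it is.
  act wall q s (just (q' , s' , left))  = head q' s'
  act a    q s (just (q' , s' , left))  = sym₁ s'

  successor : Cell → Cell → Cell → Cell
  successor a wall₀      b = wall
  successor a wall       b = wall
  successor a (sym₁ s)   b = enter (fromLeft a) (fromRight b) s
  successor a (head q s) b = act a q s (δ q s)

  -- Acceptance is visible in one cell: the output is read from the head rightwards and consists of
  -- a single bit, so it is true exactly if the halted head scans the symbol 2.
  rejects : Action → Sym M → Bool
  rejects nothing  (suc (suc zero)) = false
  rejects nothing  _                = true
  rejects (just _) _                = false

  bad : Cell → Bool
  bad (head q s) = rejects (δ q s) s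
  bad _          = false

  next : (ℕ → Cell) → ℕ → Cell
  next r zero    = wall
  next r (suc i) = successor (r i) (r (suc i)) (r (suc (suc i)))

  -- The cells 0 … W of the row r show a configuration between two walls.
  record Shows (W : ℕ) (q : Fin nStates) (l g : List (Sym M)) (r : ℕ → Cell) : Set where
    field
      fits    : suc (length l) < W
      wallˡ   : r 0 ≡ wall
      wallʳ   : r W ≡ wall
      onLeft  : ∀ i j → suc (i + j) ≡ length l → r (suc i) ≡ sym₁ (nth zero l j)
      onHead  : r (suc (length l)) ≡ head q (nth zero g 0)
      onRight : ∀ i j → i ≡ suc (length l + suc j) → i < W → r i ≡ sym₁ (nth zero g (suc j))

  next-wall : ∀ r {W} → 0 < W → r W ≡ wall → next r W ≡ wall
  next-wall r {suc W} _ eq = cong (λ a → successor (r W) a (r (suc (suc W)))) eq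

  module _ {W : ℕ} {q : Fin nStates} {l g : List (Sym M)} {r : ℕ → Cell} (sh : Shows W q l g r) where
    open Shows sh

    scanned : Sym M
    scanned = nth zero g 0

    quietˡ : ∀ i j → i + j ≡ length l → fromLeft (r i) ≡ nothing
    quietˡ zero    j eq = cong fromLeft wallˡ
    quietˡ (suc i) j eq = cong fromLeft (onLeft i j eq)

    quietʳ : ∀ i j → i ≡ suc (length l + suc j) → i ≤ W → fromRight (r i) ≡ nothing
    quietʳ i j eq le with m≤n⇒m<n∨m≡n le
    ... | inj₁ lt   = cong fromRight (onRight i j eq lt)
    ... | inj₂ refl = cong fromRight wallʳ

    quiet : ∀ a b {x} → fromLeft a ≡ nothing → fromRight b ≡ nothing → successor a (sym₁ x) b ≡ sym₁ x
    quiet a b {x} p p' = cong₂ (λ m n → enter m n x) p p'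

    next≡ : ∀ i {a} → r (suc i) ≡ a → next r (suc i) ≡ successor (r i) a (r (suc (suc i)))
    next≡ i = cong (λ a → successor (r i) a (r (suc (suc i))))

    oldˡ : ∀ i j → suc (i + suc j) ≡ length l → next r (suc i) ≡ sym₁ (nth zero l (suc j))
    oldˡ i j eq = trans (next≡ i (onLeft i (suc j) eq))
      (quiet (r i) (r (suc (suc i))) (quietˡ i (suc (suc j)) (trans (+-suc i (suc j)) eq))
             (cong fromRight (onLeft (suc i) j (trans (cong suc (sym (+-suc i j))) eq))))

    nextˡ : ∀ i → suc i ≡ length l → next r (suc i) ≡ enter nothing (leavesLeft (δ q scanned)) (nth zero l 0)
    nextˡ i eq = trans (next≡ i (onLeft i 0 (trans (cong suc (+-identityʳ i)) eq)))
      (cong₂ (λ m n → enter m n (nth zero l 0)) (quietˡ i 1 (trans (+-comm i 1) eq))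
             (cong fromRight (trans (cong (r ∘ suc) eq) onHead)))

    nextʳ : ∀ i → i ≡ suc (length l) → suc i < W →
            next r (suc i) ≡ enter (leavesRight (δ q scanned)) nothing (nth zero g 1)
    nextʳ i eq lt = trans (next≡ i (onRight (suc i) 0 (cong suc (trans eq (+-comm 1 (length l)))) lt))
      (cong₂ (λ m n → enter m n (nth zero g 1)) (cong fromLeft (trans (cong r eq) onHead))
             (quietʳ (suc (suc i)) 1 (cong suc (trans (cong suc eq) (+-comm 2 (length l)))) lt))

    oldʳ : ∀ i j → i ≡ suc (length l + suc j) → suc i < W → next r (suc i) ≡ sym₁ (nth zero g (suc (suc j)))
    oldʳ i j eq lt = trans (next≡ i (onRight (suc i) (suc j) eq₁ lt))
      (quiet (r i) (r (suc (suc i))) (cong fromLeft (onRight i j eq (<⇒≤ lt)))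
             (quietʳ (suc (suc i)) (suc (suc j)) (cong suc (trans eq₁ (sym (+-suc (length l) (suc (suc j)))))) lt))
      where
        eq₁ : suc i ≡ suc (length l + suc (suc j))
        eq₁ = cong suc (trans eq (sym (+-suc (length l) (suc j))))

    nextHead : next r (suc (length l)) ≡ act (r (length l)) q scanned (δ q scanned)
    nextHead = next≡ (length l) onHead

    nextWall : next r W ≡ wall
    nextWall = next-wall r (≤-trans (s≤s z≤n) fits) wallʳ

    stillˡ : leavesLeft (δ q scanned) ≡ nothing → ∀ i j → suc (i + j) ≡ length l → next r (suc i) ≡ sym₁ (nth zero l j)
    stillˡ e i zero    eq = trans (nextˡ i (trans (cong suc (sym (+-identityʳ i))) eq))
                                  (cong (λ m → enter nothing m (nth zero l 0)) e)
    stillˡ e i (suc j) eq = oldˡ i j eq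

    stillʳ : leavesRight (δ q scanned) ≡ nothing → ∀ i j → i ≡ suc (length l + suc j) → i < W →
             next r i ≡ sym₁ (nth zero g (suc j))
    stillʳ e (suc i) zero    eq lt = trans (nextʳ i (trans (suc-injective eq) (+-comm (length l) 1)) lt)
                                       (cong (λ m → enter m nothing (nth zero g 1)) e)
    stillʳ e (suc i) (suc j) eq lt = oldʳ i j (trans (suc-injective eq) (+-suc (length l) (suc j))) lt

    -- This covers the three ways in which the head keeps its cell: halting, a stay move, and a left
    -- move at the left end. The last one is the alternative `l ≡ []`.
    shows-stay : ∀ {q' s' g'} → act (r (length l)) q scanned (δ q scanned) ≡ head q' s' → leavesRight (δ q scanned) ≡ nothing →
      (leavesLeft (δ q scanned) ≡ nothing ⊎ l ≡ []) → nth zero g' 0 ≡ s' → (∀ j → nth zero g' (suc j) ≡ nth zero g (suc j)) →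
      Shows W q' l g' (next r)
    shows-stay {q'} a eʳ eˡ g₀ gs = record
      { fits = fits ; wallˡ = refl ; wallʳ = nextWall
      ; onLeft  = λ i j eq → case eˡ of λ { (inj₁ e) → stillˡ e i j eq ; (inj₂ refl) → case eq of λ () }
      ; onHead  = trans nextHead (trans a (cong (head q') (sym g₀)))
      ; onRight = λ i j eq lt → trans (stillʳ eʳ i j eq lt) (cong sym₁ (sym (gs j))) }

    shows-right : ∀ {q' s' g'} → δ q scanned ≡ just (q' , s' , right) → suc (suc (length l)) < W →
      (∀ j → nth zero g' j ≡ nth zero g (suc j)) → Shows W q' (s' ∷ l) g' (next r)
    shows-right {q'} {s'} {g'} e fits' gs = record
      { fits = fits' ; wallˡ = refl ; wallʳ = nextWall ; onLeft = onL
      ; onHead  = trans (nextʳ (suc (length l)) refl fits') (trans (cong (λ a → enter (leavesRight a) nothing (nth zero g 1)) e) (cong (head q') (sym (gs 0))))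
      ; onRight = λ { (suc i) j eq lt → trans (oldʳ i j (suc-injective eq) lt) (cong sym₁ (sym (gs (suc j)))) } }
      where
        onL : ∀ i j → suc (i + j) ≡ suc (length l) → next r (suc i) ≡ sym₁ (nth zero (s' ∷ l) j)
        onL i zero    eq = trans (cong (next r) (trans (cong suc (sym (+-identityʳ i))) eq)) (trans nextHead (cong (act (r (length l)) q scanned) e))
        onL i (suc j) eq = stillˡ (cong leavesLeft e) i j (trans (sym (+-suc i j)) (suc-injective eq))

  shows-left : ∀ {W q x l g r q' s' g'} → Shows W q (x ∷ l) g r → δ q (nth zero g 0) ≡ just (q' , s' , left) →
    nth zero g' 0 ≡ x → nth zero g' 1 ≡ s' → (∀ j → nth zero g' (suc (suc j)) ≡ nth zero g (suc j)) →
    Shows W q' l g' (next r)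
  shows-left {W} {q} {x} {l} {g} {r} {q'} {s'} {g'} sh e g₀ g₁ gs = record
    { fits = <⇒≤ (Shows.fits sh) ; wallˡ = refl ; wallʳ = nextWall sh
    ; onLeft  = λ i j eq → oldˡ sh i j (cong suc (trans (+-suc i j) eq))
    ; onHead  = trans (nextˡ sh (length l) refl) (trans (cong (λ a → enter nothing (leavesLeft a) x) e) (cong (head q') (sym g₀)))
    ; onRight = onR }
    where
      onR : ∀ i j → i ≡ suc (length l + suc j) → i < W → next r i ≡ sym₁ (nth zero g' (suc j))
      onR i zero eq lt = trans (cong (next r) (trans eq (cong suc (+-comm (length l) 1)))) (trans (nextHead sh)
        (trans (cong₂ (λ a b → act a q (nth zero g 0) b) (Shows.onLeft sh (length l) 0 (cong suc (+-identityʳ (length l)))) e) (cong sym₁ (sym g₁))))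
      onR i (suc j) eq lt = trans (stillʳ sh (cong leavesRight e) i j (trans eq (cong suc (+-suc (length l) (suc j)))) lt) (cong sym₁ (sym (gs j)))

  -- Machine steps as successive rows

  step⊎ : Config M → Config M
  step⊎ c = case step M c of λ { nothing → c ; (just c') → c' }

  private
    step-nothing : ∀ q l g → δ q (nth zero g 0) ≡ nothing → step M (cfg q l g) ≡ nothing
    step-nothing q l []      e rewrite e = refl
    step-nothing q l (x ∷ g) e rewrite e = refl

    step-just : ∀ q l g {q' s' m} → δ q (nth zero g 0) ≡ just (q' , s' , m) → step M (cfg q l g) ≡
      just (cfg q' (proj₁ (move M m l (s' ∷ dropHead M g))) (proj₂ (move M m l (s' ∷ dropHead M g))))
    step-just q l []      e rewrite e = refl
    step-just q l (x ∷ g) e rewrite e = refl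

    nth-dropHead : ∀ g j → nth zero (dropHead M g) j ≡ nth zero g (suc j)
    nth-dropHead []      j = refl
    nth-dropHead (x ∷ g) j = refl

  ShowsConfig : ℕ → Config M → (ℕ → Cell) → Set
  ShowsConfig W (cfg q l g) r = Shows W q l g r

  headPos : Config M → ℕ
  headPos (cfg q l g) = length l

  step⊎-cong : ∀ {c c'} → step M c ≡ just c' → step⊎ c ≡ c'
  step⊎-cong eq rewrite eq = refl

  step⊎-halt : ∀ {c} → step M c ≡ nothing → step⊎ c ≡ c
  step⊎-halt eq rewrite eq = refl

  shows-step : ∀ {W r} c → ShowsConfig W c r → suc (suc (headPos c)) < W → ShowsConfig W (step⊎ c) (next r)
  shows-step {W} {r} (cfg q l g) sh lt with δ q (nth zero g 0) in e
  ... | nothing = subst (λ c → ShowsConfig W c (next r)) (sym (step⊎-halt (step-nothing q l g e)))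
        (shows-stay sh (cong (act (r (length l)) q _) e) (cong leavesRight e) (inj₁ (cong leavesLeft e)) refl (λ _ → refl))
  ... | just (q' , s' , m) = subst (λ c → ShowsConfig W c (next r)) (sym (step⊎-cong (step-just q l g e))) (by m e)
    where
      by : ∀ m → δ q (nth zero g 0) ≡ just (q' , s' , m) → ShowsConfig W
        (cfg q' (proj₁ (move M m l (s' ∷ dropHead M g))) (proj₂ (move M m l (s' ∷ dropHead M g)))) (next r)
      by stay  e = shows-stay sh (cong (act (r (length l)) q _) e) (cong leavesRight e) (inj₁ (cong leavesLeft e)) refl (nth-dropHead g)
      by right e = shows-right sh e lt (nth-dropHead g)
      by left  e = byLeft l sh e
        where
          byLeft : ∀ l → Shows W q l g r → δ q (nth zero g 0) ≡ just (q' , s' , left) → ShowsConfig W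
            (cfg q' (proj₁ (move M left l (s' ∷ dropHead M g))) (proj₂ (move M left l (s' ∷ dropHead M g)))) (next r)
          byLeft []      sh e = shows-stay sh (cong₂ (λ a b → act a q (nth zero g 0) b) (Shows.wallˡ sh) e) (cong leavesRight e) (inj₂ refl) refl (nth-dropHead g)
          byLeft (x ∷ l) sh e = shows-left sh e refl refl (nth-dropHead g)

  headPos-step⊎ : ∀ c → headPos (step⊎ c) ≤ suc (headPos c)
  headPos-step⊎ (cfg q l g) with δ q (nth zero g 0) in e
  ... | nothing = ≤-trans (≤-reflexive (cong headPos (step⊎-halt (step-nothing q l g e)))) (n≤1+n _)
  ... | just (q' , s' , m) = ≤-trans (≤-reflexive (cong headPos (step⊎-cong (step-just q l g e)))) (by m l)
    where
      by : ∀ m l → length (proj₁ (move M m l (s' ∷ dropHead M g))) ≤ suc (length l)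
      by left  []      = z≤n
      by left  (x ∷ l) = ≤-trans (n≤1+n _) (n≤1+n _)
      by right l       = ≤-refl
      by stay  l       = n≤1+n _

  steps : ℕ → Config M → Config M
  steps zero    c = c
  steps (suc t) c = step⊎ (steps t c)

  steps-step⊎ : ∀ t c → steps t (step⊎ c) ≡ step⊎ (steps t c)
  steps-step⊎ zero    c = refl
  steps-step⊎ (suc t) c = cong step⊎ (steps-step⊎ t c)

  -- With halted configurations repeated, there is a configuration at every time. The field `unique`
  -- identifies a halted head seen in any row with the final configuration, even if the machine
  -- stops before time k.
  record Halting (k : ℕ) (c c' : Config M) : Set where
    field
      halted : step M c' ≡ nothing
      final  : steps k c ≡ c'
      unique : ∀ t → step M (steps t c) ≡ nothing → steps t c ≡ c'

  halting : ∀ k c {c'} → haltsWithin M k c ≡ just c' → Halting k c c'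
  halting k c eq with step M c in st
  halting k       c refl | nothing = record
    { halted = st ; final = still k ; unique = λ t _ → still t }
    where
      still : ∀ t → steps t c ≡ c
      still zero    = refl
      still (suc t) = trans (cong step⊎ (still t)) (step⊎-halt st)
  halting (suc k) c eq   | just c₁ with halting k c₁ eq
  ... | h = record { halted = Halting.halted h ; final = trans (later k) (Halting.final h) ; unique = uniq }
    where
      later : ∀ t → steps (suc t) c ≡ steps t c₁
      later t = trans (sym (steps-step⊎ t c)) (cong (steps t) (step⊎-cong st))
      uniq : ∀ t → step M (steps t c) ≡ nothing → steps t c ≡ _
      uniq zero    n = case trans (sym n) st of λ ()
      uniq (suc t) n = trans (later t) (Halting.unique h t (trans (cong (step M) (sym (later t))) n))

  -- Row 0 shows the tape without a head, so the first bit is coded like every other one and its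
  -- template depends on the bit alone. The initial configuration appears in row 1.
  initialCells : Str → ℕ → List Cell
  initialCells z b = wall₀ ∷ map (sym₁ ∘ encBit M) z ++ replicate b (sym₁ zero) ++ wall ∷ []

  -- The rows as one sequence of cells

  module Rows (z : Str) (b : ℕ) where

    W : ℕ
    W = suc (length z + b)

    row : ℕ → ℕ → Cell
    row zero    i = nth wall (initialCells z b) i
    row (suc t) i = next (row t) i

    -- Consecutive rows share a wall: position W of row t is position 0 of row t + 1. This is why
    -- the period is W although a row has W + 1 cells.
    u : ℕ → Cell
    u c = row (c / W) (c % W)

    private
      blanks : ∀ b i → i < b → nth wall (replicate b (sym₁ zero) ++ wall ∷ []) i ≡ sym₁ zero
      blanks (suc b) zero    _        = refl
      blanks (suc b) (suc i) (s≤s lt) = blanks b i lt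

      blanks-end : ∀ b → nth wall (replicate b (sym₁ zero) ++ wall ∷ []) b ≡ wall
      blanks-end zero    = refl
      blanks-end (suc b) = blanks-end b

      input : ∀ z i → i < length z + b → nth wall (map (sym₁ ∘ encBit M) z ++ replicate b (sym₁ zero) ++ wall ∷ []) i ≡
              sym₁ (nth zero (map (encBit M) z) i)
      input []      i       lt       = blanks b i lt
      input (x ∷ z) zero    lt       = refl
      input (x ∷ z) (suc i) (s≤s lt) = input z i lt

      input-end : ∀ z → nth wall (map (sym₁ ∘ encBit M) z ++ replicate b (sym₁ zero) ++ wall ∷ []) (length z + b) ≡ wall
      input-end []      = blanks-end b
      input-end (x ∷ z) = input-end z

      row-wallʳ : ∀ t → row t W ≡ wall
      row-wallʳ zero    = input-end z
      row-wallʳ (suc t) = next-wall (row t) (s≤s z≤n) (row-wallʳ t)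

    u-row : ∀ t i → i ≤ W → u (i + t * W) ≡ row t i
    u-row t i le with m≤n⇒m<n∨m≡n le
    ... | inj₁ lt = cong₂ row
          (trans (+-distrib-/-∣ʳ i (n∣m*n t)) (cong₂ _+_ (m<n⇒m/n≡0 lt) (m*n/n≡m t W)))
          (trans ([m+kn]%n≡m%n i t W) (m<n⇒m%n≡m lt))
    ... | inj₂ refl = trans (cong₂ row (m*n/n≡m (suc t) W) ([m+kn]%n≡m%n 0 (suc t) W)) (sym (row-wallʳ t))

    u-initial : ∀ c → c ≤ W → u c ≡ nth wall (initialCells z b) c
    u-initial c le = trans (cong u (sym (+-identityʳ c))) (u-row 0 c le)

    private
      u-rec′ : ∀ t i → i < W →
        u (suc W + (i + t * W)) ≡ successor (u (i + t * W)) (u (suc (i + t * W))) (u (suc (suc (i + t * W))))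
      u-rec′ t i lt with m≤n⇒m<n∨m≡n lt
      ... | inj₁ lt' = trans (cong u shift) (trans (u-row (suc t) (suc i) lt)
              (sym (trans (cong (λ a → successor a (u (suc (i + t * W))) (u (suc (suc (i + t * W))))) (u-row t i (<⇒≤ lt)))
                (cong₂ (successor (row t i)) (u-row t (suc i) lt) (u-row t (suc (suc i)) lt')))))
        where
          shift : suc W + (i + t * W) ≡ suc i + suc t * W
          shift = cong suc (solve 3 (λ W i x → W :+ (i :+ x) := i :+ (W :+ x)) refl W i (t * W))
            where open +-*-Solver
      -- Here the middle cell is the wall shared by two rows. The third cell belongs to the next
      -- row, but the successor of a wall is a wall whatever its neighbours are.
      ... | inj₂ eq = trans (trans (cong u shift) (u-row (suc (suc t)) 0 z≤n))
              (sym (cong (λ a → successor (u (i + t * W)) a (u (suc (suc (i + t * W))))) (trans (u-row t (suc i) lt) (trans (cong (row t) eq) (row-wallʳ t)))))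
        where
          shift : suc W + (i + t * W) ≡ 0 + suc (suc t) * W
          shift = trans (cong suc (solve 3 (λ W i x → W :+ (i :+ x) := i :+ (W :+ x)) refl W i (t * W))) (cong (_+ (W + t * W)) eq)
            where open +-*-Solver

    u-rec : ∀ c → u (suc W + c) ≡ successor (u c) (u (1 + c)) (u (2 + c))
    u-rec c = subst (λ d → u (suc W + d) ≡ successor (u d) (u (1 + d)) (u (2 + d)))
      (sym (m≡m%n+[m/n]*n c W)) (u-rec′ (c / W) (c % W) (m%n<n c W))

    private
      shows-start : 1 < W → ShowsConfig W (initial M z) (row 1)
      shows-start lt = record
        { fits = lt ; wallˡ = refl ; wallʳ = row-wallʳ 1 ; onLeft = λ _ _ ()
        ; onHead  = cong (λ a → successor wall₀ a (row 0 2)) (input z 0 (≤-pred lt))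
        ; onRight = λ { (suc (suc i)) .i refl (s≤s lt) →
            trans (cong (λ a → successor (row 0 (suc i)) a (row 0 (suc (suc (suc i))))) (input z (suc i) lt))
              (cong₂ (λ m n → enter m n _) (cong fromLeft (input z i (<⇒≤ lt))) (quiet₀ (suc (suc i)) lt)) } }
        where
          quiet₀ : ∀ i → i ≤ length z + b → fromRight (row 0 (suc i)) ≡ nothing
          quiet₀ i le with m≤n⇒m<n∨m≡n le
          ... | inj₁ lt   = cong fromRight (input z i lt)
          ... | inj₂ refl = cong fromRight (input-end z)

      config : ℕ → Config M
      config t = steps t (initial M z)

      headPos-config : ∀ t → headPos (config t) ≤ t
      headPos-config zero    = z≤n
      headPos-config (suc t) = ≤-trans (headPos-step⊎ (config t)) (s≤s (headPos-config t))

      shows-config : ∀ t → suc t < W → ShowsConfig W (config t) (row (suc t))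
      shows-config zero    lt = shows-start lt
      shows-config (suc t) lt = shows-step (config t) (shows-config t (<⇒≤ lt)) (≤-trans (s≤s (s≤s (s≤s (headPos-config t)))) lt)

      not-rejects : ∀ a {s} → (a ≡ nothing → s ≡ suc (suc zero)) → rejects a s ≡ false
      not-rejects (just _) h = refl
      not-rejects nothing  h = cong (rejects nothing) (h refl)

      bad-shows : ∀ {q l g r} → Shows W q l g r → (δ q (nth zero g 0) ≡ nothing → nth zero g 0 ≡ suc (suc zero)) →
                  ∀ i → i < W → bad (r i) ≡ false
      bad-shows sh h zero lt = cong bad (Shows.wallˡ sh)
      bad-shows {q} {l} {g} {r} sh h (suc i) lt with suc i ≤? length l
      ... | yes le = cong bad (Shows.onLeft sh i (length l ∸ suc i) (m+[n∸m]≡n le))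
      ... | no ¬le with m≤n⇒m<n∨m≡n (≤-pred (≰⇒> ¬le))
      ...   | inj₁ gt = cong bad (Shows.onRight sh (suc i) (i ∸ suc (length l))
                (cong suc (trans (sym (m+[n∸m]≡n gt)) (sym (+-suc (length l) _)))) lt)
      ...   | inj₂ refl = trans (cong bad (Shows.onHead sh)) (not-rejects (δ q (nth zero g 0)) h)

      bad-initial : ∀ i → i < W → bad (row 0 i) ≡ false
      bad-initial zero    lt       = refl
      bad-initial (suc i) (s≤s lt) = cong bad (input z i lt)

      readBits-true : ∀ g {w} → readBits M g ≡ true ∷ w → nth zero g 0 ≡ suc (suc zero)
      readBits-true (suc (suc zero) ∷ g) eq = refl

      true-readBits : ∀ g → nth zero g 0 ≡ suc (suc zero) → Σ Str λ w → readBits M g ≡ true ∷ w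
      true-readBits (suc (suc zero) ∷ g) refl = readBits M g , refl

      rejects-nothing : ∀ s → rejects nothing s ≡ false → s ≡ suc (suc zero)
      rejects-nothing (suc (suc zero)) _ = refl

      nothing-step : ∀ c → step M c ≡ nothing → δ (Config.state c) (nth zero (Config.rgt c) 0) ≡ nothing
      nothing-step (cfg q l g) eq with δ q (nth zero g 0) in e
      ... | nothing = refl
      ... | just _  = case trans (sym eq) (step-just q l g e) of λ ()

      step-nothing′ : ∀ c → δ (Config.state c) (nth zero (Config.rgt c) 0) ≡ nothing → step M c ≡ nothing
      step-nothing′ (cfg q l g) = step-nothing q l g

    initial-good : ∀ c → c ≤ W → bad (u c) ≡ false
    initial-good c le with m≤n⇒m<n∨m≡n le
    ... | inj₁ lt   = trans (cong bad (u-initial c le)) (bad-initial c lt)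
    ... | inj₂ refl = cong bad (trans (u-initial W le) (row-wallʳ 0))

    module _ {T} (room : T + 4 ≤ W) {c'} (h : haltsWithin M T (initial M z) ≡ just c') where

      private
        H : Halting T (initial M z) c'
        H = halting T (initial M z) h

      -- The cells may end inside a row. As `suc W` is at most W + W, they lie in rows below T + 4,
      -- and `room` ensures that all of these after row 0 show configurations. A halted head in any
      -- of them belongs to the final configuration and hence scans true.
      accept-good : output M c' ≡ true ∷ [] → ∀ c → c < suc W + (T + 2) * W → bad (u c) ≡ false
      accept-good out c lt with c / W | m<n*o⇒m/o<n {c} {T + 4} {W} (≤-trans lt bound)
        where
          bound : suc W + (T + 2) * W ≤ (T + 4) * W
          bound = ≤-trans (+-monoˡ-≤ ((T + 2) * W) (s≤s (m≤n+m W (length z + b))))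
            (≤-reflexive (solve 2 (λ T W → W :+ W :+ (T :+ con 2) :* W := (T :+ con 4) :* W) refl T W))
            where open +-*-Solver
      ... | zero  | _ = bad-initial (c % W) (m%n<n c W)
      ... | suc t | t< = bad-shows (shows-config t (≤-trans t< room)) ok (c % W) (m%n<n c W)
        where
          ok : δ (Config.state (config t)) (nth zero (Config.rgt (config t)) 0) ≡ nothing →
               nth zero (Config.rgt (config t)) 0 ≡ suc (suc zero)
          ok e = readBits-true (Config.rgt (config t))
            (trans (cong (output M) (Halting.unique H t (step-nothing′ (config t) e))) out)

      -- By time T the machine has halted, so row T + 1 shows the final configuration and its head
      -- lies within the cells covered. Being good, this head scans true, which is the first output
      -- bit.
      good-accept : ∀ {r} → output M c' ≡ r ∷ [] → (∀ c → c < suc W + (T + 2) * W → bad (u c) ≡ false) → r ≡ true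
      good-accept {r} out good with true-readBits (Config.rgt c') (rejects-nothing (nth zero (Config.rgt c') 0)
          (trans (cong (λ a → rejects a (nth zero (Config.rgt c') 0)) (sym (nothing-step c' (Halting.halted H))))
            (trans (cong bad (sym (trans (u-row (suc T) (suc (headPos c')) (<⇒≤ (Shows.fits sh))) (Shows.onHead sh)))) (good _ lt))))
        where
          sh : ShowsConfig W c' (row (suc T))
          sh = subst (λ c → ShowsConfig W c (row (suc T))) (Halting.final H)
                 (shows-config T (≤-trans (≤-trans (≤-reflexive (+-comm 2 T)) (+-monoʳ-≤ T (s≤s (s≤s z≤n)))) room))
          lt : suc (headPos c') + suc T * W < suc W + (T + 2) * W
          lt = +-mono-<-≤ (m≤n⇒m≤1+n (Shows.fits sh)) (*-monoˡ-≤ W (≤-trans (≤-reflexive (+-comm 1 T)) (+-monoʳ-≤ T (s≤s z≤n))))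
      ... | w , eq = case trans (sym out) eq of λ { refl → refl }

-- The formula of a computation

eqV : ∀ {n} → Vec Bool n → Vec Bool n → Bool
eqV u v = does (VP.≡-dec _≟B_ u v)

eqV-sound : ∀ {n} (u v : Vec Bool n) → eqV u v ≡ true → u ≡ v
eqV-sound u v eq with VP.≡-dec _≟B_ u v
... | yes p = p

eqV-refl : ∀ {n} {u v : Vec Bool n} → u ≡ v → eqV u v ≡ true
eqV-refl {u = u} {v} eq with VP.≡-dec _≟B_ u v
... | yes _ = refl
... | no ne = ⊥-elim (ne eq)

pairPrefix : Str → Str
pairPrefix x = concatMap (λ b → b ∷ b ∷ []) x ++ false ∷ true ∷ []

pair-prefix : ∀ x y → pair x y ≡ pairPrefix x ++ y
pair-prefix x y = sym (++-assoc (concatMap (λ b → b ∷ b ∷ []) x) (false ∷ true ∷ []) y)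

∧-true : ∀ a {b} → a ∧ b ≡ true → a ≡ true × b ≡ true
∧-true true eq = refl , eq

forbid-slots : ∀ {m} {Q : Slot → Set} (ss : Vec Slot m) G → VAll.All Q ss →
               ∀ {c} → c ∈ forbid ss G → ∀ {l} → l ∈ c → Q (proj₁ l)
forbid-slots {Q = Q} ss G qs c∈ l∈ with ∈-map⁻ (differ ss) c∈
... | β , _ , refl = go ss β qs l∈
  where
    go : ∀ {m} (ss : Vec Slot m) (β : Vec Bool m) → VAll.All Q ss → ∀ {l} → l ∈ differ ss β → Q (proj₁ l)
    go []       []      VAll.[] ()
    go (s ∷ ss) (b ∷ β) (q VAll.∷ qs) (here refl) = q
    go (s ∷ ss) (b ∷ β) (q VAll.∷ qs) (there m)   = go ss β qs m

module Encoding (M : TM) (K : ℕ) (encCell : Tableau.Cell M → Vec Bool K) (decCell : Vec Bool K → Tableau.Cell M)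
                (decCell-encCell : ∀ c → decCell (encCell c) ≡ c) where
  open Tableau M public hiding (K; encCell; decCell; decCell-encCell)

  exactly : Cell → Block
  exactly c = forbid (near K 0) (λ v → eqV v (encCell c))

  bitCell : Bool → Cell
  bitCell b = sym₁ (encBit M b)

  free : Block
  free = forbid (near K 0) (λ v → eqV v (encCell (bitCell false)) ∨ eqV v (encCell (bitCell true)))

  -- The new cell must be the code of the successor. Merely decoding to it would not do: `decCell`
  -- may identify several vectors, and other codes of the same cell would add satisfying
  -- assignments.
  lawful : Vec Bool K → Vec Bool K → Vec Bool K → Vec Bool K → Bool
  lawful a b c d = eqV d (encCell (successor (decCell a) (decCell b) (decCell c))) ∧ not (bad (decCell d))

  -- The window consists of three adjacent cells and the cell below the middle one.
  window : Vec Slot (K + (K + (K + K)))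
  window = near K 0 V.++ (near K 1 V.++ (near K 2 V.++ far K))

  lawfulWindow : Vec Bool (K + (K + (K + K))) → Bool
  lawfulWindow v = lawful (proj₁ p) (proj₁ p₁) (proj₁ p₂) (proj₂ p₂)
    where
      p  = cut K v
      p₁ = cut K (proj₂ p)
      p₂ = cut K (proj₂ p₁)

  transition : Block
  transition = forbid window lawfulWindow

  closing : ℕ → List Cell
  closing b = replicate b (sym₁ zero) ++ wall ∷ []

  opening : Str → List Cell
  opening x = wall₀ ∷ map bitCell (pairPrefix x)

  initialBlocks : Str → ℕ → ℕ → List Block
  initialBlocks x P b = map exactly (opening x) ++ replicate P free ++ map exactly (closing b)

  initialCells-pair : ∀ x y b → initialCells (pair x y) b ≡ opening x ++ map bitCell y ++ closing b
  initialCells-pair x y b = cong (wall₀ ∷_) (trans (cong (λ w → map bitCell w ++ closing b) (pair-prefix x y))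
    (trans (cong (_++ closing b) (map-++ bitCell (pairPrefix x) y)) (++-assoc (map bitCell (pairPrefix x)) (map bitCell y) (closing b))))

  encCell-injective : ∀ {c d} → encCell c ≡ encCell d → c ≡ d
  encCell-injective {c} {d} eq = trans (sym (decCell-encCell c)) (trans (cong decCell eq) (decCell-encCell d))

  -- What satisfying assignments of the blocks look like

  module Semantics (L : ℕ) (α : ℕ → Bool) where
    open Blocks K L

    Matches : ℕ → List Cell → Set
    Matches c []       = ⊤
    Matches c (a ∷ as) = cell α c ≡ encCell a × Matches (suc c) as

    matches-at : ∀ c as → Matches c as → ∀ i → i < length as → cell α (i + c) ≡ encCell (nth wall as i)
    matches-at c (a ∷ as) (m , ms) zero    _        = m
    matches-at c (a ∷ as) (m , ms) (suc i) (s≤s lt) =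
      subst (λ d → cell α d ≡ encCell (nth wall as i)) (+-suc i c) (matches-at (suc c) as ms i lt)

    at-matches : ∀ c as → (∀ i → i < length as → cell α (i + c) ≡ encCell (nth wall as i)) → Matches c as
    at-matches c []       h = tt
    at-matches c (a ∷ as) h = h 0 (s≤s z≤n) , at-matches (suc c) as
      (λ i lt → subst (λ d → cell α d ≡ encCell (nth wall as i)) (sym (+-suc i c)) (h (suc i) (s≤s lt)))

    matches-++ : ∀ c as bs → Matches c as → Matches (length as + c) bs → Matches c (as ++ bs)
    matches-++ c []       bs _        n = n
    matches-++ c (a ∷ as) bs (m , ms) n =
      m , matches-++ (suc c) as bs ms (subst (λ d → Matches d bs) (sym (+-suc (length as) c)) n)

    ++-matches : ∀ c as bs → Matches c (as ++ bs) → Matches c as × Matches (length as + c) bs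
    ++-matches c []       bs m        = tt , m
    ++-matches c (a ∷ as) bs (m , ms) with ++-matches (suc c) as bs ms
    ... | p , q = (m , p) , subst (λ d → Matches d bs) (+-suc (length as) c) q

    read-near₀ : ∀ c → V.map (α ∘ index c) (near K 0) ≡ cell α c
    read-near₀ c = read-near α c 0

    exactly-sound : ∀ c as Bs → SatFrom α c (map exactly as ++ Bs) → Matches c as × SatFrom α (length as + c) Bs
    exactly-sound c []       Bs s       = tt , s
    exactly-sound c (a ∷ as) Bs (h , s) with exactly-sound (suc c) as Bs s
    ... | m , s' = (trans (sym (read-near₀ c)) (eqV-sound _ _ (forbid-sound α c (near K 0) _ h)) , m) ,
                   subst (λ d → SatFrom α d Bs) (+-suc (length as) c) s'

    exactly-complete : ∀ c as Bs → Matches c as → SatFrom α (length as + c) Bs → SatFrom α c (map exactly as ++ Bs)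
    exactly-complete c []       Bs _        s = s
    exactly-complete c (a ∷ as) Bs (m , ms) s =
      forbid-complete α c (near K 0) _ (eqV-refl (trans (read-near₀ c) m)) ,
      exactly-complete (suc c) as Bs ms (subst (λ d → SatFrom α d Bs) (sym (+-suc (length as) c)) s)

    free-sound : ∀ P c Bs → SatFrom α c (replicate P free ++ Bs) →
                 Σ Str λ y → length y ≡ P × Matches c (map bitCell y) × SatFrom α (P + c) Bs
    free-sound zero    c Bs s       = [] , refl , tt , s
    free-sound (suc P) c Bs (h , s) with free-sound P (suc c) Bs s
      | eqV (cell α c) (encCell (bitCell false)) in e
      | subst (λ v → eqV v (encCell (bitCell false)) ∨ eqV v (encCell (bitCell true)) ≡ true) (read-near₀ c) (forbid-sound α c (near K 0) _ h)
    ... | y , refl , ms , s' | true  | _ = false ∷ y , refl , (eqV-sound _ _ e , ms) , subst (λ d → SatFrom α d Bs) (+-suc (length y) c) s'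
    ... | y , refl , ms , s' | false | t = true ∷ y , refl ,
      (eqV-sound _ _ t , ms) , subst (λ d → SatFrom α d Bs) (+-suc (length y) c) s'

    free-complete : ∀ y c Bs → Matches c (map bitCell y) → SatFrom α (length y + c) Bs →
                    SatFrom α c (replicate (length y) free ++ Bs)
    free-complete []      c Bs _        s = s
    free-complete (b ∷ y) c Bs (m , ms) s =
      forbid-complete α c (near K 0) _ (trans (cong (λ v → eqV v (encCell (bitCell false)) ∨ eqV v (encCell (bitCell true))) (trans (read-near₀ c) m)) (isBit b)) ,
      free-complete y (suc c) Bs ms (subst (λ d → SatFrom α d Bs) (sym (+-suc (length y) c)) s)
      where
        isBit : ∀ b → eqV (encCell (bitCell b)) (encCell (bitCell false)) ∨ eqV (encCell (bitCell b)) (encCell (bitCell true)) ≡ true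
        isBit false = cong (_∨ eqV (encCell (bitCell false)) (encCell (bitCell true))) (eqV-refl {u = encCell (bitCell false)} refl)
        isBit true  = trans (cong (eqV (encCell (bitCell true)) (encCell (bitCell false)) ∨_) (eqV-refl {u = encCell (bitCell true)} refl)) (∨-zeroʳ (eqV (encCell (bitCell true)) (encCell (bitCell false))))

    initial-sound : ∀ x P b → SatFrom α 0 (initialBlocks x P b) →
                    Σ Str λ y → length y ≡ P × Matches 0 (initialCells (pair x y) b)
    initial-sound x P b s with exactly-sound 0 (opening x) _ s
    ... | m₁ , s₁ with free-sound P _ _ s₁
    ... | y , refl , m₂ , s₂ with exactly-sound _ (closing b) [] (subst (SatFrom α _) (sym (++-identityʳ (map exactly (closing b)))) s₂)
    ... | m₃ , _ = y , refl , subst (Matches 0) (sym (initialCells-pair x y b))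
          (matches-++ 0 (opening x) _ m₁ (matches-++ _ (map bitCell y) _ m₂
            (subst (λ k → Matches (k + (length (opening x) + 0)) (closing b)) (sym (length-map bitCell y)) m₃)))

    initial-complete : ∀ x y b → Matches 0 (initialCells (pair x y) b) → SatFrom α 0 (initialBlocks x (length y) b)
    initial-complete x y b m with ++-matches 0 (opening x) _ (subst (Matches 0) (initialCells-pair x y b) m)
    ... | m₁ , m' with ++-matches _ (map bitCell y) _ m'
    ... | m₂ , m₃ = exactly-complete 0 (opening x) _ m₁ (free-complete y _ _ m₂
          (subst (SatFrom α _) (++-identityʳ (map exactly (closing b))) (exactly-complete _ (closing b) []
            (subst (λ k → Matches (k + (length (opening x) + 0)) (closing b)) (length-map bitCell y) m₃) tt)))

    read-window : ∀ c → lawfulWindow (V.map (α ∘ index c) window) ≡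
                  lawful (cell α c) (cell α (1 + c)) (cell α (2 + c)) (cell α (L + c))
    read-window c = trans (cong lawfulWindow parts) (assemble (cell α c) (cell α (1 + c)) (cell α (2 + c)) (cell α (L + c)))
      where
        parts : V.map (α ∘ index c) window ≡ cell α c V.++ (cell α (1 + c) V.++ (cell α (2 + c) V.++ cell α (L + c)))
        parts = trans (VP.map-++ _ (near K 0) _) (cong₂ V._++_ (read-near₀ c)
          (trans (VP.map-++ _ (near K 1) _) (cong₂ V._++_ (read-near α c 1)
          (trans (VP.map-++ _ (near K 2) _) (cong₂ V._++_ (read-near α c 2) (read-far α c))))))
        assemble : ∀ a b c d → lawfulWindow (a V.++ (b V.++ (c V.++ d))) ≡ lawful a b c d
        assemble a b c d rewrite cut-++ a (b V.++ (c V.++ d)) | cut-++ b (c V.++ d) | cut-++ c d = refl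

    transition-sound : ∀ c → rawSat α (instantiate c transition) ≡ true →
      cell α (L + c) ≡ encCell (successor (decCell (cell α c)) (decCell (cell α (1 + c))) (decCell (cell α (2 + c)))) ×
      bad (decCell (cell α (L + c))) ≡ false
    transition-sound c h with ∧-true (eqV (cell α (L + c)) _) (trans (sym (read-window c)) (forbid-sound α c window lawfulWindow h))
    ... | e , g = eqV-sound _ _ e , not-true (bad (decCell (cell α (L + c)))) g
      where
        not-true : ∀ b → not b ≡ true → b ≡ false
        not-true false _ = refl

    transition-complete : ∀ c →
      cell α (L + c) ≡ encCell (successor (decCell (cell α c)) (decCell (cell α (1 + c))) (decCell (cell α (2 + c)))) →
      bad (decCell (cell α (L + c))) ≡ false → rawSat α (instantiate c transition) ≡ true
    transition-complete c e g = forbid-complete α c window lawfulWindow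
      (trans (read-window c) (cong₂ _∧_ (eqV-refl e) (cong not g)))

  -- The formula and its satisfying assignments

  module Formula {{K>0 : NonZero K}} (x : Str) (P T : ℕ) (R : Str → Bool)
    (runs : ∀ y → length y ≡ P → Σ (Config M) λ c →
      haltsWithin M T (initial M (pair x y)) ≡ just c × output M c ≡ R y ∷ []) where

    b W L N n : ℕ
    b = T + 4
    W = suc (P + (2 + double (length x)) + b)
    L = suc W
    N = (T + 2) * W
    n = (L + N) * K

    open Blocks K L

    instance
      n>0 : NonZero n
      n>0 = m*n≢0 (L + N) K

    raw : RawCNF
    raw = sequence 0 (initialBlocks x P b) ++ sequence 0 (replicate N transition)

    formula : CNF n
    formula = toCNF n raw

    private
      room : T + 4 ≤ W
      room = m≤n⇒m≤1+n (m≤n+m (T + 4) (P + (2 + double (length x))))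

      width : ∀ y → length y ≡ P → Rows.W (pair x y) b ≡ W
      width y refl = cong (λ l → suc (l + b)) (length-pair x y)

      u : Str → ℕ → Cell
      u y = Rows.u (pair x y) b

      module _ (y : Str) (|y| : length y ≡ P) where

        u-init : ∀ c → c < L → u y c ≡ nth wall (initialCells (pair x y) b) c
        u-init c (s≤s le) = Rows.u-initial (pair x y) b c (subst (c ≤_) (sym (width y |y|)) le)

        u-step : ∀ c → u y (L + c) ≡ successor (u y c) (u y (1 + c)) (u y (2 + c))
        u-step c = subst (λ w → u y (suc w + c) ≡ successor (u y c) (u y (1 + c)) (u y (2 + c)))
          (width y |y|) (Rows.u-rec (pair x y) b c)

        length-initial : length (initialCells (pair x y) b) ≡ L
        length-initial = cong suc (trans (length-++ (map bitCell (pair x y)))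
          (trans (cong₂ _+_ (length-map bitCell (pair x y)) (trans (length-++ (replicate b (sym₁ zero))) (trans (cong (_+ 1) (length-replicate b)) (+-comm b 1))))
            (trans (+-suc _ b) (width y |y|))))

        u-accept : R y ≡ true → ∀ c → c < L + N → bad (u y c) ≡ false
        u-accept r c lt with runs y |y|
        ... | _ , h , out = Rows.accept-good (pair x y) b (subst (T + 4 ≤_) (sym (width y |y|)) room) h
              (trans out (cong (_∷ []) r)) c (subst (λ w → c < suc w + (T + 2) * w) (sym (width y |y|)) lt)

        accept-u : (∀ c → c < L + N → bad (u y c) ≡ false) → R y ≡ true
        accept-u g with runs y |y|
        ... | _ , h , out = Rows.good-accept (pair x y) b (subst (T + 4 ≤_) (sym (width y |y|)) room) h out
              (subst (λ w → ∀ c → c < suc w + (T + 2) * w → bad (u y c) ≡ false) (sym (width y |y|)) g)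

        initial-u : ∀ c → c < L → bad (u y c) ≡ false
        initial-u c (s≤s le) = Rows.initial-good (pair x y) b c (subst (c ≤_) (sym (width y |y|)) le)

      ≥L : ∀ {c} → ¬ c < L → c ≡ L + (c ∸ L)
      ≥L ge = sym (m+[n∸m]≡n (≮⇒≥ ge))

      <N : ∀ {c} → ¬ c < L → c < L + N → c ∸ L < N
      <N {c} ge lt = +-cancelˡ-< L (c ∸ L) N (subst (_< L + N) (≥L ge) lt)

      2<L : 2 < L
      2<L = s≤s (s≤s (≤-trans (≤-trans (s≤s z≤n) (m≤n+m 4 T)) (m≤n+m (T + 4) (P + (2 + double (length x))))))

      module Assigned (α : ℕ → Bool) where
        open Semantics L α

        -- Course-of-values induction, with m as the bound on c. Beyond the first L cells, a cell is
        -- fixed by those numbered c - L, c - L + 1 and c - L + 2, and all three precede it because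
        -- 2 < L.
        tableau : ∀ y → length y ≡ P → Matches 0 (initialCells (pair x y) b) → SatFrom α 0 (replicate N transition) →
          ∀ m c → c < m → c < L + N → cell α c ≡ encCell (u y c)
        tableau y |y| ms s (suc m) c (s≤s c≤m) lt with c <? L
        ... | yes c<L = trans (cong (cell α) (sym (+-identityʳ c)))
              (trans (matches-at 0 (initialCells (pair x y) b) ms c (subst (c <_) (sym (length-initial y |y|)) c<L)) (cong encCell (sym (u-init y |y| c c<L))))
        ... | no ge = subst (λ d → cell α d ≡ encCell (u y d)) (sym (≥L ge))
              (trans (proj₁ (transition-sound c' (subst (λ d → rawSat α (instantiate d transition) ≡ true) (+-identityʳ c') (SatFrom-replicate α N 0 transition s c' (<N ge lt)))))
                (cong encCell (trans (cong₂ (λ a w → successor a (proj₁ w) (proj₂ w)) (prev 0 (s≤s z≤n)) (cong₂ _,_ (prev 1 (s≤s (s≤s z≤n))) (prev 2 ≤-refl)))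
                  (sym (u-step y |y| c')))))
          where
            c' = c ∸ L
            prev : ∀ k → k < 3 → decCell (cell α (k + c')) ≡ u y (k + c')
            prev k k<3 = trans (cong decCell (tableau y |y| ms s m (k + c') (≤-trans k<c c≤m) (<-trans k<c lt))) (decCell-encCell _)
              where
                k<c : k + c' < c
                k<c = subst (k + c' <_) (sym (≥L ge)) (+-monoˡ-< c' (≤-trans k<3 2<L))

        good : ∀ y → length y ≡ P → SatFrom α 0 (replicate N transition) → (∀ c → c < L + N → cell α c ≡ encCell (u y c)) →
               ∀ c → c < L + N → bad (u y c) ≡ false
        good y |y| s rel c lt with c <? L
        ... | yes c<L = initial-u y |y| c c<L
        ... | no ge = trans (cong bad (sym (trans (cong decCell (rel c lt)) (decCell-encCell _))))
              (subst (λ d → bad (decCell (cell α d)) ≡ false) (sym (≥L ge))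
                (proj₂ (transition-sound (c ∸ L) (subst (λ d → rawSat α (instantiate d transition) ≡ true) (+-identityʳ (c ∸ L)) (SatFrom-replicate α N 0 transition s (c ∸ L) (<N ge lt))))))

        matches : ∀ y → length y ≡ P → (∀ c → c < L + N → cell α c ≡ encCell (u y c)) → Matches 0 (initialCells (pair x y) b)
        matches y |y| rel = at-matches 0 (initialCells (pair x y) b) λ i lt → let i<L = subst (i <_) (length-initial y |y|) lt in
          trans (cong (cell α) (+-identityʳ i)) (trans (rel i (≤-trans i<L (m≤m+n L N))) (cong encCell (u-init y |y| i i<L)))

        sound : rawSat α raw ≡ true → Σ Str λ y → length y ≡ P × R y ≡ true × (∀ c → c < L + N → cell α c ≡ encCell (u y c))
        sound sat with ∧-true (rawSat α (sequence 0 (initialBlocks x P b))) (trans (sym (all-++ (any (rawLit α)) (sequence 0 (initialBlocks x P b)) (sequence 0 (replicate N transition)))) sat)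
        ... | s₁ , s₂ with initial-sound x P b (sequence-SatFrom α 0 (initialBlocks x P b) s₁)
        ... | y , |y| , ms = y , |y| , accept-u y |y| (good y |y| s rel) , rel
          where
            s   = sequence-SatFrom α 0 (replicate N transition) s₂
            rel = λ c lt → tableau y |y| ms s (suc c) c ≤-refl lt

        complete : ∀ y → length y ≡ P → R y ≡ true → (∀ c → c < L + N → cell α c ≡ encCell (u y c)) → rawSat α raw ≡ true
        complete y |y| r rel = trans (all-++ (any (rawLit α)) (sequence 0 (initialBlocks x P b)) (sequence 0 (replicate N transition))) (cong₂ _∧_
          (SatFrom-sequence α 0 (initialBlocks x P b) (subst (λ p → SatFrom α 0 (initialBlocks x p b)) |y| (initial-complete x y b (matches y |y| rel))))
          (SatFrom-sequence α 0 (replicate N transition) (replicate-SatFrom α N 0 transition λ i lt →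
            subst (λ d → rawSat α (instantiate d transition) ≡ true) (sym (+-identityʳ i)) (transition-complete i
              (trans (rel (L + i) (+-monoʳ-< L lt)) (cong encCell (trans (u-step y |y| i)
                (cong₂ (λ a w → successor a (proj₁ w) (proj₂ w)) (sym (prev lt 0 (s≤s z≤n)))
                  (cong₂ _,_ (sym (prev lt 1 (s≤s (s≤s z≤n)))) (sym (prev lt 2 ≤-refl)))))))
              (trans (cong bad (trans (cong decCell (rel (L + i) (+-monoʳ-< L lt))) (decCell-encCell _))) (u-accept y |y| r (L + i) (+-monoʳ-< L lt)))))))
          where
            prev : ∀ {i} → i < N → ∀ k → k < 3 → decCell (cell α (k + i)) ≡ u y (k + i)
            prev {i} lt k k<3 = trans (cong decCell (rel (k + i) (+-mono-< (≤-trans k<3 2<L) lt))) (decCell-encCell _)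

        matches-unique : ∀ c y y' → length y ≡ length y' → Matches c (map bitCell y) → Matches c (map bitCell y') → y ≡ y'
        matches-unique c []      []       eq _        _          = refl
        matches-unique c (d ∷ y) (d' ∷ y') eq (m , ms) (m' , ms') =
          cong₂ _∷_ (bit d d' (encCell-injective (trans (sym m) m'))) (matches-unique (suc c) y y' (suc-injective eq) ms ms')
          where
            bit : ∀ d d' → bitCell d ≡ bitCell d' → d ≡ d'
            bit false false _ = refl
            bit true  true  _ = refl

        witness : ∀ y → length y ≡ P → (∀ c → c < L + N → cell α c ≡ encCell (u y c)) → Matches (length (opening x) + 0) (map bitCell y)
        witness y |y| rel = proj₁ (++-matches (length (opening x) + 0) (map bitCell y) (closing b) (proj₂ (++-matches 0 (opening x) (map bitCell y ++ closing b)
          (subst (Matches 0) (initialCells-pair x y b) (matches y |y| rel)))))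

      asg : Vec Bool n → ℕ → Bool
      asg a i = lookup a (i mod n)

      -- The cells below L + N comprise all n variables, so y determines the assignment. Conversely
      -- y can be read off the first row. These are the two injectivity properties needed for equal
      -- counts.
      Rel : Vec Bool n → Str → Set
      Rel a y = ∀ c → c < L + N → cell (asg a) c ≡ encCell (u y c)

      bitOf : Str → ℕ → Bool
      bitOf y i = lookup (encCell (u y (i / K))) (i mod K)

      assignment : Str → Vec Bool n
      assignment y = tabulate (bitOf y ∘ toℕ)

      slot< : ∀ {c} (k : Fin K) → c < L + N → toℕ k + c * K < n
      slot< {c} k lt = ≤-trans (+-monoˡ-< (c * K) (toℕ<n k)) (*-monoˡ-≤ K lt)

      slot-/ : ∀ c (k : Fin K) → (toℕ k + c * K) / K ≡ c
      slot-/ c k = trans (+-distrib-/-∣ʳ (toℕ k) (n∣m*n c)) (cong₂ _+_ (m<n⇒m/n≡0 (toℕ<n k)) (m*n/n≡m c K))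

      slot-mod : ∀ c (k : Fin K) → (toℕ k + c * K) mod K ≡ k
      slot-mod c k = toℕ-injective (trans (toℕ-fromℕ< (m%n<n (toℕ k + c * K) K))
        (trans ([m+kn]%n≡m%n (toℕ k) c K) (m<n⇒m%n≡m (toℕ<n k))))

      assignment-Rel : ∀ y → Rel (assignment y) y
      assignment-Rel y c lt = trans (VP.tabulate-cong λ k →
          trans (VP.lookup∘tabulate (bitOf y ∘ toℕ) ((toℕ k + c * K) mod n))
            (trans (cong (bitOf y) (toℕ-mod (slot< k lt)))
              (cong₂ (λ d j → lookup (encCell (u y d)) j) (slot-/ c k) (slot-mod c k))))
        (VP.tabulate∘lookup (encCell (u y c)))

      Rel-injˡ : ∀ {a a' y} → Rel a y → Rel a' y → a ≡ a'
      Rel-injˡ {a} {a'} {y} r r' = trans (sym (VP.tabulate∘lookup a)) (trans (VP.tabulate-cong same) (VP.tabulate∘lookup a'))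
        where
          same : ∀ i → lookup a i ≡ lookup a' i
          same i = trans (sym (at′ a)) (trans (cong (λ v → lookup v k) (trans (r c c<) (sym (r' c c<)))) (at′ a'))
            where
              c = toℕ i / K
              k = toℕ i mod K
              c< : c < L + N
              c< = m<n*o⇒m/o<n (toℕ<n i)
              whole : toℕ k + c * K ≡ toℕ i
              whole = trans (cong (_+ c * K) (toℕ-fromℕ< (m%n<n (toℕ i) K))) (sym (m≡m%n+[m/n]*n (toℕ i) K))
              at′ : ∀ a → lookup (cell (asg a) c) k ≡ lookup a i
              at′ a = trans (VP.lookup∘tabulate (λ k → asg a (toℕ k + c * K)) k)
                (cong (lookup a) (toℕ-injective (trans (cong (λ j → toℕ (j mod n)) whole) (toℕ-mod (toℕ<n i)))))

      Rel-injʳ : ∀ {a y y'} → length y ≡ P → length y' ≡ P → Rel a y → Rel a y' → y ≡ y'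
      Rel-injʳ {a} {y} {y'} |y| |y'| r r' = Assigned.matches-unique (asg a) _ y y' (trans |y| (sym |y'|))
        (Assigned.witness (asg a) y |y| r) (Assigned.witness (asg a) y' |y'| r')

    #sat-formula : #sat formula ≡ countWitnesses R P
    #sat-formula = count-bijection Rel (λ a → cnfSat a formula) R (unique-allAssignments n) (unique-allStrings P)
      (λ {a} _ sat → case Assigned.sound (asg a) (trans (sym (cnfSat-toCNF n a raw)) sat) of λ
        { (y , |y| , r , rel) → y , subst (λ p → y ∈ allStrings p) |y| (∈-allStrings y) , r , rel })
      (λ {y} y∈ r → assignment y , ∈-allAssignments _ ,
        trans (cnfSat-toCNF n (assignment y) raw) (Assigned.complete (asg (assignment y)) y (∈-allStrings⁻ P y∈) r (assignment-Rel y)) ,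
        assignment-Rel y)
      Rel-injˡ (λ {a} {y} {y'} y∈ y'∈ → Rel-injʳ {a} {y} {y'} (∈-allStrings⁻ P y∈) (∈-allStrings⁻ P y'∈))

    private
      BlockIn : ℕ → Block → Set
      BlockIn c B = ∀ {d} → d ∈ B → ∀ {l} → l ∈ d → index c (proj₁ l) < n

      instantiate-below : ∀ c B → BlockIn c B → Below n (instantiate c B)
      instantiate-below c B h d∈ l∈ with ∈-map⁻ (map (place c)) d∈
      ... | d , d∈' , refl with ∈-map⁻ (place c) l∈
      ... | l , l∈' , refl = h d∈' l∈'

      sequence-below : ∀ c Bs → (∀ i B → i < length Bs → B ∈ Bs → BlockIn (i + c) B) → Below n (sequence c Bs)
      sequence-below c (B ∷ Bs) h d∈ with ∈-++⁻ (instantiate c B) d∈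
      ... | inj₁ p = instantiate-below c B (h 0 B (s≤s z≤n) (here refl)) p
      ... | inj₂ p = sequence-below (suc c) Bs (λ i B' lt B∈ → subst (λ e → BlockIn e B') (sym (+-suc i c)) (h (suc i) B' (s≤s lt) (there B∈))) p

      near-below : ∀ d c → d + c < L + N → VAll.All (λ s → index c s < n) (near K d)
      near-below d c lt = VAllP.tabulate⁺ λ k → subst (_< n)
        (solve 4 (λ c K k d → k :+ (d :+ c) :* K := c :* K :+ (k :+ d :* K)) refl c K (toℕ k) d) (slot< k lt)
        where open +-*-Solver

      far-below : ∀ c → c < N → VAll.All (λ s → index c s < n) (far K)
      far-below c lt = VAllP.tabulate⁺ λ k → subst (_< n)
        (solve 4 (λ c K k L → k :+ (L :+ c) :* K := c :* K :+ (L :* K :+ k)) refl c K (toℕ k) L) (slot< k (+-monoʳ-< L lt))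
        where open +-*-Solver

      NearOnly : Block → Set
      NearOnly B = ∀ c → c < L + N → BlockIn c B

      forbid-near : ∀ G → NearOnly (forbid (near K 0) G)
      forbid-near G c lt = forbid-slots (near K 0) G (near-below 0 c lt)

      initialBlocks-near : ∀ {B} → B ∈ initialBlocks x P b → NearOnly B
      initialBlocks-near B∈ with ∈-++⁻ (map exactly (opening x)) B∈
      ... | inj₁ p = case ∈-map⁻ exactly p of λ { (a , _ , refl) → forbid-near _ }
      ... | inj₂ p with ∈-++⁻ (replicate P free) p
      ...   | inj₁ q = subst NearOnly (sym (∈-replicate P q)) (forbid-near _)
      ...   | inj₂ q = case ∈-map⁻ exactly q of λ { (a , _ , refl) → forbid-near _ }

      length-initialBlocks : length (initialBlocks x P b) ≡ L
      -- Only the length of y matters here, so the string of P zeros stands in for it and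
      -- `length-initial` applies.
      length-initialBlocks = trans (length-++ (map exactly (opening x))) (trans (cong₂ _+_ (length-map exactly (opening x))
          (trans (length-++ (replicate P free)) (cong₂ _+_ (trans (length-replicate P) (sym (trans (length-map bitCell (replicate P false)) (length-replicate P)))) (length-map exactly (closing b)))))
        (trans (cong (length (opening x) +_) (sym (length-++ (map bitCell (replicate P false)))))
          (trans (sym (length-++ (opening x))) (trans (cong length (sym (initialCells-pair x (replicate P false) b))) (length-initial (replicate P false) (length-replicate P))))))

      transition-below : ∀ c → c < N → BlockIn c transition
      transition-below c lt = forbid-slots window lawfulWindow
        (VAllP.++⁺ (near-below 0 c (within 0 (s≤s z≤n))) (VAllP.++⁺ (near-below 1 c (within 1 (s≤s (s≤s z≤n))))
          (VAllP.++⁺ (near-below 2 c (within 2 ≤-refl)) (far-below c lt))))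
        where
          within : ∀ k → k < 3 → k + c < L + N
          within k k<3 = +-mono-< (≤-trans k<3 2<L) lt

    -- This bound makes the reduction modulo n harmless, so that the raw clauses written by the
    -- machine are literally the code of `formula`.
    raw-below : Below n raw
    raw-below d∈ with ∈-++⁻ (sequence 0 (initialBlocks x P b)) d∈
    ... | inj₁ p = sequence-below 0 (initialBlocks x P b) (λ i B lt B∈ → initialBlocks-near B∈ (i + 0)
          (subst (_< L + N) (sym (+-identityʳ i)) (≤-trans (subst (i <_) length-initialBlocks lt) (m≤m+n L N)))) p
    ... | inj₂ p = sequence-below 0 (replicate N transition) (λ i B lt B∈ → subst (BlockIn (i + 0)) (sym (∈-replicate N B∈))
          (transition-below (i + 0) (subst₂ _<_ (sym (+-identityʳ i)) (length-replicate N) lt))) p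

    encCNF-formula : encCNF formula ≡ encNat n ++ concatMap encRawClause raw
    encCNF-formula = encCNF-toCNF n raw raw-below

-- The reduction in polynomial time

enc : RawCNF → Str
enc = concatMap encRawClause

replicate-+ : ∀ {A : Set} m n {a : A} → replicate m a ++ replicate n a ≡ replicate (m + n) a
replicate-+ zero    n = refl
replicate-+ (suc m) n = cong (_ ∷_) (replicate-+ m n)

-- Pieces are appended on the right, which is the output of a loop after its first n rounds.
concatBelow : ∀ {A : Set} → ℕ → (ℕ → List A) → List A
concatBelow zero    f = []
concatBelow (suc n) f = concatBelow n f ++ f n

concatBelow-suc : ∀ {A : Set} n (f : ℕ → List A) → concatBelow (suc n) f ≡ f 0 ++ concatBelow n (f ∘ suc)
concatBelow-suc zero    f = sym (++-identityʳ (f 0))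
concatBelow-suc (suc n) f = trans (cong (_++ f (suc n)) (concatBelow-suc n f)) (++-assoc (f 0) _ _)

concatBelow-replicate : ∀ {A : Set} n (a : A) → concatBelow n (λ _ → a ∷ []) ≡ replicate n a
concatBelow-replicate zero    a = refl
concatBelow-replicate (suc n) a = trans (concatBelow-suc n (λ _ → a ∷ [])) (cong (a ∷_) (concatBelow-replicate n a))

concatBelow-concatMap : ∀ {A : Set} (g : Bool → List A) x → concatBelow (length x) (g ∘ bitAt x) ≡ concatMap g x
concatBelow-concatMap g []      = refl
concatBelow-concatMap g (b ∷ x) = trans (concatBelow-suc (length x) (g ∘ bitAt (b ∷ x))) (cong (g b ++_) (concatBelow-concatMap g x))

double≤ : ∀ n → double n ≤ n + n
double≤ zero    = z≤n
double≤ (suc n) = s≤s (≤-trans (s≤s (double≤ n)) (≤-reflexive (sym (+-suc n n))))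

module Generator (K : ℕ) (first last blank open-bit : Block) (bit : Bool → Block) (law : Block) (p q : Poly)
  (e : ℕ) (toFin : Vec Bool 15 → Fin e) (fromFin : Fin e → Vec Bool 15) (fromFin-toFin : ∀ v → fromFin (toFin v) ≡ v) where

  open Complete 10 e toFin fromFin fromFin-toFin public

  cI cJ cT cA cR cP cC cL cN cB : Counter
  cI = suc zero
  cJ = suc (suc zero)
  cT = suc (suc (suc zero))
  cA = suc (suc (suc (suc zero)))
  cR = suc (suc (suc (suc (suc zero))))
  cP = suc (suc (suc (suc (suc (suc zero)))))
  cC = suc (suc (suc (suc (suc (suc (suc zero))))))
  cL = suc (suc (suc (suc (suc (suc (suc (suc zero)))))))
  cN = suc (suc (suc (suc (suc (suc (suc (suc (suc zero))))))))
  cB = suc (suc (suc (suc (suc (suc (suc (suc (suc (suc zero)))))))))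

  regs : (n i j t a r P c l N b : ℕ) → Vec ℕ 11
  regs n i j t a r P c l N b = n ∷ i ∷ j ∷ t ∷ a ∷ r ∷ P ∷ c ∷ l ∷ N ∷ b ∷ []

  <ᵇ-irrefl : ∀ n → (n <ᵇ n) ≡ false
  <ᵇ-irrefl n = <ᵇ-false {n} ≤-refl

  incs : ℕ → Counter → LoopFree
  incs zero    i = skip
  incs (suc k) i = incs k i ▹ inc i

  emits : Str → LoopFree
  emits []      = skip
  emits (b ∷ w) = emit b ▹ emits w

  exec-emits : ∀ z w v o → exec z (emits w) (v , o) ≡ (v , o ++ w)
  exec-emits z []      v o = cong (v ,_) (sym (++-identityʳ o))
  exec-emits z (b ∷ w) v o = trans (exec-emits z w v (o ++ b ∷ [])) (cong (v ,_) (++-assoc o (b ∷ []) w))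

  tri-emits : ∀ {z} w v o → Tri z (cost (emits w)) (v , o) ⟦ emits w ⟧ (v , o ++ w)
  tri-emits w v o = tri-exec (emits w) (exec-emits _ w v o)

  tri-out : ∀ {z d s P v o o'} → o ≡ o' → Tri z d s P (v , o) → Tri z d s P (v , o')
  tri-out refl t = t

  -- Horner's rule at cA, with result in cR.
  poly : Poly → Prog
  poly []       = ⟦ skip ⟧
  poly (k ∷ cs) = poly cs ⨾ for cI (suc cA) (for cJ (suc cR) ⟦ inc cT ⟧) ⨾ ⟦ copy cR (suc cT) ▹ reset cT ▹ incs k cR ⟧

  polyCost : Poly → ℕ → ℕ
  polyCost []       a = 1
  polyCost (k ∷ cs) a = polyCost cs a + (loopCost a (loopCost (evalPoly cs a) 1) + (1 + (1 + cost (incs k cR))))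

  tri-poly : ∀ {z} cs n a P c l N b o →
    Tri z (polyCost cs a) (regs n 0 0 0 a 0 P c l N b , o) (poly cs) (regs n 0 0 0 a (evalPoly cs a) P c l N b , o)
  tri-poly []       n a P c l N b o = tri-exec skip refl
  tri-poly {z} (k ∷ cs) n a P c l N b o = tri-seq (tri-poly cs n a P c l N b o) (tri-seq
    (tri-for cI (suc cA) (λ m → regs n m 0 (m * r) a r P c l N b , o) (λ m → regs n m 0 (suc m * r) a r P c l N b , o) a
      (λ m lt → <ᵇ-true lt) (<ᵇ-irrefl a)
      (λ m _ → tri-for cJ (suc cR) (λ j → regs n m j (j + m * r) a r P c l N b , o) (λ j → regs n m j (suc j + m * r) a r P c l N b , o) r
        (λ j lt → <ᵇ-true lt) (<ᵇ-irrefl r) (λ j _ → tri-exec (inc cT) refl) (λ _ _ → refl) refl)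
      (λ _ _ → refl) refl)
    (tri-exec (copy cR (suc cT) ▹ reset cT ▹ incs k cR) (exec-incs k (a * r))))
    where
      r = evalPoly cs a
      exec-incs : ∀ k r → exec z (incs k cR) (regs n 0 0 0 a r P c l N b , o) ≡ (regs n 0 0 0 a (k + r) P c l N b , o)
      exec-incs zero    r = refl
      exec-incs (suc k) r = cong (exec z (inc cR)) (exec-incs k r)

  -- K is a constant of the program. Multiplication by it therefore takes no counter: each round
  -- emits K ones.
  unary : Bound → Prog
  unary b = for cJ b ⟦ emits (replicate K true) ⟧

  unaryCost : ℕ → ℕ
  unaryCost n = loopCost n (cost (emits (replicate K true)))

  -- The vector `f m` is the register contents with m in `cJ`. The four conditions say just this,
  -- and at each use they hold by computation because the registers are written out.
  tri-unary : ∀ {z} b (f : ℕ → Vec ℕ 11) n → (∀ m → lookup (f m) cJ ≡ m) → (∀ m → value (f m) b ≡ n) →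
    (∀ m → V.updateAt (f m) cJ suc ≡ f (suc m)) → (∀ m → f m [ cJ ]≔ 0 ≡ f 0) →
    ∀ o → Tri z (unaryCost n) (f 0 , o) (unary b) (f 0 , o ++ replicate (n * K) true)
  tri-unary {z} b f n fJ fb fs fr o = subst (λ w → Tri z (unaryCost n) (f 0 , w) (unary b) (f 0 , o ++ replicate (n * K) true)) (++-identityʳ o)
    (tri-for cJ b (λ m → f m , o ++ replicate (m * K) true) (λ m → f m , o ++ replicate (suc m * K) true) n
    (λ m lt → trans (cong₂ _<ᵇ_ (fJ m) (fb m)) (<ᵇ-true lt)) (trans (cong₂ _<ᵇ_ (fJ n) (fb n)) (<ᵇ-irrefl n))
    (λ m _ → tri-out (trans (++-assoc o _ _) (cong (o ++_) (trans (replicate-+ (m * K) K) (cong (λ k → replicate k true) (+-comm (m * K) K)))))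
      (tri-emits (replicate K true) (f m) (o ++ replicate (m * K) true)))
    (λ m _ → cong (_, o ++ replicate (suc m * K) true) (fs m)) (cong (_, o ++ replicate (n * K) true) (fr n)))

  literal : Slot × Bool → Prog
  literal ((far , o) , s) = ⟦ emit s ⟧ ⨾ unary (suc cC) ⨾ (if far then unary (suc cL) else ⟦ skip ⟧) ⨾ ⟦ emits (encNat o) ⟧

  literals : List (Slot × Bool) → Prog
  literals []      = ⟦ skip ⟧
  literals (l ∷ d) = literal l ⨾ literals d

  block : Block → Prog
  block []      = ⟦ skip ⟧
  block (d ∷ B) = (⟦ emits (encNat (length d)) ⟧ ⨾ literals d) ⨾ block B

  literalCost : Slot × Bool → ℕ → ℕ
  literalCost ((far , o) , s) m = 1 + (unaryCost m + ((if far then unaryCost m else 1) + cost (emits (encNat o))))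

  literalsCost : List (Slot × Bool) → ℕ → ℕ
  literalsCost []      m = 1
  literalsCost (l ∷ d) m = literalCost l m + literalsCost d m

  blockCost : Block → ℕ → ℕ
  blockCost []      m = 1
  blockCost (d ∷ B) m = (cost (emits (encNat (length d))) + literalsCost d m) + blockCost B m

  single : Block → Prog
  single B = block B ⨾ ⟦ inc cC ⟧

  singleCost : Block → ℕ → ℕ
  singleCost B m = blockCost B m + 1

  pairOf : Bool → List Block
  pairOf d = bit d ∷ bit d ∷ []

  twice : Bool → Prog
  twice d = single (bit d) ⨾ single (bit d)

  twiceCost : Bool → ℕ → ℕ
  twiceCost d m = singleCost (bit d) m + singleCost (bit d) m

  branch : Prog
  branch = seek ℓ (track (suc cI)) ⨾ ifT (λ v → lookup v zero) (twice true) (twice false)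

  branchCost : ℕ → ℕ
  branchCost m = 1 + (twiceCost true m + twiceCost false m)

  initialProg : Prog
  initialProg = single first ⨾ for cI (suc zero) branch ⨾ (single (bit false) ⨾ single (bit true)) ⨾
                for cI (suc cP) (single open-bit) ⨾ for cI (suc cB) (single blank) ⨾ single last

  initialCost : (n P b m : ℕ) → ℕ
  initialCost n P b m = singleCost first m + (loopCost n (branchCost m) +
    ((singleCost (bit false) m + singleCost (bit true) m) + (loopCost P (singleCost open-bit m) +
    (loopCost b (singleCost blank m) + singleCost last m))))

  -- Each block advances `cC`, so the cell number itself is the loop variable. It restarts at 0,
  -- because the law placed at cell c constrains the cells c, c + 1, c + 2 and c + L.
  laws : Prog
  laws = whileLt cC (suc cN) (single law)

  lawsCost : (N m : ℕ) → ℕ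
  lawsCost N m = 1 + N * suc (singleCost law m)

  module Writing (z : Str) (n a r P l N b m : ℕ) (l≤m : l ≤ m) where
    open Blocks K l

    state : ℕ → ℕ → Vec ℕ 11
    state i c = regs n i 0 0 a r P c l N b

    tri-literal : ∀ i c → c ≤ m → ∀ x o →
      Tri z (literalCost x m) (state i c , o) (literal x) (state i c , o ++ encRawLit (place c x))
    tri-literal i c c≤m ((far , k) , s) o = tri-out out
      (tri-seq (tri-exec (emit s) refl) (tri-seq
        (tri-weaken (loopCost-mono c≤m) (tri-unary (suc cC) (λ j → regs n i j 0 a r P c l N b) c (λ _ → refl) (λ _ → refl) (λ _ → refl) (λ _ → refl) _))
        (tri-seq (lagging far _) (tri-emits (encNat k) (state i c) _))))
      where
        lagging : ∀ far o → Tri z (if far then unaryCost m else 1) (state i c , o) (if far then unary (suc cL) else ⟦ skip ⟧)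
                    (state i c , o ++ replicate (lag far) true)
        lagging true  o = tri-weaken (loopCost-mono l≤m) (tri-unary (suc cL) (λ j → regs n i j 0 a r P c l N b) l (λ _ → refl) (λ _ → refl) (λ _ → refl) (λ _ → refl) o)
        lagging false o = tri-exec skip (cong (state i c ,_) (sym (++-identityʳ o)))
        out : (((o ++ s ∷ []) ++ replicate (c * K) true) ++ replicate (lag far) true) ++ encNat k ≡ o ++ s ∷ encNat (c * K + (lag far + k))
        out = trans (++-assoc (((o ++ s ∷ []) ++ replicate (c * K) true)) _ _) (trans (++-assoc (o ++ s ∷ []) _ _) (trans (++-assoc o _ _)
          (cong (λ w → o ++ s ∷ w) (trans (cong (replicate (c * K) true ++_) (trans (sym (++-assoc (replicate (lag far) true) _ _)) (cong (_++ false ∷ []) (replicate-+ (lag far) k))))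
            (trans (sym (++-assoc (replicate (c * K) true) _ _)) (cong (_++ false ∷ []) (replicate-+ (c * K) (lag far + k))))))))

    tri-literals : ∀ i c → c ≤ m → ∀ d o →
      Tri z (literalsCost d m) (state i c , o) (literals d) (state i c , o ++ concatMap encRawLit (map (place c) d))
    tri-literals i c c≤m []      o = tri-exec skip (cong (state i c ,_) (sym (++-identityʳ o)))
    tri-literals i c c≤m (x ∷ d) o = tri-out (++-assoc o _ _) (tri-seq (tri-literal i c c≤m x o) (tri-literals i c c≤m d _))

    tri-block : ∀ i c → c ≤ m → ∀ B o →
      Tri z (blockCost B m) (state i c , o) (block B) (state i c , o ++ enc (instantiate c B))
    tri-block i c c≤m []      o = tri-exec skip (cong (state i c ,_) (sym (++-identityʳ o)))
    tri-block i c c≤m (d ∷ B) o = tri-out out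
      (tri-seq (tri-seq (tri-emits (encNat (length d)) (state i c) o) (tri-literals i c c≤m d _)) (tri-block i c c≤m B _))
      where
        out : ((o ++ encNat (length d)) ++ concatMap encRawLit (map (place c) d)) ++ enc (instantiate c B) ≡ o ++ enc (instantiate c (d ∷ B))
        out = trans (++-assoc (o ++ encNat (length d)) _ _) (trans (++-assoc o _ _) (cong (o ++_)
          (trans (cong (λ k → encNat k ++ concatMap encRawLit (map (place c) d) ++ enc (instantiate c B)) (sym (length-map (place c) d)))
            (sym (++-assoc (encNat (length (map (place c) d))) _ _)))))

    -- The program S, run while the outer loop counter is i, writes the instances of Bs.
    record Writes (i d : ℕ) (S : Prog) (Bs : List Block) : Set where
      constructor writes
      field
        from : ∀ c o → length Bs + c ≤ m →
               Tri z d (state i c , o) S (state i (length Bs + c) , o ++ enc (sequence c Bs))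

    open Writes

    enc-sequence-++ : ∀ c o As Bs → (o ++ enc (sequence c As)) ++ enc (sequence (length As + c) Bs) ≡ o ++ enc (sequence c (As ++ Bs))
    enc-sequence-++ c o As Bs = trans (++-assoc o _ _) (cong (o ++_) (trans (sym (concatMap-++ encRawClause (sequence c As) _))
      (cong enc (sym (sequence-++ c As Bs)))))

    length-shift : ∀ (As Bs : List Block) c → length Bs + (length As + c) ≡ length (As ++ Bs) + c
    length-shift As Bs c = trans (sym (+-assoc (length Bs) (length As) c)) (cong (_+ c) (trans (+-comm (length Bs) (length As)) (sym (length-++ As))))

    writes-single : ∀ i B → Writes i (singleCost B m) (single B) (B ∷ [])
    writes-single i B .from c o le = tri-out (cong (λ w → o ++ enc w) (sym (++-identityʳ (instantiate c B))))
      (tri-seq (tri-block i c (<⇒≤ le) B o) (tri-exec (inc cC) refl))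

    writes-seq : ∀ {i d d' S S'} As Bs → Writes i d S As → Writes i d' S' Bs → Writes i (d + d') (S ⨾ S') (As ++ Bs)
    writes-seq {i} {d} {d'} {S} {S'} As Bs s s' .from c o le = tri-out (enc-sequence-++ c o As Bs)
      (subst (λ k → Tri z (d + d') (state i c , o) (S ⨾ S') (state i k , (o ++ enc (sequence c As)) ++ enc (sequence (length As + c) Bs))) (length-shift As Bs c)
        (tri-seq (from s c o (≤-trans (≤-trans (m≤n+m (length As + c) (length Bs)) (≤-reflexive (length-shift As Bs c))) le))
                 (from s' (length As + c) _ (≤-trans (≤-reflexive (length-shift As Bs c)) le))))

    writes-for : ∀ {d S} β k (Bs : ℕ → List Block) → (∀ i c → value (state i c) β ≡ k) →
      (∀ i → i < k → Writes i d S (Bs i)) → Writes 0 (loopCost k d) (for cI β S) (concatBelow k Bs)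
    writes-for {d} {S} β k Bs β≡ w .from c o le = subst (λ u → Tri z (loopCost k d) (state 0 c , u) (for cI β S) (state 0 (length (concatBelow k Bs) + c) , o ++ enc (sequence c (concatBelow k Bs))))
      (++-identityʳ o)
      (tri-for cI β (λ i → at′ i i) (λ i → at′ i (suc i)) k
        (λ i lt → trans (cong (i <ᵇ_) (β≡ i _)) (<ᵇ-true lt)) (trans (cong (k <ᵇ_) (β≡ k _)) (<ᵇ-irrefl k))
        (λ i lt → tri-out (enc-sequence-++ c o (concatBelow i Bs) (Bs i))
          (subst (λ u → Tri z d (at′ i i) S (state i u , (o ++ enc (sequence c (concatBelow i Bs))) ++ enc (sequence (length (concatBelow i Bs) + c) (Bs i))))
            (length-shift (concatBelow i Bs) (Bs i) c)
            (from (w i lt) (length (concatBelow i Bs) + c) _ (≤-trans (≤-reflexive (length-shift (concatBelow i Bs) (Bs i) c)) (≤-trans (+-monoˡ-≤ c (prefix≤ lt)) le)))))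
        (λ _ _ → refl) refl)
      where
        at′ : ℕ → ℕ → St
        at′ i j = state i (length (concatBelow j Bs) + c) , o ++ enc (sequence c (concatBelow j Bs))
        -- The cost of a block was bounded through m, so the cell numbers reached between the rounds
        -- must stay within m too.
        prefix≤ : ∀ {i j} → i < j → length (concatBelow (suc i) Bs) ≤ length (concatBelow j Bs)
        prefix≤ {i} {suc j} (s≤s le) with m≤n⇒m<n∨m≡n le
        ... | inj₁ lt   = ≤-trans (prefix≤ lt) (≤-trans (m≤m+n _ _) (≤-reflexive (sym (length-++ (concatBelow j Bs)))))
        ... | inj₂ refl = ≤-refl

    writes-branch : ∀ i → Writes i (branchCost m) branch (pairOf (bitAt z i))
    writes-branch i .from c o le = tri-branch cI (λ v → lookup v zero) (bitAt z i) refl (from (alternatives (bitAt z i)) c o le)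
      where
        alternatives : ∀ d → Writes i (twiceCost true m + twiceCost false m) (if d then twice true else twice false) (pairOf d)
        alternatives true  .from c o le = tri-weaken (m≤m+n (twiceCost true m) (twiceCost false m))
          (from (writes-seq (bit true ∷ []) (bit true ∷ []) (writes-single i (bit true)) (writes-single i (bit true))) c o le)
        alternatives false .from c o le = tri-weaken (m≤n+m (twiceCost false m) (twiceCost true m))
          (from (writes-seq (bit false ∷ []) (bit false ∷ []) (writes-single i (bit false)) (writes-single i (bit false))) c o le)

    written : List Block
    written = (first ∷ []) ++ concatBelow n (pairOf ∘ bitAt z) ++ ((bit false ∷ []) ++ (bit true ∷ [])) ++
              concatBelow P (λ _ → open-bit ∷ []) ++ concatBelow b (λ _ → blank ∷ []) ++ (last ∷ [])

    writes-initial : Writes 0 (initialCost n P b m) initialProg written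
    writes-initial = writes-seq (first ∷ []) _ (writes-single 0 first)
      (writes-seq (concatBelow n (pairOf ∘ bitAt z)) _
        (writes-for (suc zero) n (pairOf ∘ bitAt z) (λ _ _ → refl) (λ i _ → writes-branch i))
      (writes-seq ((bit false ∷ []) ++ (bit true ∷ [])) _
        (writes-seq (bit false ∷ []) (bit true ∷ []) (writes-single 0 (bit false)) (writes-single 0 (bit true)))
      (writes-seq (concatBelow P (λ _ → open-bit ∷ [])) _
        (writes-for (suc cP) P (λ _ → open-bit ∷ []) (λ _ _ → refl) (λ i _ → writes-single i open-bit))
      (writes-seq (concatBelow b (λ _ → blank ∷ [])) (last ∷ [])
        (writes-for (suc cB) b (λ _ → blank ∷ []) (λ _ _ → refl) (λ i _ → writes-single i blank))
        (writes-single 0 last)))))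

    tri-laws : N ≤ m → ∀ o → Tri z (lawsCost N m) (state 0 0 , o) laws
                 (state 0 N , o ++ enc (sequence 0 (replicate N law)))
    tri-laws N≤m o = subst₂ (λ u v → Tri z (lawsCost N m) (state 0 0 , u) laws (state 0 N , o ++ enc (sequence 0 v))) (++-identityʳ o) (concatBelow-replicate N law)
      (tri-while cC (suc cN) (λ k → state 0 k , o ++ enc (sequence 0 (Ls k))) N
        (λ k lt → <ᵇ-true lt , tri-out (trans (cong (λ c → (o ++ enc (sequence 0 (Ls k))) ++ enc (sequence c (law ∷ []))) (sym (len k)))
            (enc-sequence-++ 0 o (Ls k) (law ∷ []))) (from (writes-single 0 law) k _ (≤-trans lt N≤m)))
        (<ᵇ-irrefl N))
      where
        Ls : ℕ → List Block
        Ls k = concatBelow k (λ _ → law ∷ [])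
        len : ∀ k → length (Ls k) + 0 ≡ k
        len k = trans (+-identityʳ _) (trans (cong length (concatBelow-replicate k law)) (length-replicate k))

  -- The sizes of `Formula` as functions of the input length: `D` is the length of the pair given to
  -- the verifier, T its time bound. The number `span` is a generous bound for every cell number
  -- that occurs during writing.
  P D T b W L N initialLength span : ℕ → ℕ
  P n = evalPoly p n
  D n = P n + (2 + double n)
  T n = evalPoly q (D n)
  b n = T n + 4
  W n = suc (D n + b n)
  L n = suc (W n)
  N n = (T n + 2) * W n
  initialLength n = suc (double n + (2 + (P n + (b n + 1))))
  span n = initialLength n + (L n + N n)

  -- The register `cL` holds W while `cN` collects (T + 2) * W, and only the last increment turns it
  -- into L.
  setup : Prog
  setup = ⟦ copy cA (suc zero) ⟧ ⨾ poly p ⨾ ⟦ copy cP (suc cR) ▹ reset cR ▹ reset cA ⟧ ⨾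
          for cI (suc zero) ⟦ inc cA ▹ inc cA ⟧ ⨾ ⟦ inc cA ▹ inc cA ⟧ ⨾ for cI (suc cP) ⟦ inc cA ⟧ ⨾ poly q ⨾
          ⟦ copy cB (suc cR) ▹ incs 4 cB ⟧ ⨾ ⟦ copy cL (suc cB) ⟧ ⨾ for cI (suc cA) ⟦ inc cL ⟧ ⨾
          ⟦ inc cL ▹ inc cR ▹ inc cR ⟧ ⨾ for cI (suc cR) (for cJ (suc cL) ⟦ inc cN ⟧) ⨾ ⟦ inc cL ⟧

  setupCost : ℕ → ℕ
  setupCost n = 1 + (polyCost p n + (3 + (loopCost n 2 + (2 + (loopCost (P n) 1 + (polyCost q (D n) +
    (6 + (1 + (loopCost (D n) 1 + (3 + (loopCost (T n + 2) (loopCost (W n) 1) + 1)))))))))))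

  tri-setup : ∀ z → let n = length z in
    Tri z (setupCost n) (start z) setup (regs n 0 0 0 (D n) (T n + 2) (P n) 0 (L n) (N n) (b n) , [])
  tri-setup z = tri-seq (tri-exec (copy cA (suc zero)) refl) (tri-seq (tri-poly p n n 0 0 0 0 0 [])
    (tri-seq (tri-exec {s' = regs n 0 0 0 0 0 (P n) 0 0 0 0 , []} (copy cP (suc cR) ▹ reset cR ▹ reset cA) refl) (tri-seq
    (tri-for cI (suc zero) (λ i → regs n i 0 0 (double i) 0 (P n) 0 0 0 0 , []) (λ i → regs n i 0 0 (double (suc i)) 0 (P n) 0 0 0 0 , []) n
      (λ _ → <ᵇ-true) (<ᵇ-irrefl n) (λ _ _ → tri-exec (inc cA ▹ inc cA) refl) (λ _ _ → refl) refl) (tri-seq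
    (tri-exec (inc cA ▹ inc cA) refl) (tri-seq
    (tri-for cI (suc cP) (λ i → regs n i 0 0 (i + (2 + double n)) 0 (P n) 0 0 0 0 , []) (λ i → regs n i 0 0 (suc i + (2 + double n)) 0 (P n) 0 0 0 0 , []) (P n)
      (λ _ → <ᵇ-true) (<ᵇ-irrefl (P n)) (λ _ _ → tri-exec (inc cA) refl) (λ _ _ → refl) refl) (tri-seq
    (tri-poly q n (D n) (P n) 0 0 0 0 []) (tri-seq
    (tri-exec (copy cB (suc cR) ▹ incs 4 cB) (cong (λ k → regs n 0 0 0 (D n) (T n) (P n) 0 0 0 k , []) (+-comm 4 (T n)))) (tri-seq
    (tri-exec (copy cL (suc cB)) refl) (tri-seq
    (tri-for cI (suc cA) (λ i → regs n i 0 0 (D n) (T n) (P n) 0 (i + b n) 0 (b n) , []) (λ i → regs n i 0 0 (D n) (T n) (P n) 0 (suc i + b n) 0 (b n) , []) (D n)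
      (λ _ → <ᵇ-true) (<ᵇ-irrefl (D n)) (λ _ _ → tri-exec (inc cL) refl) (λ _ _ → refl) refl) (tri-seq
    (tri-exec (inc cL ▹ inc cR ▹ inc cR) (cong (λ k → regs n 0 0 0 (D n) k (P n) 0 (W n) 0 (b n) , []) (+-comm 2 (T n)))) (tri-seq
    (tri-for cI (suc cR) (λ i → regs n i 0 0 (D n) (T n + 2) (P n) 0 (W n) (i * W n) (b n) , [])
      (λ i → regs n i 0 0 (D n) (T n + 2) (P n) 0 (W n) (suc i * W n) (b n) , []) (T n + 2)
      (λ _ → <ᵇ-true) (<ᵇ-irrefl (T n + 2))
      (λ i _ → tri-for cJ (suc cL) (λ j → regs n i j 0 (D n) (T n + 2) (P n) 0 (W n) (j + i * W n) (b n) , [])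
        (λ j → regs n i j 0 (D n) (T n + 2) (P n) 0 (W n) (suc j + i * W n) (b n) , []) (W n)
        (λ _ → <ᵇ-true) (<ᵇ-irrefl (W n)) (λ _ _ → tri-exec (inc cN) refl) (λ _ _ → refl) refl)
      (λ _ _ → refl) refl)
    (tri-exec (inc cL) refl))))))))))))
    where n = length z

  -- The header is written as two runs of ones for L and for N, which join to the unary code of (L +
  -- N) * K; the sum itself is never computed.
  generate : Prog
  generate = setup ⨾ unary (suc cL) ⨾ unary (suc cN) ⨾ ⟦ emit false ⟧ ⨾ initialProg ⨾ ⟦ reset cC ⟧ ⨾ laws

  generateCost : ℕ → ℕ
  generateCost n = setupCost n + (unaryCost (L n) + (unaryCost (N n) + (1 + (initialCost n (P n) (b n) (span n) +
    (1 + lawsCost (N n) (span n))))))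

  initialBlocks′ : Str → List Block
  initialBlocks′ x = (first ∷ concatMap pairOf x ++ bit false ∷ bit true ∷ []) ++
    replicate (P (length x)) open-bit ++ replicate (b (length x)) blank ++ last ∷ []

  generated : Str → Str
  generated x = encNat ((L n + N n) * K) ++ enc (sequence 0 (initialBlocks′ x) ++ sequence 0 (replicate (N n) law))
    where
      n = length x
      open Blocks K (L n)

  tri-generate : ∀ x → Σ (Vec ℕ 11) λ v → Tri x (generateCost (length x)) (start x) generate (v , generated x)
  tri-generate x = state 0 (N n) , tri-out out
    (tri-seq (tri-setup x)
    (tri-seq (tri-unary (suc cL) (λ j → regs n 0 j 0 (D n) (T n + 2) (P n) 0 (L n) (N n) (b n)) (L n) (λ _ → refl) (λ _ → refl) (λ _ → refl) (λ _ → refl) [])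
    (tri-seq (tri-unary (suc cN) (λ j → regs n 0 j 0 (D n) (T n + 2) (P n) 0 (L n) (N n) (b n)) (N n) (λ _ → refl) (λ _ → refl) (λ _ → refl) (λ _ → refl) _)
    (tri-seq (tri-exec (emit false) refl)
    (tri-seq (Writes.from writes-initial 0 header (≤-trans (≤-reflexive (trans (+-identityʳ _) length-written)) (m≤m+n (initialLength n) (L n + N n))))
    (tri-seq (tri-exec {s' = state 0 0 , header ++ enc (sequence 0 written)} (reset cC) refl)
             (tri-laws (≤-trans (m≤n+m (N n) (L n)) (m≤n+m (L n + N n) (initialLength n))) (header ++ enc (sequence 0 written)))))))))
    where
      n = length x
      open Blocks K (L n)
      open Writing x n (D n) (T n + 2) (P n) (L n) (N n) (b n) (span n) (≤-trans (m≤m+n (L n) (N n)) (m≤n+m (L n + N n) (initialLength n)))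
      header : Str
      header = (replicate (L n * K) true ++ replicate (N n * K) true) ++ false ∷ []
      header≡ : header ≡ encNat ((L n + N n) * K)
      header≡ = cong (_++ false ∷ []) (trans (replicate-+ (L n * K) (N n * K)) (cong (λ k → replicate k true) (sym (*-distribʳ-+ K (L n) (N n)))))
      written≡ : written ≡ initialBlocks′ x
      written≡ = cong (first ∷_) (trans (cong₂ _++_ (concatBelow-concatMap pairOf x)
          (cong (λ Bs → bit false ∷ bit true ∷ Bs) (cong₂ _++_ (concatBelow-replicate (P n) open-bit) (cong (_++ last ∷ []) (concatBelow-replicate (b n) blank)))))
        (sym (++-assoc (concatMap pairOf x) (bit false ∷ bit true ∷ []) _)))
      length-pairs : ∀ x → length (concatMap pairOf x) ≡ double (length x)
      length-pairs []      = refl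
      length-pairs (_ ∷ x) = cong (2 +_) (length-pairs x)
      length-written : length written ≡ initialLength n
      length-written = cong suc (trans (length-++ (concatBelow n (pairOf ∘ bitAt x))) (cong₂ _+_ (trans (cong length (concatBelow-concatMap pairOf x)) (length-pairs x))
        (cong (2 +_) (trans (length-++ (concatBelow (P n) (λ _ → open-bit ∷ []))) (cong₂ _+_ (trans (cong length (concatBelow-replicate (P n) open-bit)) (length-replicate (P n)))
          (trans (length-++ (concatBelow (b n) (λ _ → blank ∷ []))) (cong (_+ 1) (trans (cong length (concatBelow-replicate (b n) blank)) (length-replicate (b n))))))))))
      out : (header ++ enc (sequence 0 written)) ++ enc (sequence 0 (replicate (N n) law)) ≡ generated x
      out = trans (++-assoc header _ _) (cong₂ _++_ header≡ (trans (sym (concatMap-++ encRawClause (sequence 0 written) _))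
        (cong (λ Bs → enc (sequence 0 Bs ++ sequence 0 (replicate (N n) law))) written≡)))

  -- Polynomial bounds for the generator

  module _ {f : ℕ → ℕ} (pf : PolyBounded f) where

    pb-suc : PolyBounded (λ n → suc (f n))
    pb-suc = pb-+ (pb-const 1) pf

    pb-loop : ∀ {g} → PolyBounded g → PolyBounded (λ n → loopCost (f n) (g n))
    pb-loop pg = pb-+ (pb-+ (pb-const 1) (pb-* pf (pb-+ (pb-const 1) (pb-+ pg (pb-const 1))))) (pb-const 1)

    pb-unary : PolyBounded (λ n → unaryCost (f n))
    pb-unary = pb-loop (pb-const _)

  pb-polyCost : ∀ cs {f} → PolyBounded f → PolyBounded (λ n → polyCost cs (f n))
  pb-polyCost []       pf = pb-const 1
  pb-polyCost (k ∷ cs) pf = pb-+ (pb-polyCost cs pf) (pb-+ (pb-loop pf (pb-loop (pb-eval cs pf) (pb-const 1))) (pb-const _))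

  pb-literals : ∀ d {f} → PolyBounded f → PolyBounded (λ n → literalsCost d (f n))
  pb-literals []                       pf = pb-const 1
  pb-literals (((false , o) , s) ∷ d) pf = pb-+ (pb-+ (pb-const 1) (pb-+ (pb-unary pf) (pb-const _))) (pb-literals d pf)
  pb-literals (((true , o) , s) ∷ d)  pf = pb-+ (pb-+ (pb-const 1) (pb-+ (pb-unary pf) (pb-+ (pb-unary pf) (pb-const _)))) (pb-literals d pf)

  pb-block : ∀ B {f} → PolyBounded f → PolyBounded (λ n → blockCost B (f n))
  pb-block []      pf = pb-const 1
  pb-block (d ∷ B) pf = pb-+ (pb-+ (pb-const _) (pb-literals d pf)) (pb-block B pf)

  pb-generate : PolyBounded generateCost
  pb-generate = pb-+ pb-setup (pb-+ (pb-unary pL) (pb-+ (pb-unary pN) (pb-+ (pb-const 1) (pb-+ pb-initial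
      (pb-+ (pb-const 1) (pb-+ (pb-const 1) (pb-* pN (pb-suc (one law)))))))))
    where
      pP : PolyBounded P
      pP = pb-eval p pb-id
      pDouble : PolyBounded double
      pDouble = pb-≤ double≤ (pb-+ pb-id pb-id)
      pD : PolyBounded D
      pD = pb-+ pP (pb-+ (pb-const 2) pDouble)
      pT : PolyBounded T
      pT = pb-eval q pD
      pb : PolyBounded b
      pb = pb-+ pT (pb-const 4)
      pW : PolyBounded W
      pW = pb-suc (pb-+ pD pb)
      pL : PolyBounded L
      pL = pb-suc pW
      pT2 : PolyBounded (λ n → T n + 2)
      pT2 = pb-+ pT (pb-const 2)
      pN : PolyBounded N
      pN = pb-* pT2 pW
      pSpan : PolyBounded span
      pSpan = pb-+ (pb-suc (pb-+ pDouble (pb-+ (pb-const 2) (pb-+ pP (pb-+ pb (pb-const 1)))))) (pb-+ pL pN)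
      one : ∀ B → PolyBounded (λ n → singleCost B (span n))
      one B = pb-+ (pb-block B pSpan) (pb-const 1)
      pb-setup : PolyBounded setupCost
      pb-setup = pb-+ (pb-const 1) (pb-+ (pb-polyCost p pb-id) (pb-+ (pb-const 3) (pb-+ (pb-loop pb-id (pb-const 2)) (pb-+ (pb-const 2)
        (pb-+ (pb-loop pP (pb-const 1)) (pb-+ (pb-polyCost q pD) (pb-+ (pb-const 6) (pb-+ (pb-const 1) (pb-+ (pb-loop pD (pb-const 1)) (pb-+ (pb-const 3)
        (pb-+ (pb-loop pT2 (pb-loop pW (pb-const 1))) (pb-const 1))))))))))))
      pb-initial : PolyBounded (λ n → initialCost n (P n) (b n) (span n))
      pb-initial = pb-+ (one first) (pb-+ (pb-loop pb-id (pb-+ (pb-const 1) (pb-+ (pb-+ (one (bit true)) (one (bit true))) (pb-+ (one (bit false)) (one (bit false))))))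
        (pb-+ (pb-+ (one (bit false)) (one (bit true))) (pb-+ (pb-loop pP (one open-bit)) (pb-+ (pb-loop pb (one blank)) (one last)))))

  generated-polyTime : PolyTimeComputable generated
  generated-polyTime = machine (complete generate) , proj₁ bound , λ x →
    complete-computes (proj₂ (tri-generate x)) (nonempty ((L (length x) + N (length x)) * K)) (proj₂ bound (length x))
    where
      bound : PolyBounded (λ n → total (generateCost n) n)
      bound = pb-total pb-generate
      nonempty : ∀ k {w} → 0 < length (encNat k ++ w)
      nonempty zero    = s≤s z≤n
      nonempty (suc k) = s≤s z≤n

-- The reduction for a given language

module Reduction (L : Language) (p : Poly) (R : Str → Str → Bool) (M : TM) (q : Poly)
  (runs : ∀ x y → Σ (Config M) λ c →
    haltsWithin M (evalPoly q (length (pair x y))) (initial M (pair x y)) ≡ just c × output M c ≡ R x y ∷ [])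
  (correct : ∀ x → L x ⇔ IsMersenne (countWitnesses (R x) (evalPoly p (length x)))) where

  open Tableau M using (K; encCell; decCell; decCell-encCell; wall₀; wall; sym₁)
  open Encoding M K encCell decCell decCell-encCell using (exactly; bitCell; free; transition; opening; closing; initialBlocks; module Formula)
  open Generator K (exactly wall₀) (exactly wall) (exactly (sym₁ zero)) free (exactly ∘ bitCell) transition p q
    (2 ^ 15) fromBits (toBits 15) toBits-fromBits
    using (generated; generated-polyTime; pairOf) renaming (P to witnesses; D to inputLength; T to time; L to lagOf; N to lawCount; b to blankCount)

  runsOn : ∀ x y → length y ≡ witnesses (length x) → Σ (Config M) λ c →
    haltsWithin M (time (length x)) (initial M (pair x y)) ≡ just c × output M c ≡ R x y ∷ []
  runsOn x y |y| with runs x y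
  ... | c , h , out = c , subst (λ k → haltsWithin M (evalPoly q k) (initial M (pair x y)) ≡ just c)
        (trans (length-pair x y) (cong (_+ (2 + double (length x))) |y|)) h , out

  module At (x : Str) = Formula x (witnesses (length x)) (time (length x)) (R x) (runsOn x)

  private
    blocks≡ : ∀ x → initialBlocks x (witnesses (length x)) (blankCount (length x)) ≡
      (exactly wall₀ ∷ concatMap pairOf x ++ exactly (bitCell false) ∷ exactly (bitCell true) ∷ []) ++
      replicate (witnesses (length x)) free ++ replicate (blankCount (length x)) (exactly (sym₁ zero)) ++ exactly wall ∷ []
    blocks≡ x = cong₂ (λ as bs → (exactly wall₀ ∷ as) ++ replicate (witnesses (length x)) free ++ bs) (bits x) (blanks (blankCount (length x)))
      where
        bits : ∀ x → map exactly (map bitCell (pairPrefix x)) ≡ concatMap pairOf x ++ exactly (bitCell false) ∷ exactly (bitCell true) ∷ []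
        bits []      = refl
        bits (d ∷ x) = cong (λ Bs → exactly (bitCell d) ∷ exactly (bitCell d) ∷ Bs) (bits x)
        blanks : ∀ k → map exactly (closing k) ≡ replicate k (exactly (sym₁ zero)) ++ exactly wall ∷ []
        blanks zero    = refl
        blanks (suc k) = cong (exactly (sym₁ zero) ∷_) (blanks k)

    -- The numbers of `Formula` and those of the generator agree by computation. Only the initial
    -- blocks, assembled differently on the two sides, have to be compared.
    encCNF≡ : ∀ x → encCNF (At.formula x) ≡ generated x
    encCNF≡ x = trans (At.encCNF-formula x) (cong (λ Bs → encNat ((lagOf n + lawCount n) * K) ++
        enc (sequence 0 Bs ++ sequence 0 (replicate (lawCount n) transition))) (blocks≡ x))
      where
        n = length x
        open Blocks K (lagOf n)

  reduction : L ≤ₚ MersenneNumberSAT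
  reduction = generated , generated-polyTime , λ x →
    let open Equivalence
        φ = mersenneSAT-encCNF (At.formula x)
    in mk⇔
      (λ l → subst MersenneNumberSAT (encCNF≡ x) (from φ (subst IsMersenne (sym (At.#sat-formula x)) (to (correct x) l))))
      (λ s → from (correct x) (subst IsMersenne (At.#sat-formula x) (to φ (subst MersenneNumberSAT (sym (encCNF≡ x)) s))))

theorem1 : MNS MersenneNumberSAT × ((L : Language) → MNS L → L ≤ₚ MersenneNumberSAT)
theorem1 = mersenneSAT∈MNS ,
  λ { L (p , R , (M , q , runs) , correct) → Reduction.reduction L p R M q runs correct }
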